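{- Let $n>1$ and let $\tau_n$ be a bijection on the set of partitions of $n$ obtained as follows: list the partitions of $n$ in weakly increasing order of crank and, separately, in weakly increasing order of rank (ties broken arbitrarily); then $\tau_n$ sends the $i$-th partition of the first list to the $i$-th partition of the second list. Then $\operatorname{ospt}(n)$ equals the number of partitions $\lambda$ of $n$ such that $\operatorname{crank}(\lambda)-\operatorname{rank}(\tau_n(\lambda))=1$.
   Context: For a partition $\lambda$, $\operatorname{rank}(\lambda)$ is its largest part minus its number of parts. $\operatorname{crank}(\lambda)$ is the largest part of $\lambda$ if $\lambda$ contains no part equal to $1$; otherwise it is the number of parts larger than the number of ones minus the number of ones. For $n>1$, $N(m,n)$ is the number of partitions of $n$ with rank $m$ and $M(m,n)$ is the number of partitions of $n$ with crank $m$. The function is $\operatorname{ospt}(n)=\sum_{m\geq 0}mM(m,n)-\sum_{m\geq 0}mN(m,n)$. -}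

module Defs where

open import Data.Nat as ℕ using (ℕ; zero; suc; _∸_; _⊓_; _≤_; _<_; _≥_; _>_; z≤n; s≤s; _<?_)
open import Data.Nat.ListAction using (sum)
import Data.Nat.Properties as ℕ
open import Data.Integer as ℤ using (ℤ; +_)
import Data.Integer.Properties as ℤ
open import Data.Fin as Fin using (Fin)
open import Data.List using (List; []; _∷_; [_]; map; concatMap; length; filter; upTo)
open import Data.List.Properties using (∷-injectiveˡ; ∷-injectiveʳ; filter-none; length-filter)
open import Data.List.Extrema.Nat using (max; max≤v⁺)
open import Data.List.Membership.Propositional using (_∈_; find; lose)
open import Data.List.Membership.Propositional.Properties using (∈-map⁺; ∈-map⁻; ∈-concatMap⁺; ∈-concatMap⁻; ∈-upTo⁺; ∈-upTo⁻)
open import Data.List.Relation.Unary.All as All using (All; []; _∷_)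
import Data.List.Relation.Unary.All.Properties as All
import Data.List.Relation.Unary.AllPairs as AllPairs
import Data.List.Relation.Unary.AllPairs.Properties as AllPairs
open import Data.List.Relation.Unary.Any using (here)
open import Data.List.Relation.Unary.Linked as Linked using (Linked; []; [-]; _∷_)
open import Data.List.Relation.Unary.Unique.Propositional using (Unique; []; _∷_)
import Data.List.Relation.Unary.Unique.Propositional.Properties as Unique
open import Data.Product using (_×_; _,_)
open import Function.Bundles using (_⤖_; module Bijection)
open import Relation.Binary.PropositionalEquality using (_≡_; _≢_; refl; sym; trans; cong; subst)
open import Relation.Unary using (Pred; Decidable)

open Bijection using (to)

record Partition (n : ℕ) : Set where
  constructor partition
  field
    parts             : List ℕ
    weakly-decreasing : Linked _≥_ parts
    positive          : All (_> 0) parts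
    sums-to           : sum parts ≡ n

open Partition public

Partition-ext : ∀ {n} {π ρ : Partition n} → parts π ≡ parts ρ → π ≡ ρ
Partition-ext {π = partition _ d p s} {partition _ d′ p′ s′} refl
  with refl ← Linked.irrelevant ℕ.≤-irrelevant d d′
     | refl ← All.irrelevant ℕ.≤-irrelevant p p′
     | refl ← ℕ.≡-irrelevant s s′ = refl

module _ {n : ℕ} where

  largestPart : Partition n → ℕ
  largestPart π = max 0 (parts π)

  numberOfParts : Partition n → ℕ
  numberOfParts π = length (parts π)

  numberOfOnes : Partition n → ℕ
  numberOfOnes π = length (filter (ℕ._≟ 1) (parts π))

  numberOfPartsLargerThan : ℕ → Partition n → ℕ
  numberOfPartsLargerThan k π = length (filter (k <?_) (parts π))

  rank : Partition n → ℤ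
  rank π = + largestPart π ℤ.- + numberOfParts π

  crank : Partition n → ℤ
  crank π with numberOfOnes π
  ... | zero      = + largestPart π
  ... | ω@(suc _) = + numberOfPartsLargerThan ω π ℤ.- + ω

-- Lists of positive integers xs with sum n such that k ∷ xs is weakly
-- decreasing, by choice of the first part suc j.  The first argument only
-- ensures termination; any value ≥ n gives the full list.
enumerate : (fuel k n : ℕ) → List (List ℕ)
enumerate _       k zero    = [ [] ]
enumerate zero    k (suc n) = []
enumerate (suc f) k (suc n) =
  concatMap (λ j → map (suc j ∷_) (enumerate f (suc j) (n ∸ j))) (upTo (k ⊓ suc n))

Enumerated : (k n : ℕ) → List ℕ → Set
Enumerated k n xs = Linked _≥_ (k ∷ xs) × All (_> 0) xs × sum xs ≡ n

enumerate-sound : ∀ f k n {xs} → xs ∈ enumerate f k n → Enumerated k n xs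
enumerate-sound zero    k zero (here refl) = [-] , [] , refl
enumerate-sound (suc f) k zero (here refl) = [-] , [] , refl
enumerate-sound (suc f) k (suc n) xs∈
  with j , j∈ , xs∈j ← find (∈-concatMap⁻ (λ j → map (suc j ∷_) (enumerate f (suc j) (n ∸ j))) {xs = upTo (k ⊓ suc n)} xs∈)
  with ys , ys∈ , refl ← ∈-map⁻ (suc j ∷_) xs∈j
  with d , p , s ← enumerate-sound f (suc j) (n ∸ j) ys∈ =
    ℕ.≤-trans (∈-upTo⁻ j∈) (ℕ.m⊓n≤m k (suc n)) ∷ d ,
    s≤s z≤n ∷ p ,
    cong suc (trans (cong (j ℕ.+_) s) (ℕ.m+[n∸m]≡n (ℕ.≤-pred (ℕ.≤-trans (∈-upTo⁻ j∈) (ℕ.m⊓n≤n k (suc n))))))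

enumerate-complete : ∀ f k n {xs} → n ≤ f → Enumerated k n xs → xs ∈ enumerate f k n
enumerate-complete zero    k zero {[]}          _ _ = here refl
enumerate-complete (suc f) k zero {[]}          _ _ = here refl
enumerate-complete f       k zero {suc j ∷ xs}  _ (_ , _ , ())
enumerate-complete f       k n    {zero ∷ xs}   _ (_ , () ∷ _ , _)
enumerate-complete (suc f) k (suc n) {[]}       _ (_ , _ , ())
enumerate-complete (suc f) k (suc n) {suc j ∷ xs} (s≤s n≤f) (k≥ ∷ d , _ ∷ p , s) =
  ∈-concatMap⁺ (λ j → map (suc j ∷_) (enumerate f (suc j) (n ∸ j)))
    (lose (∈-upTo⁺ (ℕ.⊓-glb k≥ (s≤s j≤n)))
          (∈-map⁺ (suc j ∷_) (enumerate-complete f (suc j) (n ∸ j) (ℕ.≤-trans (ℕ.m∸n≤m n j) n≤f)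
            (d , p , sym (trans (cong (_∸ j) (sym s′)) (ℕ.m+n∸m≡n j (sum xs)))))))
  where
  s′ : j ℕ.+ sum xs ≡ n
  s′ = ℕ.suc-injective s
  j≤n : j ≤ n
  j≤n = subst (j ≤_) s′ (ℕ.m≤m+n j (sum xs))

enumerate-unique : ∀ f k n → Unique (enumerate f k n)
enumerate-unique zero    k zero    = [] ∷ []
enumerate-unique (suc f) k zero    = [] ∷ []
enumerate-unique zero    k (suc n) = []
enumerate-unique (suc f) k (suc n) = Unique.concat⁺
  (All.map⁺ (All.tabulate λ {j} _ → Unique.map⁺ ∷-injectiveʳ (enumerate-unique f (suc j) (n ∸ j))))
  (AllPairs.map⁺ (AllPairs.map disjoint (Unique.upTo⁺ (k ⊓ suc n))))
  where
  disjoint : ∀ {i j} → i ≢ j → ∀ {xs} →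
             xs ∈ map (suc i ∷_) (enumerate f (suc i) (n ∸ i)) ×
             xs ∈ map (suc j ∷_) (enumerate f (suc j) (n ∸ j)) → _
  disjoint {i} {j} i≢j (p , q)
    with _ , _ , refl ← ∈-map⁻ (suc i ∷_) p
    with _ , _ , eq ← ∈-map⁻ (suc j ∷_) q = i≢j (ℕ.suc-injective (∷-injectiveˡ eq))

toPartition : ∀ {k n xs} → Enumerated k n xs → Partition n
toPartition {xs = xs} (d , p , s) = partition xs (Linked.tail d) p s

partitions : (n : ℕ) → List (Partition n)
partitions n = All.reduce toPartition (All.tabulate (enumerate-sound n n n))

private
  parts-reduce : ∀ {k n xss} (es : All (Enumerated k n) xss) →
                 map parts (All.reduce toPartition es) ≡ xss
  parts-reduce []       = refl
  parts-reduce (_ ∷ es) = cong (_ ∷_) (parts-reduce es)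

  decreasing-from-sum : ∀ {xs} → Linked _≥_ xs → Linked _≥_ (sum xs ∷ xs)
  decreasing-from-sum []          = [-]
  decreasing-from-sum {x ∷ xs} l = ℕ.m≤m+n x (sum xs) ∷ l

partitions-complete : ∀ {n} (π : Partition n) → π ∈ partitions n
partitions-complete {n} π@(partition xs d p refl)
  with ρ , ρ∈ , eq ← ∈-map⁻ parts (subst (xs ∈_) (sym (parts-reduce (All.tabulate (enumerate-sound n n n))))
                       (enumerate-complete n n n ℕ.≤-refl (decreasing-from-sum d , p , refl)))
  with refl ← Partition-ext {π = π} {ρ} eq = ρ∈

partitions-unique : ∀ n → Unique (partitions n)
partitions-unique n = Unique.map⁻ {f = parts}
  (subst Unique (sym (parts-reduce (All.tabulate (enumerate-sound n n n)))) (enumerate-unique n n n))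

p : ℕ → ℕ
p n = length (partitions n)

count : ∀ {n ℓ} {P : Pred (Partition n) ℓ} → Decidable P → ℕ
count {n} P? = length (filter P? (partitions n))

N : ℤ → ℕ → ℕ
N m n = count {n} (λ π → rank π ℤ.≟ m)

-- For n ≤ 1 this is the literal count, not the convention read off the crank
-- generating function.
M : ℤ → ℕ → ℕ
M m n = count {n} (λ π → crank π ℤ.≟ m)

-- The sums over m ≥ 0 stop at m = n; N-vanishes and M-vanishes below show
-- that all later terms are zero.
ospt : ℕ → ℤ
ospt n = + sum (map (λ m → m ℕ.* M (+ m) n) (upTo (suc n)))
     ℤ.- + sum (map (λ m → m ℕ.* N (+ m) n) (upTo (suc n)))

private
  parts≤sum : ∀ xs → All (_≤ sum xs) xs
  parts≤sum []       = []
  parts≤sum (x ∷ xs) = ℕ.m≤m+n x (sum xs) ∷ All.map (λ le → ℕ.≤-trans le (ℕ.m≤n+m (sum xs) x)) (parts≤sum xs)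

  length≤sum : ∀ {xs} → All (_> 0) xs → length xs ≤ sum xs
  length≤sum []       = z≤n
  length≤sum (x ∷ xs) = ℕ.+-mono-≤ x (length≤sum xs)

  largestPart≤n : ∀ {n} (π : Partition n) → largestPart π ≤ n
  largestPart≤n (partition xs _ _ refl) = max≤v⁺ {xs = xs} z≤n (parts≤sum xs)

rank≤n : ∀ {n} (π : Partition n) → rank π ℤ.≤ + n
rank≤n π = ℤ.≤-trans (ℤ.i-j≤i _ (+ numberOfParts π)) (ℤ.+≤+ (largestPart≤n π))

crank≤n : ∀ {n} (π : Partition n) → crank π ℤ.≤ + n
crank≤n π with numberOfOnes π
... | zero      = ℤ.+≤+ (largestPart≤n π)
... | ω@(suc _) = ℤ.≤-trans (ℤ.i-j≤i _ (+ ω)) (ℤ.+≤+ (ℕ.≤-trans (length-filter (ω <?_) (parts π))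
                    (subst (_ ≤_) (sums-to π) (length≤sum (positive π)))))

private
  count-vanishes : ∀ {n} (stat : Partition n → ℤ) → (∀ π → stat π ℤ.≤ + n) →
                   ∀ {m} → m > n → count (λ π → stat π ℤ.≟ + m) ≡ 0
  count-vanishes {n} stat bound {m} m>n = cong length (filter-none (λ π → stat π ℤ.≟ + m) {partitions n}
    (All.tabulate λ {π} _ eq → ℕ.<⇒≱ m>n (ℤ.drop‿+≤+ (subst (ℤ._≤ _) eq (bound π)))))

N-vanishes : ∀ {m n} → m > n → N (+ m) n ≡ 0
N-vanishes = count-vanishes rank rank≤n

M-vanishes : ∀ {m n} → m > n → M (+ m) n ≡ 0
M-vanishes = count-vanishes crank crank≤n

-- A listing of the partitions of n, each occurring exactly once.
Listing : ℕ → Set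
Listing n = Fin (p n) ⤖ Partition n

WeaklyIncreasing : ∀ {n} → (Partition n → ℤ) → Listing n → Set
WeaklyIncreasing stat l = ∀ {i j} → i Fin.≤ j → stat (to l i) ℤ.≤ stat (to l j)

-- The listings are part of the data, so every way of breaking ties is covered.
record MatchesCrankWithRank {n : ℕ} (τ : Partition n ⤖ Partition n) : Set where
  field
    byCrank      : Listing n
    byRank       : Listing n
    crank-sorted : WeaklyIncreasing crank byCrank
    rank-sorted  : WeaklyIncreasing rank byRank
    matches      : ∀ i → to τ (to byCrank i) ≡ to byRank i

{-# OPTIONS --safe #-}
-- Write M(≥m) and N(≥m) for the numbers of partitions of n with crank ≥ m and
-- with rank ≥ m.  If, for m ≥ 1,
--     N(≥m) ≤ M(≥m),   M(≥m+1) ≤ N(≥m),   N(≤-m) ≤ M(≤-m),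
-- then comparing the i-th entries c and r of the two sorted lists shows that
-- c - r is 0 or 1 when c > 0, and that r ≤ 0 and c ≤ r when c ≤ 0.  Hence
-- max(c,0) - max(r,0) is 1 if c - r = 1 and 0 otherwise; summing over i gives
-- the theorem.
--
-- By Dyson, M(≥m) and M(≤-m) both count the set X(m) of the partitions such that
-- λ_{j+1} = j + m for some j ≥ 0: for M(≤-m), replace that part by j + m ones.
-- So it remains to map {rank ≥ m} \ X(m) injectively into X(m) \ {rank ≥ m}, and
-- X(m+1) \ {rank ≥ m} into {rank ≥ m} \ X(m+1).
--
-- Cut the boundary path of the partition at the diagonal on which X(m) is read
-- off.  The vertical steps above the cut and the horizontal steps below it form
-- two finite sets of distances a and b, and the size of the partition is the sum
-- of all distances plus the number of elements of a, up to a constant.  The rank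
-- compares the largest elements of a and b.  In these coordinates all maps move a
-- bounded number of extreme elements, except for one kind of step: part of a and
-- the part of b at a fixed offset from it are exchanged, up to the first point
-- where b is ahead by one (the reflection principle).
module Submission where

open import Defs
open import Data.Bool using (Bool; true; false; not)
open import Data.Bool.Properties using (not-injective)
open import Data.Empty using (⊥; ⊥-elim)
open import Data.Fin as Fin using (Fin)
import Data.Fin.Properties as Fin
import Data.Integer as ℤ
import Data.Integer.Properties as ℤ
open import Data.List using (List; []; _∷_; _++_; _∷ʳ_; [_]; map; length; reverse; replicate; filter; allFin; upTo)
open import Data.List.Extrema.Nat using (max; max≤v⁺; xs≤max)
open import Data.List.Membership.Propositional using (_∈_)
open import Data.List.Membership.Propositional.Properties using (∈-∃++; ∈-filter⁺; ∈-++⁻; ∈-++⁺ˡ; ∈-++⁺ʳ; ∈-map⁺; ∈-allFin)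
open import Data.List.Membership.Propositional.Properties.WithK using (unique∧set⇒bag)
open import Data.List.Properties using (length-++; length-reverse; length-map; length-replicate; length-filter; ∷-injective; ∷-injectiveˡ; ∷-injectiveʳ; ∷ʳ-injective; ++-assoc; ++-identityʳ; ++-cancelʳ; unfold-reverse; reverse-involutive; reverse-injective; reverse-++; reverse-map; map-++; map-∘; map-cong; map-injective; filter-++; filter-accept; filter-reject; filter-none; upTo-∷ʳ)
open import Data.List.Relation.Binary.BagAndSetEquality using (∼bag⇒↭)
open import Data.List.Relation.Binary.Permutation.Propositional using (_↭_)
open import Data.List.Relation.Binary.Permutation.Propositional.Properties using (filter-↭; ↭-length) renaming (map⁺ to ↭-map⁺)
open import Data.List.Relation.Unary.All as All using (All; []; _∷_)
import Data.List.Relation.Unary.All.Properties as All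
open import Data.List.Relation.Unary.AllPairs using ([]; _∷_)
open import Data.List.Relation.Unary.Any using (here; there)
open import Data.List.Relation.Unary.Linked as Linked using (Linked; []; [-]; _∷_)
open import Data.List.Relation.Unary.Unique.Propositional using (Unique)
open import Data.List.Relation.Unary.Unique.Propositional.Properties using (filter⁺; allFin⁺) renaming (map⁺ to unique-map⁺)
open import Data.Nat as ℕ using (ℕ; zero; suc; _+_; _*_; _∸_; _≤_; _<_; _≥_; _>_; z≤n; s≤s; s≤s⁻¹; _<?_; _≤?_)
open import Data.Nat.ListAction using (sum)
open import Data.Nat.ListAction.Properties using (sum-++; sum-↭)
open import Data.Nat.Properties hiding (_≟_; _<?_; _≤?_)
open import Data.Nat.Tactic.RingSolver using (solve-∀)
open import Data.Product using (_×_; _,_; ∃; ∃₂; proj₁; proj₂)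
open import Data.Sum using (_⊎_; inj₁; inj₂)
open import Data.Unit using (⊤; tt)
open import Function using (_∘_)
open import Function.Bundles using (_⤖_; mk⇔; module Bijection)
open import Level using (0ℓ)
open import Relation.Binary.PropositionalEquality hiding ([_])
open import Relation.Nullary using (¬_; Dec; yes; no)
open import Relation.Nullary.Decidable using (¬?; decidable-stable)
open import Relation.Unary using (Pred; Decidable)

-- Every map has to keep the size, and this shapes all of them. Moving extreme elements succeeds
-- except when the two largest elements of a are adjacent and 0 lies in neither set. There the sum
-- of distances is off by an amount that depends on m, so no fixed move corrects it. A reflection
-- does: on balance it moves one element from b to a, and it lowers the sum by exactly the chosen
-- offset, whatever the two sets are. It can be undone because the image reaches the opposite lead
-- for the first time at the same point. For m = 1 the offset m - 2 would be negative, and the two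
-- sets trade roles instead. The count of M(≥m) goes through complements: the conjugate of a
-- partition outside X(m) satisfies λ_{m+i} = i for some i ≥ 0. If i > 0, dropping the first m parts
-- leaves a partition in X(1), and replacing its distinguished part by ones gives crank < m. If i =
-- 0, there are fewer than m parts, and such partitions are matched separately.

open Bijection using (to; injective; surjective)

-- A linear consequence of a ≡ b is reduced to an identity for the ring solver.
infix 4 _by_
_by_ : ∀ {x y a b} → a ≡ b → x + b ≡ y + a → x ≡ y
_by_ {x} {y} {a} refl eq = +-cancelʳ-≡ a x y eq

infixr 5 _&_
_&_ : ∀ {a b c d} → a ≡ b → c ≡ d → a + c ≡ b + d
_&_ = cong₂ _+_

-- Finite sets as lists of truth values: number of elements and sum of positions

cnt : List Bool → ℕ
cnt []           = 0
cnt (true  ∷ xs) = suc (cnt xs)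
cnt (false ∷ xs) = cnt xs

-- Sum of the positions of the true entries; tw counts positions from the end.
wt : List Bool → ℕ
wt []       = 0
wt (_ ∷ xs) = cnt xs + wt xs

tw : List Bool → ℕ
tw []           = 0
tw (true  ∷ xs) = length xs + tw xs
tw (false ∷ xs) = tw xs

cnt-++ : ∀ xs ys → cnt (xs ++ ys) ≡ cnt xs + cnt ys
cnt-++ []           ys = refl
cnt-++ (true  ∷ xs) ys = cong suc (cnt-++ xs ys)
cnt-++ (false ∷ xs) ys = cnt-++ xs ys

cnt≤length : ∀ xs → cnt xs ≤ length xs
cnt≤length []           = z≤n
cnt≤length (true  ∷ xs) = s≤s (cnt≤length xs)
cnt≤length (false ∷ xs) = m≤n⇒m≤1+n (cnt≤length xs)

wt-++ : ∀ xs ys → wt (xs ++ ys) ≡ wt xs + wt ys + length xs * cnt ys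
wt-++ []       ys = sym (+-identityʳ (wt ys))
wt-++ (x ∷ xs) ys = (cnt-++ xs ys & wt-++ xs ys) by arith (cnt xs) (cnt ys) (wt xs) (wt ys) (length xs) (cnt (xs ++ ys)) (wt (xs ++ ys))
  where
  arith : ∀ a b c d l x y → x + y + (a + b + (c + d + l * b)) ≡ a + c + d + (b + l * b) + (x + y)
  arith = solve-∀

cnt-∷ʳ : ∀ xs b → cnt (xs ∷ʳ b) ≡ cnt xs + cnt [ b ]
cnt-∷ʳ xs b = cnt-++ xs [ b ]

wt-∷ʳ : ∀ xs b → wt (xs ∷ʳ b) ≡ wt xs + length xs * cnt [ b ]
wt-∷ʳ xs b = trans (wt-++ xs [ b ]) (cong (_+ length xs * cnt [ b ]) (+-identityʳ (wt xs)))

length-∷ʳ : ∀ (xs : List Bool) b → length (xs ∷ʳ b) ≡ suc (length xs)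
length-∷ʳ xs b = trans (length-++ xs) (+-comm (length xs) 1)

cnt-reverse : ∀ xs → cnt (reverse xs) ≡ cnt xs
cnt-reverse []       = refl
cnt-reverse (x ∷ xs) = trans (cong cnt (unfold-reverse x xs)) (trans (cnt-∷ʳ (reverse xs) x) (aux x (cnt-reverse xs)))
  where
  aux : ∀ {n} x → n ≡ cnt xs → n + cnt [ x ] ≡ cnt (x ∷ xs)
  aux true  refl = +-comm (cnt xs) 1
  aux false refl = +-identityʳ (cnt xs)

wt-reverse : ∀ xs → wt (reverse xs) ≡ tw xs
wt-reverse []       = refl
wt-reverse (x ∷ xs) = trans (cong wt (unfold-reverse x xs))
  (trans (wt-∷ʳ (reverse xs) x) (trans (cong₂ (λ a b → a + b * cnt [ x ]) (wt-reverse xs) (length-reverse xs)) (aux x)))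
  where
  aux : ∀ x → tw xs + length xs * cnt [ x ] ≡ tw (x ∷ xs)
  aux true  = trans (cong (tw xs +_) (*-identityʳ (length xs))) (+-comm (tw xs) (length xs))
  aux false = trans (cong (tw xs +_) (*-zeroʳ (length xs))) (+-identityʳ (tw xs))

split : ∀ {A : Set} k (xs : List A) → k ≤ length xs → ∃₂ λ ys zs → xs ≡ ys ++ zs × length ys ≡ k
split zero    xs       _         = [] , xs , refl , refl
split (suc k) (x ∷ xs) (s≤s k≤) with ys , zs , refl , refl ← split k xs k≤ = x ∷ ys , zs , refl , refl

++-split-injective : ∀ {A : Set} (xs ys : List A) {xs′ ys′} → length xs ≡ length ys →
                     xs ++ xs′ ≡ ys ++ ys′ → xs ≡ ys × xs′ ≡ ys′
++-split-injective []       []       _  eq = refl , eq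
++-split-injective (x ∷ xs) (y ∷ ys) le eq
  with refl , eq′ ← ∷-injective eq
  with refl , eq″ ← ++-split-injective xs ys (suc-injective le) eq′ = refl , eq″

snoc : ∀ {A : Set} (xs : List A) → 0 < length xs → ∃₂ λ ys y → xs ≡ ys ∷ʳ y
snoc (x ∷ [])     _ = [] , x , refl
snoc (x ∷ y ∷ xs) _ with ys , z , eq ← snoc (y ∷ xs) (s≤s z≤n) = x ∷ ys , z , cong (x ∷_) eq

-- Reflection: x and y are exchanged entry by entry up to the first point where y
-- has k more true entries than x.
data Swap : ℕ → (x y x′ y′ : List Bool) → Set where
  done : ∀ {x y} → Swap 0 x y x y
  keep : ∀ {k x y x′ y′} b → Swap (suc k) x y x′ y′ → Swap (suc k) (b ∷ x) (b ∷ y) (b ∷ x′) (b ∷ y′)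
  up   : ∀ {k x y x′ y′} → Swap k x y x′ y′ → Swap (suc k) (false ∷ x) (true ∷ y) (true ∷ x′) (false ∷ y′)
  down : ∀ {k x y x′ y′} → Swap (suc (suc k)) x y x′ y′ → Swap (suc k) (true ∷ x) (false ∷ y) (false ∷ x′) (true ∷ y′)

-- The lead of `y` over `x` starts at 0, changes by at most one per entry and ends at `k` or more,
-- so it takes the value `k` on the way.
swap : ∀ k x y → length x ≡ length y → cnt x + k ≤ cnt y → ∃₂ (Swap k x y)
swap zero    x           y           _  _  = x , y , done
swap (suc k) []          []          _  ()
swap (suc k) (true ∷ x)  (true ∷ y)  le (s≤s h) with _ , _ , s ← swap (suc k) x y (suc-injective le) h = _ , _ , keep true s
swap (suc k) (false ∷ x) (false ∷ y) le h with _ , _ , s ← swap (suc k) x y (suc-injective le) h = _ , _ , keep false s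
swap (suc k) (false ∷ x) (true ∷ y)  le h
  with _ , _ , s ← swap k x y (suc-injective le) (s≤s⁻¹ (subst (_≤ suc (cnt y)) (+-suc (cnt x) k) h)) = _ , _ , up s
swap (suc k) (true ∷ x)  (false ∷ y) le h
  with _ , _ , s ← swap (suc (suc k)) x y (suc-injective le) (subst (_≤ cnt y) (sym (+-suc (cnt x) (suc k))) h) = _ , _ , down s

-- After the exchange `p` leads where the second list led before, and it reaches the lead `k` first
-- at the same point. So `p` and `q` show where the exchange ended.
swap-injective : ∀ {k x y z w p q} → Swap k x y p q → Swap k z w p q → x ≡ z × y ≡ w
swap-injective done        done         = refl , refl
swap-injective (keep b s)  (keep .b s′) with refl , refl ← swap-injective s s′ = refl , refl
swap-injective (up s)      (up s′)      with refl , refl ← swap-injective s s′ = refl , refl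
swap-injective (down s)    (down s′)    with refl , refl ← swap-injective s s′ = refl , refl

swap-lengthˡ : ∀ {k x y x′ y′} → Swap k x y x′ y′ → length x′ ≡ length x
swap-lengthˡ done       = refl
swap-lengthˡ (keep _ s) = cong suc (swap-lengthˡ s)
swap-lengthˡ (up s)     = cong suc (swap-lengthˡ s)
swap-lengthˡ (down s)   = cong suc (swap-lengthˡ s)

swap-lengthʳ : ∀ {k x y x′ y′} → Swap k x y x′ y′ → length y′ ≡ length y
swap-lengthʳ done       = refl
swap-lengthʳ (keep _ s) = cong suc (swap-lengthʳ s)
swap-lengthʳ (up s)     = cong suc (swap-lengthʳ s)
swap-lengthʳ (down s)   = cong suc (swap-lengthʳ s)

swap-cntˡ : ∀ {k x y x′ y′} → Swap k x y x′ y′ → cnt x′ ≡ k + cnt x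
swap-cntˡ done           = refl
swap-cntˡ (keep {k} true s)  = trans (cong suc (swap-cntˡ s)) (sym (+-suc (suc k) _))
swap-cntˡ (keep false s) = swap-cntˡ s
swap-cntˡ (up s)         = cong suc (swap-cntˡ s)
swap-cntˡ (down {k} s)   = trans (swap-cntˡ s) (sym (+-suc (suc k) _))

swap-cntʳ : ∀ {k x y x′ y′} → Swap k x y x′ y′ → k + cnt y′ ≡ cnt y
swap-cntʳ done           = refl
swap-cntʳ (keep {k} true s)  = trans (+-suc (suc k) _) (cong suc (swap-cntʳ s))
swap-cntʳ (keep false s) = swap-cntʳ s
swap-cntʳ (up s)         = cong suc (swap-cntʳ s)
swap-cntʳ (down {k} s)   = trans (+-suc (suc k) _) (swap-cntʳ s)

-- Exchanged entries keep their positions. A new pair of entries in front raises all later positions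
-- by one, and the two lists together keep their number of true entries.
swap-wt : ∀ {k x y x′ y′} → Swap k x y x′ y′ → wt x′ + wt y′ ≡ wt x + wt y
swap-wt-step : ∀ {k x y x′ y′} → Swap k x y x′ y′ →
               cnt x′ + wt x′ + (cnt y′ + wt y′) ≡ cnt x + wt x + (cnt y + wt y)

swap-wt done       = refl
swap-wt (keep _ s) = swap-wt-step s
swap-wt (up s)     = swap-wt-step s
swap-wt (down s)   = swap-wt-step s

swap-wt-step {k} {x} {y} {x′} {y′} s = (swap-cntˡ s & swap-cntʳ s & swap-wt s) by
    arith (cnt x) (wt x) (cnt y) (wt y) (cnt x′) (wt x′) (cnt y′) (wt y′) k
    where
    arith : ∀ a b c d a′ b′ c′ d′ k → a′ + b′ + (c′ + d′) + (k + a + (c + (b + d))) ≡ a + b + (c + d) + (a′ + (k + c′ + (b′ + d′)))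
    arith = solve-∀

-- The case m = 1.  The set a is listed in g from its largest element and b in v
-- from its smallest one; the run of consecutive elements at the top of a is
-- compared with the gap at the bottom of b.
data Run : (g v k w : List Bool) → Set where
  remove : ∀ {g v} → Run (true ∷ g) (true ∷ v) (false ∷ g) (false ∷ v)
  step   : ∀ {g v k w} → Run (true ∷ g) v k w → Run (true ∷ true ∷ g) (false ∷ v) (true ∷ k) (false ∷ w)
  lower  : ∀ {r q} → length q ≡ length r → Run (true ∷ false ∷ r) (false ∷ q ∷ʳ true) (true ∷ r) (true ∷ q)
  cross  : ∀ {r q r′ q′} → length q ≡ length r → Swap 1 (reverse r) q r′ q′ →
           Run (true ∷ false ∷ r) (false ∷ q ∷ʳ false) (false ∷ reverse r′) (true ∷ q′)

cross-bound : ∀ g q → 2 + cnt g ≤ cnt (q ∷ʳ false) → cnt (reverse g) + 1 ≤ cnt q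
cross-bound g q h = begin
  cnt (reverse g) + 1  ≡⟨ cong (_+ 1) (cnt-reverse g) ⟩
  cnt g + 1            ≤⟨ +-monoʳ-≤ (cnt g) (s≤s z≤n) ⟩
  cnt g + 2            ≡⟨ +-comm (cnt g) 2 ⟩
  2 + cnt g            ≤⟨ h ⟩
  cnt (q ∷ʳ false)     ≡⟨ cnt-∷ʳ q false ⟩
  cnt q + 0            ≡⟨ +-identityʳ (cnt q) ⟩
  cnt q                ∎
  where open ≤-Reasoning

-- `v` is longer than `g` by one but has at least two more true entries. Hence a run of true entries
-- in `g` against false ones in `v` ends before `g` is exhausted.
run : ∀ g v → length v ≡ suc (length g) → 2 + cnt g ≤ cnt v → ∃₂ (Run (true ∷ g) v)
run g           (true ∷ v)  le h = _ , _ , remove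
run []          (false ∷ v) le h with () ← ≤-trans h (≤-trans (cnt≤length v) (≤-reflexive (suc-injective le)))
run (true ∷ g)  (false ∷ v) le h with _ , _ , r ← run g v (suc-injective le) (≤-trans (n≤1+n _) h) = _ , _ , step r
run (false ∷ g) (false ∷ v) le h
  with q , b , refl ← snoc v (≤-trans (s≤s z≤n) (≤-reflexive (sym (suc-injective le))))
  with lq ← suc-injective (trans (sym (length-∷ʳ q b)) (suc-injective le))
  with b
... | true  = _ , _ , lower lq
... | false with _ , _ , s ← swap 1 (reverse g) q (trans (length-reverse g) (sym lq)) (cross-bound g q h) = _ , _ , cross lq s

-- The first entries of `k` and `w` tell the four constructors apart.
run-injective : ∀ {g v g′ v′ k w k′ w′} → Run g v k w → Run g′ v′ k′ w′ → k ≡ k′ → w ≡ w′ → g ≡ g′ × v ≡ v′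
run-injective remove     remove     refl refl = refl , refl
run-injective (step r)   (step r′)  refl refl with refl , refl ← run-injective r r′ refl refl = refl , refl
run-injective (lower _)  (lower _)  refl refl = refl , refl
run-injective (cross {r = r} {r′ = a} _ s) (cross {r = r₁} {r′ = b} _ s′) eq refl
  with refl ← reverse-injective {x = a} {y = b} (∷-injectiveʳ eq)
  with eq₁ , refl ← swap-injective s s′
  with refl ← reverse-injective {x = r} {y = r₁} eq₁ = refl , refl

-- This is what the case `step` of `run-weight` adds to the induction hypothesis.
run-count : ∀ {g v k w} → Run g v k w → cnt w + suc (length k) ≡ length g + cnt v
run-count (remove {g} {v}) = arith (cnt v) (length g)
  where
  arith : ∀ a b → a + suc (suc b) ≡ suc b + suc a
  arith = solve-∀
run-count (step {g} {v} {k} {w} r) = run-count r by arith (cnt w) (length k) (length g) (cnt v)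
  where
  arith : ∀ a b c d → a + suc (suc b) + (suc c + d) ≡ suc (suc c) + d + (a + suc b)
  arith = solve-∀
run-count (lower {r} {q} lq) = sym (cnt-∷ʳ q true) by arith (cnt q) (length r) (cnt (q ∷ʳ true))
  where
  arith : ∀ a b c → suc a + suc (suc b) + c ≡ suc (suc b) + c + (a + 1)
  arith = solve-∀
run-count (cross {r} {q} {r′} {q′} lq s) =
  (sym (cnt-∷ʳ q false) & swap-cntʳ s & trans (length-reverse r′) (trans (swap-lengthˡ s) (length-reverse r))) by
  arith (cnt q) (cnt q′) (length r) (cnt (q ∷ʳ false)) (length (reverse r′))
  where
  arith : ∀ a a′ b c l → suc a′ + suc (suc l) + (c + (a + b)) ≡ suc (suc b) + c + (a + 0 + (1 + a′ + l))
  arith = solve-∀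

run-balance : ∀ {g v k w} → Run g v k w → cnt w + cnt g ≡ cnt k + cnt v
run-balance (remove {g} {v}) = arith (cnt v) (cnt g)
  where
  arith : ∀ a b → a + suc b ≡ b + suc a
  arith = solve-∀
run-balance (step {g} {v} {k} {w} r) = trans (+-suc (cnt w) (suc (cnt g))) (cong suc (run-balance r))
run-balance (lower {r} {q} lq) = sym (cnt-∷ʳ q true) by arith (cnt q) (cnt r) (cnt (q ∷ʳ true))
  where
  arith : ∀ a b c → suc a + suc b + c ≡ suc b + c + (a + 1)
  arith = solve-∀
run-balance (cross {r} {q} {r′} {q′} lq s) =
  (sym (cnt-∷ʳ q false) & swap-cntʳ s & sym (trans (cnt-reverse r′) (trans (swap-cntˡ s) (cong suc (cnt-reverse r))))) by
  arith (cnt q) (cnt q′) (cnt r) (cnt (q ∷ʳ false)) (cnt (reverse r′))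
  where
  arith : ∀ a a′ b c l → suc a′ + suc b + (c + (a + l)) ≡ l + c + (a + 0 + (1 + a′ + suc b))
  arith = solve-∀

-- The two sides are the weights that `Valid₃` requires for `flip`, where `w` becomes `u′` and the
-- reverse of `k` becomes `v′`. The first lists start at the largest element, so their positions
-- count from the end. The multiple of `cnt v` stands for one of `cnt u` because `step` leaves
-- `cnt v` unchanged.
run-weight : ∀ {g v k w} → Run g v k w →
             2 * length k + wt w + tw k + 3 * cnt w + 2 ≡ length g + tw g + wt v + 3 * cnt v
run-weight (remove {g} {v}) = arith (length g) (cnt v) (wt v) (tw g)
  where
  arith : ∀ l a b c → 2 * suc l + (a + b) + c + 3 * a + 2 ≡ suc l + (l + c) + (a + b) + 3 * suc a
  arith = solve-∀
run-weight (step {g} {v} {k} {w} r) = (run-count r & run-weight r) by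
  arith (length k) (cnt w) (wt w) (tw k) (length g) (tw (true ∷ g)) (cnt v) (wt v)
  where
  arith : ∀ lk a b t lg tg c d → 2 * suc lk + (a + b) + (lk + t) + 3 * a + 2 + (suc lg + c + (suc lg + tg + d + 3 * c))
        ≡ suc (suc lg) + (suc lg + tg) + (c + d) + 3 * c + (a + suc lk + (2 * lk + b + t + 3 * a + 2))
  arith = solve-∀
run-weight (lower {r} {q} lq) = (sym (cnt-∷ʳ q true) & sym (cnt-∷ʳ q true) & sym (cnt-∷ʳ q true) & sym (cnt-∷ʳ q true) & sym (wt-∷ʳ q true) & sym lq) by
  arith (length r) (cnt q) (wt q) (tw r) (cnt (q ∷ʳ true)) (wt (q ∷ʳ true)) (length q)
  where
  arith : ∀ l a b t c d m → 2 * suc l + (a + b) + (l + t) + 3 * suc a + 2 + (c + (c + (c + (c + (d + m)))))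
        ≡ suc (suc l) + (suc l + t) + (c + d) + 3 * c + (a + 1 + (a + 1 + (a + 1 + (a + 1 + (b + m * 1 + l)))))
  arith = solve-∀
run-weight (cross {r} {q} {r′} {q′} lq s) =
  (sym (cnt-∷ʳ q false) & sym (cnt-∷ʳ q false) & sym (cnt-∷ʳ q false) & sym (cnt-∷ʳ q false) & sym (wt-∷ʳ q false) &
   swap-cntʳ s & swap-cntʳ s & swap-cntʳ s & swap-cntʳ s & trans (length-reverse r′) (trans (swap-lengthˡ s) (length-reverse r)) & 
   trans (length-reverse r′) (trans (swap-lengthˡ s) (length-reverse r)) & swap-wt s &
   trans (sym (wt-reverse (reverse r′))) (cong wt (reverse-involutive r′)) & wt-reverse r) by
  arith (length r) (cnt q) (wt q) (tw r) (cnt (q ∷ʳ false)) (wt (q ∷ʳ false)) (length q) (cnt q′) (wt q′) (wt r′) (wt (reverse r)) (tw (reverse r′)) (length (reverse r′))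
  where
  arith : ∀ l a b t c d m a′ b′ x y z l′ → 2 * suc l′ + (a′ + b′) + z + 3 * suc a′ + 2 + (c + (c + (c + (c + (d + (a + (a + (a + (a + (l + (l + (y + b + (x + t)))))))))))))
        ≡ suc (suc l) + (suc l + t) + (c + d) + 3 * c + (a + 0 + (a + 0 + (a + 0 + (a + 0 + (b + m * 0 + (1 + a′ + (1 + a′ + (1 + a′ + (1 + a′ + (l′ + (l′ + (x + b′ + (z + y)))))))))))))
  arith = solve-∀

-- Reflection at a given offset

≤-from-parts : ∀ {a b d x y} → a + b ≡ x → a ≤ d → d + y ≤ x → y ≤ b
≤-from-parts {a} {b} {d} {x} {y} refl a≤d d+y≤x = +-cancelˡ-≤ a y b (≤-trans (+-monoˡ-≤ y a≤d) d+y≤x)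

-- Reflection in which position i of u faces position i + d of v.
data Shift (d : ℕ) : (u v u′ v′ : List Bool) → Set where
  shift : ∀ {u p q u′ q′} → length p ≡ d → Swap 1 (u ∷ʳ false) q u′ q′ → Shift d u (p ++ q) u′ (p ++ q′)

shift-injective : ∀ {d u v u₀ v₀ u′ v′ v₀′} → Shift d u v u′ v′ → Shift d u₀ v₀ u′ v₀′ → v′ ≡ v₀′ → u ≡ u₀ × v ≡ v₀
shift-injective (shift {u} {p} lp s) (shift {u₀} {p₀} lp₀ s₀) eq
  with refl , refl ← ++-split-injective p p₀ (trans lp (sym lp₀)) eq
  with eq′ , refl ← swap-injective s s₀
  with refl , _ ← ∷ʳ-injective u u₀ eq′ = refl , refl

-- On balance one element passes from `v` to `u`, and a position in `v` is larger by `d` than the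
-- one it faces in `u`; this is the `d` in `wgt`.
record Shifted (d : ℕ) (u v u′ v′ : List Bool) : Set where
  constructor shifted
  field
    lenˡ : length u′ ≡ suc (length u)
    lenʳ : length v′ ≡ length v
    cntˡ : cnt u′ ≡ suc (cnt u)
    cntʳ : suc (cnt v′) ≡ cnt v
    wgt  : wt u′ + wt v′ + d ≡ wt u + wt v

shift-len : ∀ {pq p q u} → pq ≡ u + suc p → pq ≡ p + q → q ≡ suc u
shift-len {pq} {p} {q} {u} e0 e1 = (e0 & sym e1) by eq pq p q u
  where
  eq : ∀ pq p q u → q + (u + suc p + (pq)) ≡ suc u + (pq + (p + q))
  eq = solve-∀
shift-lenʳ : ∀ {x p q′ q y} → x ≡ p + q′ → q′ ≡ q → y ≡ p + q → x ≡ y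
shift-lenʳ {x} {p} {q′} {q} {y} e0 e1 e2 = (e0 & e1 & sym e2) by eq x p q′ q y
  where
  eq : ∀ x p q′ q y → x + (p + q′ + (q + (y))) ≡ y + (x + (q′ + (p + q)))
  eq = solve-∀
shift-cntʳ : ∀ {x p q′ q y} → x ≡ p + q′ → 1 + q′ ≡ q → y ≡ p + q → suc x ≡ y
shift-cntʳ {x} {p} {q′} {q} {y} e0 e1 e2 = (e0 & e1 & sym e2) by eq x p q′ q y
  where
  eq : ∀ x p q′ q y → suc x + (p + q′ + (q + (y))) ≡ y + (x + (1 + q′ + (p + q)))
  eq = solve-∀
shift-wgt : ∀ {lu lp cq cq′ wu wu′ wz wp wq wq′ wpq wpq′} → 1 + cq′ ≡ cq → wz ≡ wu + lu * 0 → wpq ≡ wp + wq + lp * cq → wpq′ ≡ wp + wq′ + lp * cq′ → wu′ + wq′ ≡ wz + wq → lp * 1 + lp * cq′ ≡ lp * cq → wu′ + wpq′ + lp ≡ wu + wpq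
shift-wgt {lu} {lp} {cq} {cq′} {wu} {wu′} {wz} {wp} {wq} {wq′} {wpq} {wpq′} _ e1 e2 e3 e4 e5 = (e1 & sym e2 & e3 & e4 & e5) by eq lu lp cq cq′ wu wu′ wz wp wq wq′ wpq wpq′
  where
  eq : ∀ lu lp cq cq′ wu wu′ wz wp wq wq′ wpq wpq′ → wu′ + wpq′ + lp + (wu + lu * 0 + (wpq + (wp + wq′ + lp * cq′ + (wz + wq + (lp * cq))))) ≡ wu + wpq + (wz + (wp + wq + lp * cq + (wpq′ + (wu′ + wq′ + (lp * 1 + lp * cq′)))))
  eq = solve-∀

shift-bound : ∀ a b → a + (b + 0 + 1) ≡ b + suc a
shift-bound = solve-∀

-- The first `d` entries of `v` face nothing and hold at most `d` true ones, so at least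
-- `suc (cnt u)` are left for the reflection. The rest of `v` is one entry longer than `u`, hence
-- the false entry appended to `u` in `Shift`.
shift-exists : ∀ d u v → length v ≡ length u + suc d → cnt u + suc d ≤ cnt v →
               ∃₂ λ u′ v′ → Shift d u v u′ v′ × Shifted d u v u′ v′
shift-exists d u v lv cv
  with p , q , refl , refl ← split d v (≤-trans (≤-trans (n≤1+n d) (m≤n+m (suc d) (length u))) (≤-reflexive (sym lv)))
  with lq ← shift-len {length (p ++ q)} {length p} {length q} lv (length-++ p {q})
  with u′ , q′ , s ← swap 1 (u ∷ʳ false) q (trans (length-∷ʳ u false) (sym lq))
         (≤-from-parts {d = length p} (sym (cnt-++ p q)) (cnt≤length p)
           (≤-trans (≤-reflexive (trans (cong (λ z → length p + (z + 1)) (cnt-∷ʳ u false)) (shift-bound (length p) (cnt u)))) cv))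
  = u′ , p ++ q′ , shift refl s , shifted
      (trans (swap-lengthˡ s) (length-∷ʳ u false))
      (shift-lenʳ {p = length p} (length-++ p {q′}) (swap-lengthʳ s) (length-++ p {q}))
      (trans (swap-cntˡ s) (cong suc (trans (cnt-∷ʳ u false) (+-identityʳ (cnt u)))))
      (shift-cntʳ {p = cnt p} (cnt-++ p q′) (swap-cntʳ s) (cnt-++ p q))
      (shift-wgt {length u} {length p} (swap-cntʳ s) (wt-∷ʳ u false) (wt-++ p q) (wt-++ p q′) (swap-wt s)
        (trans (sym (*-distribˡ-+ (length p) 1 (cnt q′))) (cong (length p *_) (swap-cntʳ s))))

-- Here the two largest elements of a differ by one and 0 lies neither in a nor in
-- b; these elements are no longer listed.  For c = m - 1 > 0, one reflection
-- lowers the sum of positions by c - 1, or two of them lower it by c + 1.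
data Core₃ : ℕ → (u v u′ v′ : List Bool) → Set where
  one   : ∀ {d u v u′ v′} → Shift d u v u′ v′ → Core₃ (suc d) u (true ∷ v) u′ (false ∷ v′)
  two   : ∀ {u b q u′ q′} → Swap 2 u q u′ q′ → Core₃ 1 u (false ∷ b ∷ q) (u′ ∷ʳ false) (true ∷ b ∷ q′)
  three : ∀ {e u b₀ b₁ q r u₁ q₁ u′ v′} → length q ≡ length u → Swap 1 u q u₁ q₁ →
          Shift (suc e) u₁ (b₀ ∷ b₁ ∷ q₁ ++ r) u′ v′ →
          Core₃ (suc (suc e)) u (false ∷ b₀ ∷ b₁ ∷ q ++ r) u′ (true ∷ v′)
  flip  : ∀ {u v k w} → Run (true ∷ reverse u) v k w → Core₃ 0 u v w (reverse k)

-- For a given `c` only `one` competes with `two` or `three`, and its `v′` starts with false instead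
-- of true.
core₃-injective : ∀ {c u v u₀ v₀ u′ v′ u₀′ v₀′} → Core₃ c u v u′ v′ → Core₃ c u₀ v₀ u₀′ v₀′ →
                  u′ ≡ u₀′ → v′ ≡ v₀′ → u ≡ u₀ × v ≡ v₀
core₃-injective (one s) (one s₀) refl refl with refl , refl ← shift-injective s s₀ refl = refl , refl
core₃-injective (two {u′ = u′} s) (two {u′ = u₀′} s₀) eq refl
  with refl , _ ← ∷ʳ-injective u′ u₀′ eq
  with refl , refl ← swap-injective s s₀ = refl , refl
core₃-injective (three {u = u} {q = q} {u₁ = u₁} {q₁} lq s t) (three {u = u₀} {q = q₀} {u₁ = u₂} {q₂} lq₀ s₀ t₀) refl refl
  with refl , eq ← shift-injective t t₀ refl
  with refl , eq₁ ← ∷-injective eq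
  with refl , eq₂ ← ∷-injective eq₁
  with refl , refl ← ++-split-injective q₁ q₂
         (trans (trans (swap-lengthʳ s) (trans lq (sym (swap-lengthˡ s)))) (sym (trans (swap-lengthʳ s₀) (trans lq₀ (sym (swap-lengthˡ s₀)))))) eq₂
  with refl , refl ← swap-injective s s₀ = refl , refl
core₃-injective (flip {u} {k = k} r) (flip {u₀} {k = k₀} r₀) refl eq
  with refl ← reverse-injective {x = k} {y = k₀} eq
  with eq′ , refl ← run-injective r r₀ refl refl
  with refl ← reverse-injective {x = u} {y = u₀} (∷-injectiveʳ eq′) = refl , refl

-- `Valid` in the case `tied`, freed of the entries that this case fixes. The final true entries
-- there contribute the lengths of the lists before them and the leading false entries the numbers
-- of true entries after them. Hence the factors 2 and 3; the 5 collects the constants.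
record Valid₃ (c : ℕ) (u v u′ v′ : List Bool) : Set where
  constructor valid₃
  field
    len : length v′ ≡ length u′ + c
    num : suc (cnt v′) ≡ cnt u′ + c
    wgt : 2 * length u′ + c + (wt u′ + wt v′ + 3 * cnt u′) ≡ 2 * length u + 5 + (wt u + wt v + 3 * cnt u)

one-len : ∀ {x y u u′ d} → u′ ≡ suc u → x ≡ y → y ≡ u + suc d → suc x ≡ u′ + suc d
one-len {x} {y} {u} {u′} {d} e0 e1 e2 = (sym e0 & e1 & e2) by eq x y u u′ d
  where
  eq : ∀ x y u u′ d → suc x + (u′ + (y + (u + suc d))) ≡ u′ + suc d + (suc u + (x + (y)))
  eq = solve-∀
one-num : ∀ {x y u u′ d} → u′ ≡ suc u → suc x ≡ y → y ≡ suc (u + suc d) → suc x ≡ u′ + suc d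
one-num {x} {y} {u} {u′} {d} e0 e1 e2 = (sym e0 & e1 & e2) by eq x y u u′ d
  where
  eq : ∀ x y u u′ d → suc x + (u′ + (y + (suc (u + suc d)))) ≡ u′ + suc d + (suc u + (suc x + (y)))
  eq = solve-∀
one-wgt : ∀ {lu lu′ cu cu′ cv cv′ wu wu′ wv wv′ d} → lu′ ≡ suc lu → cu′ ≡ suc cu → suc cv′ ≡ cv → wu′ + wv′ + d ≡ wu + wv → 2 * lu′ + suc d + (wu′ + (cv′ + wv′) + 3 * cu′) ≡ 2 * lu + 5 + (wu + (cv + wv) + 3 * cu)
one-wgt {lu} {lu′} {cu} {cu′} {cv} {cv′} {wu} {wu′} {wv} {wv′} {d} e0 e1 e2 e3 = (e0 & e0 & e1 & e1 & e1 & e2 & e3) by eq lu lu′ cu cu′ cv cv′ wu wu′ wv wv′ d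
  where
  eq : ∀ lu lu′ cu cu′ cv cv′ wu wu′ wv wv′ d → 2 * lu′ + suc d + (wu′ + (cv′ + wv′) + 3 * cu′) + (suc lu + (suc lu + (suc cu + (suc cu + (suc cu + (cv + (wu + wv))))))) ≡ 2 * lu + 5 + (wu + (cv + wv) + 3 * cu) + (lu′ + (lu′ + (cu′ + (cu′ + (cu′ + (suc cv′ + (wu′ + wv′ + d)))))))
  eq = solve-∀

core₃-one : ∀ d u v → length v ≡ length u + suc d → cnt v ≡ suc (cnt u + suc d) →
            ∃₂ λ u′ v′ → Core₃ (suc d) u (true ∷ v) u′ v′ × Valid₃ (suc d) u (true ∷ v) u′ v′
core₃-one d u v lv cv
  with u′ , v′ , s , shifted lˡ lʳ cˡ cʳ w ← shift-exists d u v lv (≤-trans (n≤1+n _) (≤-reflexive (sym cv)))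
  = u′ , false ∷ v′ , one s , valid₃ (one-len lˡ lʳ lv) (one-num cˡ cʳ cv) (one-wgt {wu = wt u} {wu′ = wt u′} {wv = wt v} {wv′ = wt v′} lˡ cˡ cʳ w)

two-num : ∀ {y b q u} → y ≡ suc (suc (u + 1)) → y ≡ b + q → b + q ≡ 1 + (u + 2)
two-num {y} {b} {q} {u} e0 e1 = (e0 & sym e1) by eq y b q u
  where
  eq : ∀ y b q u → b + q + (suc (suc (u + 1)) + (y)) ≡ 1 + (u + 2) + (y + (b + q))
  eq = solve-∀
two-num′ : ∀ {x b q′ q y u u′ z} → x ≡ b + q′ → 2 + q′ ≡ q → y ≡ b + q → y ≡ suc (suc (u + 1)) → u′ ≡ 2 + u → z ≡ u′ + 0 → suc (suc x) ≡ z + 1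
two-num′ {x} {b} {q′} {q} {y} {u} {u′} {z} e0 e1 e2 e3 e4 e5 = (e0 & e1 & sym e2 & e3 & sym e4 & sym e5) by eq x b q′ q y u u′ z
  where
  eq : ∀ x b q′ q y u u′ z → suc (suc x) + (b + q′ + (q + (y + (suc (suc (u + 1)) + (u′ + (z)))))) ≡ z + 1 + (x + (2 + q′ + (b + q + (y + (2 + u + (u′ + 0))))))
  eq = solve-∀
two-wgt : ∀ {lu lu′ lz cu cu′ cz cq cq′ cb y x wu wu′ wz wq wq′} → lu′ ≡ lu → lz ≡ suc lu′ → cu′ ≡ 2 + cu → cz ≡ cu′ + 0 → 2 + cq′ ≡ cq → y ≡ cb + cq → x ≡ cb + cq′ → wz ≡ wu′ + lu′ * 0 → wu′ + wq′ ≡ wu + wq → 2 * lz + 1 + (wz + (x + (cq′ + wq′)) + 3 * cz) ≡ 2 * lu + 5 + (wu + (y + (cq + wq)) + 3 * cu)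
two-wgt {lu} {lu′} {lz} {cu} {cu′} {cz} {cq} {cq′} {cb} {y} {x} {wu} {wu′} {wz} {wq} {wq′} e0 e1 e2 e3 e4 e5 e6 e7 e8 = (e0 & e0 & e1 & e1 & e2 & e2 & e2 & e3 & e3 & e3 & e4 & e4 & sym e5 & e6 & e7 & e8) by eq lu lu′ lz cu cu′ cz cq cq′ cb y x wu wu′ wz wq wq′
  where
  eq : ∀ lu lu′ lz cu cu′ cz cq cq′ cb y x wu wu′ wz wq wq′ → 2 * lz + 1 + (wz + (x + (cq′ + wq′)) + 3 * cz) + (lu + (lu + (suc lu′ + (suc lu′ + (2 + cu + (2 + cu + (2 + cu + (cu′ + 0 + (cu′ + 0 + (cu′ + 0 + (cq + (cq + (y + (cb + cq′ + (wu′ + lu′ * 0 + (wu + wq)))))))))))))))) ≡ 2 * lu + 5 + (wu + (y + (cq + wq)) + 3 * cu) + (lu′ + (lu′ + (lz + (lz + (cu′ + (cu′ + (cu′ + (cz + (cz + (cz + (2 + cq′ + (2 + cq′ + (cb + cq + (x + (wz + (wu′ + wq′))))))))))))))))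
  eq = solve-∀

cnt-∷ : ∀ b xs → cnt (b ∷ xs) ≡ cnt [ b ] + cnt xs
cnt-∷ true  xs = refl
cnt-∷ false xs = refl

-- The offset 2 used in `core₃-three` does not fit into `v` here. One reflection at offset 1 up to a
-- lead of two moves two elements and lowers the sum by the same amount, `c + 1 = 2`.
core₃-two : ∀ u v → length v ≡ length u + 1 → cnt v ≡ suc (suc (cnt u + 1)) →
            ∃₂ λ u′ v′ → Core₃ 1 u (false ∷ v) u′ v′ × Valid₃ 1 u (false ∷ v) u′ v′
core₃-two u []      lv cv with () ← trans lv (+-comm (length u) 1)
core₃-two u (b ∷ q) lv cv
  with lq ← suc-injective (trans lv (+-comm (length u) 1))
  with u′ , q′ , s ← swap 2 u q (sym lq)
         (≤-from-parts {d = 1} (two-num {b = cnt [ b ]} cv (cnt-∷ b q)) (cnt≤length [ b ]) ≤-refl)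
  = u′ ∷ʳ false , true ∷ b ∷ q′ , two s , valid₃
      (trans (cong (λ z → suc (suc z)) (trans (swap-lengthʳ s) (trans lq (sym (swap-lengthˡ s)))))
             (sym (trans (cong (_+ 1) (length-∷ʳ u′ false)) (+-comm (suc (length u′)) 1))))
      (two-num′ {b = cnt [ b ]} (cnt-∷ b q′) (swap-cntʳ s) (cnt-∷ b q) cv (swap-cntˡ s) (cnt-∷ʳ u′ false))
      (two-wgt {cb = cnt [ b ]} {wu = wt u} {wu′ = wt u′} {wq = wt q} {wq′ = wt q′} (swap-lengthˡ s) (length-∷ʳ u′ false) (swap-cntˡ s) (cnt-∷ʳ u′ false) (swap-cntʳ s) (cnt-∷ b q) (cnt-∷ b q′)
        (wt-∷ʳ u′ false) (swap-wt s))

three-lenʳ : ∀ {y q r u e} → suc (suc y) ≡ u + suc (suc e) → y ≡ q + r → q ≡ u → r ≡ e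
three-lenʳ {y} {q} {r} {u} {e} e0 e1 e2 = (e0 & sym e1 & sym e2) by eq y q r u e
  where
  eq : ∀ y q r u e → r + (u + suc (suc e) + (y + (q))) ≡ e + (suc (suc y) + (q + r + (u)))
  eq = solve-∀
three-len₁ : ∀ {x q₁ q r u u₁ e} → x ≡ q₁ + r → q₁ ≡ q → q ≡ u → r ≡ e → u₁ ≡ u → suc (suc x) ≡ u₁ + suc (suc e)
three-len₁ {x} {q₁} {q} {r} {u} {u₁} {e} e0 e1 e2 e3 e4 = (e0 & e1 & e2 & e3 & sym e4) by eq x q₁ q r u u₁ e
  where
  eq : ∀ x q₁ q r u u₁ e → suc (suc x) + (q₁ + r + (q + (u + (e + (u₁))))) ≡ u₁ + suc (suc e) + (x + (q₁ + (q + (r + (u)))))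
  eq = solve-∀
three-num₁ : ∀ {x y b q q₁ r u u₁ e xx yy} → yy ≡ suc (suc (u + suc (suc e))) → yy ≡ b + y → y ≡ q + r → 1 + q₁ ≡ q → u₁ ≡ 1 + u → x ≡ q₁ + r → xx ≡ b + x → xx ≡ u₁ + suc (suc e)
three-num₁ {x} {y} {b} {q} {q₁} {r} {u} {u₁} {e} {xx} {yy} e0 e1 e2 e3 e4 e5 e6 = (e0 & sym e1 & sym e2 & e3 & sym e4 & e5 & e6) by eq x y b q q₁ r u u₁ e xx yy
  where
  eq : ∀ x y b q q₁ r u u₁ e xx yy → xx + (suc (suc (u + suc (suc e))) + (yy + (y + (q + (u₁ + (q₁ + r + (b + x))))))) ≡ u₁ + suc (suc e) + (yy + (b + y + (q + r + (1 + q₁ + (1 + u + (x + (xx)))))))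
  eq = solve-∀
three-len : ∀ {x y u u′ e} → x ≡ y → y ≡ u + suc (suc e) → u′ ≡ suc u → suc x ≡ u′ + suc (suc e)
three-len {x} {y} {u} {u′} {e} e0 e1 e2 = (e0 & e1 & sym e2) by eq x y u u′ e
  where
  eq : ∀ x y u u′ e → suc x + (y + (u + suc (suc e) + (u′))) ≡ u′ + suc (suc e) + (x + (y + (suc u)))
  eq = solve-∀
three-num : ∀ {x y u u′ e} → suc x ≡ y → y ≡ u + suc (suc e) → u′ ≡ suc u → suc (suc x) ≡ u′ + suc (suc e)
three-num {x} {y} {u} {u′} {e} e0 e1 e2 = (e0 & e1 & sym e2) by eq x y u u′ e
  where
  eq : ∀ x y u u′ e → suc (suc x) + (y + (u + suc (suc e) + (u′))) ≡ u′ + suc (suc e) + (suc x + (y + (suc u)))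
  eq = solve-∀
three-wgt₁ : ∀ {wu wu₁ wx wy wq wq₁ wr k} → wx ≡ wq₁ + wr + k → wy ≡ wq + wr + k → wu₁ + wq₁ ≡ wu + wq → wu₁ + wx ≡ wu + wy
three-wgt₁ {wu} {wu₁} {wx} {wy} {wq} {wq₁} {wr} {k} e0 e1 e2 = (e0 & sym e1 & e2) by eq wu wu₁ wx wy wq wq₁ wr k
  where
  eq : ∀ wu wu₁ wx wy wq wq₁ wr k → wu₁ + wx + (wq₁ + wr + k + (wy + (wu + wq))) ≡ wu + wy + (wx + (wq + wr + k + (wu₁ + wq₁)))
  eq = solve-∀
three-wgt₂ : ∀ {cx cy cx₁ cy₁ wx wy wu wu₁} → cy ≡ suc cx → cy₁ ≡ suc cx₁ → wu₁ + wx ≡ wu + wy → wu₁ + (cx₁ + (cx + wx)) + 2 ≡ wu + (cy₁ + (cy + wy))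
three-wgt₂ {cx} {cy} {cx₁} {cy₁} {wx} {wy} {wu} {wu₁} e0 e1 e2 = (sym e0 & sym e1 & e2) by eq cx cy cx₁ cy₁ wx wy wu wu₁
  where
  eq : ∀ cx cy cx₁ cy₁ wx wy wu wu₁ → wu₁ + (cx₁ + (cx + wx)) + 2 + (cy + (cy₁ + (wu + wy))) ≡ wu + (cy₁ + (cy + wy)) + (suc cx + (suc cx₁ + (wu₁ + wx)))
  eq = solve-∀
three-wgt₃ : ∀ {lu lu′ cu cu′ cv′ cy₀ X w₀ w e} → lu′ ≡ suc lu → cu′ ≡ suc (suc cu) → suc (suc cv′) ≡ cy₀ → w + suc e ≡ X → X + 2 ≡ w₀ → 2 * lu′ + suc (suc e) + (w + cv′ + 3 * cu′) ≡ 2 * lu + 5 + (w₀ + cy₀ + 3 * cu)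
three-wgt₃ {lu} {lu′} {cu} {cu′} {cv′} {cy₀} {X} {w₀} {w} {e} e0 e1 e2 e3 e4 = (e0 & e0 & e1 & e1 & e1 & e2 & e3 & e4) by eq lu lu′ cu cu′ cv′ cy₀ X w₀ w e
  where
  eq : ∀ lu lu′ cu cu′ cv′ cy₀ X w₀ w e → 2 * lu′ + suc (suc e) + (w + cv′ + 3 * cu′) + (suc lu + (suc lu + (suc (suc cu) + (suc (suc cu) + (suc (suc cu) + (cy₀ + (X + (w₀)))))))) ≡ 2 * lu + 5 + (w₀ + cy₀ + 3 * cu) + (lu′ + (lu′ + (cu′ + (cu′ + (cu′ + (suc (suc cv′) + (w + suc e + (X + 2))))))))
  eq = solve-∀

-- The two entries before `q` and the `e` entries after it hold at most `2 + e` of the true ones.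
three-bound : ∀ {e u q r b y yy} → r ≤ e → b ≤ 2 → yy ≡ suc (suc (u + suc (suc e))) → yy ≡ b + y → y ≡ q + r → u + 1 ≤ q
three-bound {e} {u} {q} {r} {b} r≤e b≤2 eq refl refl = +-cancelʳ-≤ (2 + e) (u + 1) q (begin
  u + 1 + (2 + e)              ≤⟨ n≤1+n _ ⟩
  suc (u + 1 + (2 + e))        ≡⟨ solve₁ u e ⟩
  suc (suc (u + suc (suc e)))  ≡⟨ sym eq ⟩
  b + (q + r)                  ≤⟨ +-mono-≤ b≤2 (+-monoʳ-≤ q r≤e) ⟩
  2 + (q + e)                  ≡⟨ solve₂ q e ⟩
  q + (2 + e)                  ∎)
  where
  open ≤-Reasoning
  solve₁ : ∀ u e → suc (u + 1 + (2 + e)) ≡ suc (suc (u + suc (suc e)))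
  solve₁ = solve-∀
  solve₂ : ∀ q e → 2 + (q + e) ≡ q + (2 + e)
  solve₂ = solve-∀

cnt-swap-prefix : ∀ p {u q r u₁ q₁} → Swap 1 u q u₁ q₁ → cnt (p ++ q ++ r) ≡ suc (cnt (p ++ q₁ ++ r))
cnt-swap-prefix p {q = q} {r} {q₁ = q₁} s = begin
  cnt (p ++ q ++ r)              ≡⟨ cnt-++ p (q ++ r) ⟩
  cnt p + cnt (q ++ r)           ≡⟨ cong (cnt p +_) (cnt-++ q r) ⟩
  cnt p + (cnt q + cnt r)        ≡⟨ cong (λ z → cnt p + (z + cnt r)) (sym (swap-cntʳ s)) ⟩
  cnt p + suc (cnt q₁ + cnt r)   ≡⟨ +-suc (cnt p) _ ⟩
  suc (cnt p + (cnt q₁ + cnt r)) ≡⟨ cong (λ z → suc (cnt p + z)) (sym (cnt-++ q₁ r)) ⟩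
  suc (cnt p + cnt (q₁ ++ r))    ≡⟨ cong suc (sym (cnt-++ p (q₁ ++ r))) ⟩
  suc (cnt (p ++ q₁ ++ r))       ∎
  where open ≡-Reasoning

three-wgt : ∀ {e u q u₁ q₁ u′ v′} b₀ b₁ r → Swap 1 u q u₁ q₁ → Shifted (suc e) u₁ (b₀ ∷ b₁ ∷ q₁ ++ r) u′ v′ →
            2 * length u′ + suc (suc e) + (wt u′ + (cnt v′ + wt v′) + 3 * cnt u′)
            ≡ 2 * length u + 5 + (wt u + (cnt (b₀ ∷ b₁ ∷ q ++ r) + wt (b₀ ∷ b₁ ∷ q ++ r)) + 3 * cnt u)
three-wgt {e} {u} {q} {u₁} {q₁} {u′} {v′} b₀ b₁ r s (shifted lˡ lʳ cˡ cʳ w) = begin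
  2 * length u′ + suc (suc e) + (wt u′ + (cnt v′ + wt v′) + 3 * cnt u′)  ≡⟨ comm (2 * length u′ + suc (suc e)) (wt u′) (cnt v′) (wt v′) (3 * cnt u′) ⟩
  2 * length u′ + suc (suc e) + (wt u′ + wt v′ + cnt v′ + 3 * cnt u′)    ≡⟨ three-wgt₃ (trans lˡ (cong suc (swap-lengthˡ s))) (trans cˡ (cong suc (swap-cntˡ s)))
                                                                             (trans (cong suc cʳ) (sym (cnt-swap-prefix (b₀ ∷ b₁ ∷ []) s))) w
                                                                             (three-wgt₂ {cnt (q₁ ++ r)} {cnt (q ++ r)} {cnt (b₁ ∷ q₁ ++ r)} {cnt (b₁ ∷ q ++ r)} {wt (q₁ ++ r)} {wt (q ++ r)} {wt u} {wt u₁} (cnt-swap-prefix [] s) (cnt-swap-prefix [ b₁ ] s)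
                                                                               (three-wgt₁ {wt u} {wt u₁} {wt (q₁ ++ r)} {wt (q ++ r)} {wt q} {wt q₁} {wt r} (trans (wt-++ q₁ r) (cong (λ z → wt q₁ + wt r + z * cnt r) (swap-lengthʳ s))) (wt-++ q r) (swap-wt s))) ⟩
  2 * length u + 5 + (wt u + wt (b₀ ∷ b₁ ∷ q ++ r) + cnt (b₀ ∷ b₁ ∷ q ++ r) + 3 * cnt u)  ≡⟨ sym (comm (2 * length u + 5) (wt u) (cnt (b₀ ∷ b₁ ∷ q ++ r)) (wt (b₀ ∷ b₁ ∷ q ++ r)) (3 * cnt u)) ⟩
  2 * length u + 5 + (wt u + (cnt (b₀ ∷ b₁ ∷ q ++ r) + wt (b₀ ∷ b₁ ∷ q ++ r)) + 3 * cnt u)  ∎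
  where
  open ≡-Reasoning
  comm : ∀ z a b c d → z + (a + (b + c) + d) ≡ z + (a + c + b + d)
  comm = solve-∀

-- The offset 2 of the first reflection and the offset `suc e` of the second add up to `c + 1` for
-- `c = 2 + e`. Two elements leave `v`, and the true entry put in front gives one back.
core₃-three : ∀ e u v → length v ≡ length u + suc (suc e) → cnt v ≡ suc (suc (cnt u + suc (suc e))) →
              ∃₂ λ u′ v′ → Core₃ (suc (suc e)) u (false ∷ v) u′ v′ × Valid₃ (suc (suc e)) u (false ∷ v) u′ v′
core₃-three e u [] lv cv with () ← trans lv (+-suc (length u) (suc e))
core₃-three e u (_ ∷ []) lv cv with () ← trans (suc-injective (trans lv (+-suc (length u) (suc e)))) (+-suc (length u) e)
core₃-three e u (b₀ ∷ b₁ ∷ y) lv cv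
  with q , r , refl , lq ← split (length u) y (s≤s⁻¹ (s≤s⁻¹ (≤-trans (≤-trans (s≤s (s≤s (m≤m+n (length u) e))) (≤-reflexive (sym (trans (+-suc (length u) (suc e)) (cong suc (+-suc (length u) e)))))) (≤-reflexive (sym lv)))))
  with lr ← three-lenʳ lv (length-++ q {r}) lq
  with u₁ , q₁ , s ← swap 1 u q (sym lq) (three-bound {b = cnt (b₀ ∷ b₁ ∷ [])} (≤-trans (cnt≤length r) (≤-reflexive lr)) (cnt≤length (b₀ ∷ b₁ ∷ [])) cv (cnt-++ (b₀ ∷ b₁ ∷ []) (q ++ r)) (cnt-++ q r))
  with lx ← three-len₁ {q₁ = length q₁} (length-++ q₁ {r}) (swap-lengthʳ s) lq lr (swap-lengthˡ s)
  with cx ← three-num₁ cv (cnt-++ (b₀ ∷ b₁ ∷ []) (q ++ r)) (cnt-++ q r) (swap-cntʳ s) (swap-cntˡ s) (cnt-++ q₁ r) (cnt-++ (b₀ ∷ b₁ ∷ []) (q₁ ++ r))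
  with u′ , v′ , t , sh@(shifted lˡ lʳ cˡ cʳ w) ← shift-exists (suc e) u₁ (b₀ ∷ b₁ ∷ q₁ ++ r) lx (≤-reflexive (sym cx))
  = u′ , true ∷ v′ , three lq s t , valid₃ (three-len lʳ lx lˡ) (three-num cʳ cx cˡ)
      (three-wgt b₀ b₁ r s sh)

flip-len : ∀ {lk cw cv ck cg lu cu} → cw + suc lk ≡ suc lu + cv → cw + cg ≡ ck + cv → cg ≡ suc cu → cv ≡ suc (suc (cu + 0)) → suc ck ≡ cw + 0
flip-len {lk} {cw} {cv} {ck} {cg} {lu} {cu} _ e1 e2 e3 = (sym e1 & e2 & sym e3) by eq lk cw cv ck cg lu cu
  where
  eq : ∀ lk cw cv ck cg lu cu → suc ck + (cw + cg + (suc cu + (cv))) ≡ cw + 0 + (ck + cv + (cg + (suc (suc (cu + 0)))))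
  eq = solve-∀
flip-wgt : ∀ {lk lw cw wkr cv wv tk tg lg lu wu cu} → 2 * lk + wv + tk + 3 * cw + 2 ≡ lg + tg + wkr + 3 * cv → lw ≡ lk → lg ≡ suc lu → tg ≡ lu + wu → cv ≡ suc (suc (cu + 0)) → 2 * lw + 0 + (wv + tk + 3 * cw) ≡ 2 * lu + 5 + (wu + wkr + 3 * cu)
flip-wgt {lk} {lw} {cw} {wkr} {cv} {wv} {tk} {tg} {lg} {lu} {wu} {cu} e0 e1 e2 e3 e4 = (e0 & e1 & e1 & e2 & e3 & e4 & e4 & e4) by eq lk lw cw wkr cv wv tk tg lg lu wu cu
  where
  eq : ∀ lk lw cw wkr cv wv tk tg lg lu wu cu → 2 * lw + 0 + (wv + tk + 3 * cw) + (lg + tg + wkr + 3 * cv + (lk + (lk + (suc lu + (lu + wu + (suc (suc (cu + 0)) + (suc (suc (cu + 0)) + (suc (suc (cu + 0)))))))))) ≡ 2 * lu + 5 + (wu + wkr + 3 * cu) + (2 * lk + wv + tk + 3 * cw + 2 + (lw + (lw + (lg + (tg + (cv + (cv + (cv))))))))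
  eq = solve-∀

run-length : ∀ {g v k w} → Run g v k w → length g ≡ length v → length k ≡ length w
run-length remove       eq = eq
run-length (step r)     eq = cong suc (run-length r (suc-injective eq))
run-length (lower lq)   eq = cong suc (sym lq)
run-length (cross {r} {q} {r′} lq s) eq = cong suc (trans (length-reverse r′) (trans (swap-lengthˡ s) (trans (length-reverse r) (sym (trans (swap-lengthʳ s) lq)))))

-- The sets trade roles: what `run` makes of `v` becomes `u′`, and what it makes of `u` becomes
-- `v′`. The true entry in front of `reverse u` is the second largest element of a, which `tied` had
-- taken out.
core₃-flip : ∀ u v → length v ≡ suc (length u + 0) → cnt v ≡ suc (suc (cnt u + 0)) →
             ∃₂ λ u′ v′ → Core₃ 0 u v u′ v′ × Valid₃ 0 u v u′ v′
core₃-flip u v lv cv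
  with lv′ ← trans lv (cong suc (trans (+-identityʳ (length u)) (sym (length-reverse u))))
  with k , w , r ← run (reverse u) v lv′
         (≤-reflexive (sym (trans cv (cong (λ z → suc (suc z)) (trans (+-identityʳ (cnt u)) (sym (cnt-reverse u)))))))
  with lkw ← run-length r (sym lv′)
  = w , reverse k , flip r , valid₃
      (trans (length-reverse k) (trans lkw (sym (+-identityʳ (length w)))))
      (trans (cong suc (cnt-reverse k)) (flip-len {length k} {cnt w} {lu = length u} (trans (run-count r) (cong (λ z → suc z + cnt v) (length-reverse u))) (run-balance r) (cong suc (cnt-reverse u)) cv))
      (flip-wgt {length k} {length w} {cnt w} {wt v} {cnt v} {wt w} {wt (reverse k)} {tw (true ∷ reverse u)} {suc (length (reverse u))} {length u} {wt u} {cnt u}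
        (trans (cong (λ z → 2 * length k + wt w + z + 3 * cnt w + 2) (wt-reverse k)) (run-weight r)) (sym lkw)
        (cong suc (length-reverse u)) (cong₂ _+_ (length-reverse u) (trans (sym (wt-reverse (reverse u))) (cong wt (reverse-involutive u)))) cv)

core₃ : ∀ c u v → length v ≡ suc (length u + c) → cnt v ≡ suc (suc (cnt u + c)) →
        ∃₂ λ u′ v′ → Core₃ c u v u′ v′ × Valid₃ c u v u′ v′
core₃ zero          u v           lv cv = core₃-flip u v lv cv
core₃ (suc d)       u (true ∷ v)  lv cv = core₃-one d u v (suc-injective lv) (suc-injective cv)
core₃ (suc zero)    u (false ∷ v) lv cv = core₃-two u v (suc-injective lv) cv
core₃ (suc (suc e)) u (false ∷ v) lv cv = core₃-three e u v (suc-injective lv) cv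

-- The map from {rank ≥ m} \ X(m) to X(m) \ {rank ≥ m} for m = c + 1: it sends
-- highWord u v to lowWord u′ v′.
data Core (c : ℕ) : (u v u′ v′ : List Bool) → Set where
  fromTrue : ∀ {u v} → Core c u (true ∷ v) (false ∷ u) (v ∷ʳ false)
  untied   : ∀ {u v} → Core c (u ∷ʳ false) (false ∷ v) (true ∷ u) v
  tied     : ∀ {u v u′ v′} → Core₃ c u v u′ v′ → Core c (u ∷ʳ true) (false ∷ v) (false ∷ u′) (v′ ∷ʳ true)

-- The images are disjoint: `u′` starts with true only for `untied`, and the last entry of `v′`
-- separates `fromTrue` from `tied`.
core-injective : ∀ {c u v u₀ v₀ u′ v′ u₀′ v₀′} → Core c u v u′ v′ → Core c u₀ v₀ u₀′ v₀′ →
                 u′ ≡ u₀′ → v′ ≡ v₀′ → u ≡ u₀ × v ≡ v₀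
core-injective (fromTrue {v = v}) (fromTrue {v = v₀}) refl eq with refl , _ ← ∷ʳ-injective v v₀ eq = refl , refl
core-injective (fromTrue {v = v}) (tied {v′ = v₀} _)  refl eq with () ← proj₂ (∷ʳ-injective v v₀ eq)
core-injective untied             untied              refl refl = refl , refl
core-injective (tied {v′ = v} _)  (fromTrue {v = v₀}) refl eq with () ← proj₂ (∷ʳ-injective v v₀ eq)
core-injective (tied {v′ = v} s)  (tied {v′ = v₀} s₀) refl eq
  with refl , _ ← ∷ʳ-injective v v₀ eq
  with refl , refl ← core₃-injective s s₀ refl refl = refl , refl

-- By `sum-highWord` and `sum-lowWord`, `wgt` says that the partitions of `highWord u v` and
-- `lowWord u′ v′` have the same size; the constant `tri c` has cancelled.
record Valid (c : ℕ) (u v u′ v′ : List Bool) : Set where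
  constructor valid
  field
    len : length v′ ≡ length u′ + c
    num : cnt v′ ≡ cnt u′ + c
    wgt : length u′ + c + (wt u′ + 2 * cnt u′ + wt v′) ≡ suc (length u) + (wt u + 2 * cnt u + wt v)

true-wgt : ∀ {lu cu cv wu wv wz c lv} → cv ≡ cu + c → wz ≡ wv + lv * 0 → suc lu + c + (cu + wu + 2 * cu + wz) ≡ suc lu + (wu + 2 * cu + (cv + wv))
true-wgt {lu} {cu} {cv} {wu} {wv} {wz} {c} {lv} e0 e1 = (sym e0 & e1) by eq lu cu cv wu wv wz c lv
  where
  eq : ∀ lu cu cv wu wv wz c lv → suc lu + c + (cu + wu + 2 * cu + wz) + (cv + (wv + lv * 0)) ≡ suc lu + (wu + 2 * cu + (cv + wv)) + (cu + c + (wz))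
  eq = solve-∀
untied-wgt : ∀ {lu lz cu cz cv wu wz wv c} → lz ≡ suc lu → cz ≡ cu + 0 → wz ≡ wu + lu * 0 → cv ≡ suc (cz + c) → suc lu + c + (cu + wu + 2 * suc cu + wv) ≡ suc lz + (wz + 2 * cz + (cv + wv))
untied-wgt {lu} {lz} {cu} {cz} {cv} {wu} {wz} {wv} {c} e0 e1 e2 e3 = (sym e0 & sym e1 & sym e1 & sym e1 & sym e2 & sym e3) by eq lu lz cu cz cv wu wz wv c
  where
  eq : ∀ lu lz cu cz cv wu wz wv c → suc lu + c + (cu + wu + 2 * suc cu + wv) + (lz + (cz + (cz + (cz + (wz + (cv)))))) ≡ suc lz + (wz + 2 * cz + (cv + wv)) + (suc lu + (cu + 0 + (cu + 0 + (cu + 0 + (wu + lu * 0 + (suc (cz + c)))))))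
  eq = solve-∀
tied-len : ∀ {lz lu′ lv′ c} → lz ≡ suc lv′ → lv′ ≡ lu′ + c → lz ≡ suc lu′ + c
tied-len {lz} {lu′} {lv′} {c} e0 e1 = (e0 & e1) by eq lz lu′ lv′ c
  where
  eq : ∀ lz lu′ lv′ c → lz + (suc lv′ + (lu′ + c)) ≡ suc lu′ + c + (lz + (lv′))
  eq = solve-∀
tied-num : ∀ {cz cv′ cu′ c} → cz ≡ cv′ + 1 → suc cv′ ≡ cu′ + c → cz ≡ cu′ + c
tied-num {cz} {cv′} {cu′} {c} e0 e1 = (e0 & e1) by eq cz cv′ cu′ c
  where
  eq : ∀ cz cv′ cu′ c → cz + (cv′ + 1 + (cu′ + c)) ≡ cu′ + c + (cz + (suc cv′))
  eq = solve-∀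
tied-wgt : ∀ {lu lz cu cz wu wz cv wv lu′ cu′ wu′ lv′ wv′ wz′ c} → lz ≡ suc lu → cz ≡ cu + 1 → wz ≡ wu + lu * 1 → wz′ ≡ wv′ + lv′ * 1 → lv′ ≡ lu′ + c → cv ≡ suc (cz + c) → 2 * lu′ + c + (wu′ + wv′ + 3 * cu′) ≡ 2 * lu + 5 + (wu + wv + 3 * cu) → suc lu′ + c + (cu′ + wu′ + 2 * cu′ + wz′) ≡ suc lz + (wz + 2 * cz + (cv + wv))
tied-wgt {lu} {lz} {cu} {cz} {wu} {wz} {cv} {wv} {lu′} {cu′} {wu′} {lv′} {wv′} {wz′} {c} e0 e1 e2 e3 e4 e5 e6 = (sym e0 & sym e1 & sym e1 & sym e1 & sym e2 & e3 & e4 & sym e5 & e6) by eq lu lz cu cz wu wz cv wv lu′ cu′ wu′ lv′ wv′ wz′ c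
  where
  eq : ∀ lu lz cu cz wu wz cv wv lu′ cu′ wu′ lv′ wv′ wz′ c → suc lu′ + c + (cu′ + wu′ + 2 * cu′ + wz′) + (lz + (cz + (cz + (cz + (wz + (wv′ + lv′ * 1 + (lu′ + c + (cv + (2 * lu + 5 + (wu + wv + 3 * cu)))))))))) ≡ suc lz + (wz + 2 * cz + (cv + wv)) + (suc lu + (cu + 1 + (cu + 1 + (cu + 1 + (wu + lu * 1 + (wz′ + (lv′ + (suc (cz + c) + (2 * lu′ + c + (wu′ + wv′ + 3 * cu′))))))))))
  eq = solve-∀
untied-num : ∀ {cv cu cz c} → cz ≡ cu + 0 → cv ≡ suc (cz + c) → cv ≡ suc cu + c
untied-num {cv} {cu} {cz} {c} e0 e1 = (e0 & e1) by eq cv cu cz c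
  where
  eq : ∀ cv cu cz c → cv + (cu + 0 + (suc (cz + c))) ≡ suc cu + c + (cz + (cv))
  eq = solve-∀
tied-num₀ : ∀ {cv cu cz c} → cz ≡ cu + 1 → cv ≡ suc (cz + c) → cv ≡ suc (suc (cu + c))
tied-num₀ {cv} {cu} {cz} {c} e0 e1 = (e0 & e1) by eq cv cu cz c
  where
  eq : ∀ cv cu cz c → cv + (cu + 1 + (suc (cz + c))) ≡ suc (suc (cu + c)) + (cz + (cv))
  eq = solve-∀

core-false : ∀ c w v → (∃₂ λ u b → w ≡ u ∷ʳ b) → length v ≡ length w + c → cnt v ≡ suc (cnt w + c) →
             ∃₂ λ u′ v′ → Core c w (false ∷ v) u′ v′ × Valid c w (false ∷ v) u′ v′
core-false c _ v (u , false , refl) lv cv = true ∷ u , v , untied , valid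
  (trans lv (cong (_+ c) (length-∷ʳ u false)))
  (untied-num {cu = cnt u} (cnt-∷ʳ u false) cv)
  (untied-wgt {length u} {cu = cnt u} {wu = wt u} {wz = wt (u ∷ʳ false)} {wv = wt v} (length-∷ʳ u false) (cnt-∷ʳ u false) (wt-∷ʳ u false) cv)
core-false c _ v (u , true , refl) lv cv
  with u′ , v′ , s , valid₃ l n w ← core₃ c u v (trans lv (cong (_+ c) (length-∷ʳ u true))) (tied-num₀ {cu = cnt u} (cnt-∷ʳ u true) cv)
  = false ∷ u′ , v′ ∷ʳ true , tied s , valid
  (tied-len {lu′ = length u′} (length-∷ʳ v′ true) l)
  (tied-num {cv′ = cnt v′} {cu′ = cnt u′} (cnt-∷ʳ v′ true) n)
  (tied-wgt {length u} {length (u ∷ʳ true)} {cnt u} {cnt (u ∷ʳ true)} {wt u} {wv = wt v} {lu′ = length u′} {cu′ = cnt u′} {wu′ = wt u′} {wv′ = wt v′}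
    (length-∷ʳ u true) (cnt-∷ʳ u true) (wt-∷ʳ u true) (wt-∷ʳ v′ true) l cv w)

-- Seen on the partition, `fromTrue` and `untied` delete the largest part, insert a part at the cut
-- and add one to the parts below it, parts 0 included. Within the case of a leading false entry,
-- `untied` means that the largest part exceeds the next one and `tied` that they are equal.
core : ∀ c u v → length v ≡ suc (length u + c) → cnt v ≡ suc (cnt u + c) →
       ∃₂ λ u′ v′ → Core c u v u′ v′ × Valid c u v u′ v′
core c u (true ∷ v) lv cv = false ∷ u , v ∷ʳ false , fromTrue , valid
  (trans (length-∷ʳ v false) lv)
  (trans (cnt-∷ʳ v false) (trans (+-identityʳ (cnt v)) (suc-injective cv)))
  (true-wgt {length u} {cnt u} {wu = wt u} {c = c} {lv = length v} (suc-injective cv) (wt-∷ʳ v false))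
-- Here `v` has only `c` entries, too few for `suc c` true ones.
core c [] (false ∷ v) lv cv = ⊥-elim (1+n≰n (≤-trans (≤-reflexive (sym cv)) (≤-trans (cnt≤length v) (≤-reflexive (suc-injective lv)))))
core c u@(_ ∷ _) (false ∷ v) lv cv = core-false c u v (snoc u (s≤s z≤n)) (suc-injective lv) cv

-- Boundary words, read from the top: true is a vertical step (a part), false a
-- horizontal one.  Vertical steps after the last horizontal one are parts 0.
cof : List Bool → ℕ
cof []          = 0
cof (true ∷ w)  = cof w
cof (false ∷ w) = suc (cof w)

shape : List Bool → List ℕ
shape []          = []
shape (true ∷ w)  = cof w ∷ shape w
shape (false ∷ w) = shape w

cof-++ : ∀ xs ys → cof (xs ++ ys) ≡ cof xs + cof ys
cof-++ []           ys = refl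
cof-++ (true  ∷ xs) ys = cof-++ xs ys
cof-++ (false ∷ xs) ys = cong suc (cof-++ xs ys)

cnt+cof : ∀ w → cnt w + cof w ≡ length w
cnt+cof []          = refl
cnt+cof (true ∷ w)  = cong suc (cnt+cof w)
cnt+cof (false ∷ w) = trans (+-suc (cnt w) (cof w)) (cong suc (cnt+cof w))

cnt-not : ∀ w → cnt (map not w) ≡ cof w
cnt-not []          = refl
cnt-not (true ∷ w)  = cnt-not w
cnt-not (false ∷ w) = cong suc (cnt-not w)

cof-not : ∀ w → cof (map not w) ≡ cnt w
cof-not []          = refl
cof-not (true ∷ w)  = cong suc (cof-not w)
cof-not (false ∷ w) = cof-not w

length-shape : ∀ w → length (shape w) ≡ cnt w
length-shape []          = refl
length-shape (true ∷ w)  = cong suc (length-shape w)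
length-shape (false ∷ w) = length-shape w

shape-linked : ∀ w {k} → cof w ≤ k → Linked _≥_ (k ∷ shape w)
shape-linked []          _  = [-]
shape-linked (true ∷ w)  le = le ∷ shape-linked w ≤-refl
shape-linked (false ∷ w) le = shape-linked w (≤-trans (n≤1+n _) le)

shape≤cof : ∀ w → All (_≤ cof w) (shape w)
shape≤cof []          = []
shape≤cof (true ∷ w)  = ≤-refl ∷ shape≤cof w
shape≤cof (false ∷ w) = All.map m≤n⇒m≤1+n (shape≤cof w)

-- A word starts with a vertical step exactly if its first part reaches the total number of
-- horizontal steps.
shape-injective : ∀ w w′ → cof w ≡ cof w′ → shape w ≡ shape w′ → w ≡ w′
shape-injective []          []           _  _  = refl
shape-injective []          (true ∷ w′)  _  ()
shape-injective []          (false ∷ w′) () _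
shape-injective (true ∷ w)  []           _  ()
shape-injective (false ∷ w) []           () _
shape-injective (true ∷ w)  (true ∷ w′)  eq sh = cong (true ∷_) (shape-injective w w′ eq (∷-injectiveʳ sh))
shape-injective (false ∷ w) (false ∷ w′) eq sh = cong (false ∷_) (shape-injective w w′ (suc-injective eq) sh)
shape-injective (true ∷ w)  (false ∷ w′) eq sh with bound ∷ _ ← subst (All (_≤ cof w′)) (sym sh) (shape≤cof w′) =
  ⊥-elim (1+n≰n (subst (_≤ cof w′) eq bound))
shape-injective (false ∷ w) (true ∷ w′)  eq sh with bound ∷ _ ← subst (All (_≤ cof w)) sh (shape≤cof w) =
  ⊥-elim (1+n≰n (subst (_≤ cof w) (sym eq) bound))

-- The word with h horizontal steps and the given parts.
word : ℕ → List ℕ → List Bool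
word h []       = replicate h false
word h (x ∷ xs) = replicate (h ∸ x) false ++ true ∷ word x xs

cof-replicate : ∀ k w → cof (replicate k false ++ w) ≡ k + cof w
cof-replicate zero    w = refl
cof-replicate (suc k) w = cong suc (cof-replicate k w)

shape-replicate : ∀ k w → shape (replicate k false ++ w) ≡ shape w
shape-replicate zero    w = refl
shape-replicate (suc k) w = shape-replicate k w

cof-word : ∀ h xs → Linked _≥_ (h ∷ xs) → cof (word h xs) ≡ h
cof-word h []       _        = trans (cong cof (sym (++-identityʳ (replicate h false)))) (trans (cof-replicate h []) (+-identityʳ h))
cof-word h (x ∷ xs) (le ∷ l) = trans (cof-replicate (h ∸ x) _) (trans (cong (h ∸ x +_) (cof-word x xs l)) (m∸n+n≡m le))

shape-word : ∀ h xs → Linked _≥_ (h ∷ xs) → shape (word h xs) ≡ xs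
shape-word h []       _        = trans (cong shape (sym (++-identityʳ (replicate h false)))) (shape-replicate h [])
shape-word h (x ∷ xs) (le ∷ l) = trans (shape-replicate (h ∸ x) _) (cong₂ _∷_ (cof-word x xs l) (shape-word x xs l))

replicate-∷ʳ : ∀ {A : Set} {x : A} k → replicate (suc k) x ≡ replicate k x ∷ʳ x
replicate-∷ʳ zero    = refl
replicate-∷ʳ (suc k) = cong (_ ∷_) (replicate-∷ʳ k)

word-last : ∀ h xs → 0 < h → All (_> 0) xs → ∃ λ w → word h xs ≡ w ∷ʳ false
word-last (suc h) [] h>0 [] = replicate h false , replicate-∷ʳ h
word-last h (x ∷ xs) h>0 (x>0 ∷ ps) with w , eq ← word-last x xs x>0 ps =
  replicate (h ∸ x) false ++ true ∷ w , trans (cong (λ z → replicate (h ∸ x) false ++ true ∷ z) eq) (sym (++-assoc (replicate (h ∸ x) false) (true ∷ w) (false ∷ [])))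

-- The size of a partition in terms of the two sets at a cut

tri : ℕ → ℕ
tri zero    = 0
tri (suc n) = n + tri n

zip₀ : ∀ {s c t w} → s + 0 + t ≡ 0 + w + 0 → s + 0 + (c + t) ≡ 0 + (c + w) + 0
zip₀ {s} {c} {t} {w} e0 = (e0) by eq s c t w
  where
  eq : ∀ s c t w → s + 0 + (c + t) + (0 + w + 0) ≡ 0 + (c + w) + 0 + (s + 0 + t)
  eq = solve-∀
zip₁ : ∀ {s c t w} → s + 0 + t ≡ 0 + w + 0 → c + s + 0 + t ≡ 0 + (c + w) + 0
zip₁ {s} {c} {t} {w} e0 = (e0) by eq s c t w
  where
  eq : ∀ s c t w → c + s + 0 + t + (0 + w + 0) ≡ 0 + (c + w) + 0 + (s + 0 + t)
  eq = solve-∀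
zip₂ : ∀ {s a b ta tb wa wb} → s + ta + tb ≡ wa + (b + wb) + a * b → s + (a + ta) + tb ≡ a + wa + wb + (b + a * b)
zip₂ {s} {a} {b} {ta} {tb} {wa} {wb} e0 = (e0) by eq s a b ta tb wa wb
  where
  eq : ∀ s a b ta tb wa wb → s + (a + ta) + tb + (wa + (b + wb) + a * b) ≡ a + wa + wb + (b + a * b) + (s + ta + tb)
  eq = solve-∀
zip₃ : ∀ {s a b ta tb wa wb} → s + ta + (b + tb) ≡ wa + (b + wb) + a * suc b → s + ta + tb ≡ a + wa + wb + a * b
zip₃ {s} {a} {b} {ta} {tb} {wa} {wb} e0 = (e0) by eq s a b ta tb wa wb
  where
  eq : ∀ s a b ta tb wa wb → s + ta + tb + (wa + (b + wb) + a * suc b) ≡ a + wa + wb + a * b + (s + ta + (b + tb))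
  eq = solve-∀

-- Moving the cut by one step takes an entry from `a` to `b`, negated, and leaves the word alone;
-- this reduces to empty `a`. Then a horizontal step adds one to each part above it, so it
-- contributes its position less the number of earlier horizontal steps. These corrections sum to
-- `tri (cnt b)`, that is n(n - 1)/2 for n = `cnt b`.
sum-shape : ∀ a b → sum (shape (reverse a ++ map not b)) + tri (cnt a) + tri (cnt b) ≡ wt a + wt b + cnt a * cnt b
sum-shape []      []          = refl
sum-shape []      (true ∷ b)  = zip₀ {sum (shape (map not b))} {cnt b} {tri (cnt b)} (sum-shape [] b)
sum-shape []      (false ∷ b) = trans (cong (λ z → z + sum (shape (map not b)) + 0 + tri (cnt b)) (cof-not b)) (zip₁ {sum (shape (map not b))} {cnt b} {tri (cnt b)} (sum-shape [] b))
sum-shape (x ∷ a) b           = trans (cong (λ z → sum (shape z) + tri (cnt (x ∷ a)) + tri (cnt b)) move) (moved x (sum-shape a (not x ∷ b)))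
  where
  not-not : ∀ x → not (not x) ≡ x
  not-not true  = refl
  not-not false = refl
  move : reverse (x ∷ a) ++ map not b ≡ reverse a ++ map not (not x ∷ b)
  move = trans (cong (_++ map not b) (unfold-reverse x a)) (trans (++-assoc (reverse a) _ _) (cong (λ z → reverse a ++ z ∷ map not b) (sym (not-not x))))
  moved : ∀ {s} x → s + tri (cnt a) + tri (cnt (not x ∷ b)) ≡ wt a + (cnt b + wt b) + cnt a * cnt (not x ∷ b) →
         s + tri (cnt (x ∷ a)) + tri (cnt b) ≡ cnt a + wt a + wt b + cnt (x ∷ a) * cnt b
  moved true  eq = zip₂ {a = cnt a} {cnt b} {tri (cnt a)} {tri (cnt b)} {wt a} {wt b} eq
  moved false eq = zip₃ {a = cnt a} {cnt b} {tri (cnt a)} {tri (cnt b)} {wt a} {wt b} eq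

tri₁ : ∀ {a b tb ta tc} → a * b + tc ≡ ta + tb + a → suc a * suc b + tc ≡ a + ta + (b + tb) + suc a
tri₁ {a} {b} {tb} {ta} {tc} e0 = (e0) by eq a b tb ta tc
  where
  eq : ∀ a b tb ta tc → suc a * suc b + tc + (ta + tb + a) ≡ a + ta + (b + tb) + suc a + (a * b + tc)
  eq = solve-∀

tri-mul : ∀ a c → a * (a + c) + tri c ≡ tri a + tri (a + c) + a
tri-mul zero    c = sym (+-identityʳ (tri c))
tri-mul (suc a) c = tri₁ {a} {a + c} {tri (a + c)} {tri a} (tri-mul a c)

sum₁ : ∀ {s a b ta tb tc wa wb} → s + ta + tb ≡ wa + wb + a * b → a * b + tc ≡ ta + tb + a → s + tc ≡ wa + wb + a
sum₁ {s} {a} {b} {ta} {tb} {tc} {wa} {wb} e0 e1 = (e0 & e1) by eq s a b ta tb tc wa wb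
  where
  eq : ∀ s a b ta tb tc wa wb → s + tc + (wa + wb + a * b + (ta + tb + a)) ≡ wa + wb + a + (s + ta + tb + (a * b + tc))
  eq = solve-∀

-- For a fixed excess `c` the product and the two triangular numbers collapse to a constant and a
-- term linear in `cnt a`. This is why sizes can be compared by weights alone.
sum-shape-centred : ∀ {c} a b → cnt b ≡ cnt a + c → sum (shape (reverse a ++ map not b)) + tri c ≡ wt a + wt b + cnt a
sum-shape-centred {c} a b eq = sum₁ {a = cnt a} {cnt b} {tri (cnt a)} {tri (cnt b)} {tri c} {wt a} {wt b} (sum-shape a b)
  (subst (λ z → cnt a * z + tri c ≡ tri (cnt a) + tri z + cnt a) (sym eq) (tri-mul (cnt a) c))

-- λ_{j+1} = j + m for some j ≥ 0; in Dyson's terms, -m is in the rank-set of λ.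
occ : ℕ → List ℕ → Set
occ m []       = ⊥
occ m (x ∷ xs) = x ≡ m ⊎ occ (suc m) xs

occ? : ∀ m xs → Dec (occ m xs)
occ? m []       = no λ ()
occ? m (x ∷ xs) with x ℕ.≟ m | occ? (suc m) xs
... | yes p | _     = yes (inj₁ p)
... | no _  | yes q = yes (inj₂ q)
... | no p  | no q  = no λ { (inj₁ r) → p r ; (inj₂ r) → q r }

¬occ-small : ∀ {m xs} → All (_< m) xs → ¬ occ m xs
¬occ-small (lt ∷ _)  (inj₁ refl) = 1+n≰n lt
¬occ-small (_ ∷ lts) (inj₂ o)    = ¬occ-small (All.map m≤n⇒m≤1+n lts) o

occ₁ : ∀ {c l m} → c ≡ suc l + m → c ≡ l + suc m
occ₁ {c} {l} {m} e0 = (e0) by eq c l m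
  where
  eq : ∀ c l m → c + (suc l + m) ≡ l + suc m + (c)
  eq = solve-∀

-- The vertical step after `x` is a part of size `cof y` with `cnt x` parts before it, and the
-- equation makes `cof y` equal to `cnt x + m`.
occ-true : ∀ x y {m} → cof (x ++ true ∷ y) ≡ length x + m → occ m (shape (x ++ true ∷ y))
occ-true []          y eq = inj₁ eq
occ-true (true ∷ x)  y eq = inj₂ (occ-true x y (occ₁ {l = length x} eq))
occ-true (false ∷ x) y eq = occ-true x y (suc-injective eq)

-- λ_{j+1} - j decreases strictly in j. It is above `m` for the parts before this horizontal step
-- and below `m` for those after it.
occ-false : ∀ x y {m} → cof (x ++ false ∷ y) ≡ length x + m → ¬ occ m (shape (x ++ false ∷ y))
occ-false []          y refl o        = ¬occ-small (All.map s≤s (shape≤cof y)) o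
occ-false (true ∷ x)  y {m} eq (inj₁ p) = m≢1+n+m m (trans (sym p) eq)
occ-false (true ∷ x)  y eq   (inj₂ o) = occ-false x y (occ₁ {l = length x} eq) o
occ-false (false ∷ x) y eq   o        = occ-false x y (suc-injective eq) o

occ-++ : ∀ {m xs ys} → occ m xs → occ m (xs ++ ys)
occ-++ {xs = _ ∷ _} (inj₁ p) = inj₁ p
occ-++ {xs = _ ∷ _} (inj₂ o) = inj₂ (occ-++ o)

occ-zeros : ∀ {m} xs k → occ (suc m) (xs ++ replicate k 0) → occ (suc m) xs
occ-zeros (x ∷ xs) k       (inj₁ p) = inj₁ p
occ-zeros (x ∷ xs) k       (inj₂ o) = inj₂ (occ-zeros xs k o)
occ-zeros []       (suc k) (inj₂ o) = occ-zeros [] k o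

-- Padded boundary words for rank at least m and rank below m

max-decreasing : ∀ {x xs} → Linked _≥_ (x ∷ xs) → max 0 (x ∷ xs) ≡ x
max-decreasing {x} {xs} l = ≤-antisym (max≤v⁺ {xs = x ∷ xs} z≤n (≤-refl ∷ bounded l)) (All.head (xs≤max 0 (x ∷ xs)))
  where
  bounded : ∀ {x xs} → Linked _≥_ (x ∷ xs) → All (_≤ x) xs
  bounded [-]      = []
  bounded (le ∷ l) = le ∷ All.map (λ le′ → ≤-trans le′ le) (bounded l)

linked-zeros : ∀ {h} xs k → Linked _≥_ (h ∷ xs) → Linked _≥_ (h ∷ xs ++ replicate k 0)
linked-zeros []       zero    _        = [-]
linked-zeros []       (suc k) _        = z≤n ∷ linked-zeros [] k [-]
linked-zeros (x ∷ xs) k       (le ∷ l) = le ∷ linked-zeros xs k l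

strip-zeros : ∀ {h} xs → Linked _≥_ (h ∷ xs) → ∃₂ λ ys k → xs ≡ ys ++ replicate k 0 × All (_> 0) ys × Linked _≥_ (h ∷ ys)
strip-zeros []           _        = [] , 0 , refl , [] , [-]
strip-zeros (zero ∷ xs)  (le ∷ l) with ys , k , eq , ps , l′ ← strip-zeros xs l = zeros ys k eq l′ ps
  where
  zeros : ∀ ys k → xs ≡ ys ++ replicate k 0 → Linked _≥_ (0 ∷ ys) → All (_> 0) ys → _
  zeros []       k eq _        _ = [] , suc k , cong (0 ∷_) eq , [] , [-]
  zeros (y ∷ ys) k eq (z≤n ∷ _) (() ∷ _)
strip-zeros (suc x ∷ xs) (le ∷ l) with ys , k , eq , ps , l′ ← strip-zeros xs l = suc x ∷ ys , k , cong (suc x ∷_) eq , s≤s z≤n ∷ ps , le ∷ l′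

zeros-unique : ∀ xs ys k l → All (_> 0) xs → All (_> 0) ys → xs ++ replicate k 0 ≡ ys ++ replicate l 0 → xs ≡ ys
zeros-unique []       []       _       _       _        _        _  = refl
zeros-unique (x ∷ xs) (y ∷ ys) k       l       (_ ∷ ps) (_ ∷ qs) eq = cong₂ _∷_ (∷-injectiveˡ eq) (zeros-unique xs ys k l ps qs (∷-injectiveʳ eq))
zeros-unique []       (y ∷ ys) (suc k) l       _        (q ∷ _)  eq = ⊥-elim (<-irrefl (∷-injectiveˡ eq) q)
zeros-unique (x ∷ xs) []       k       (suc l) (p ∷ _)  _        eq = ⊥-elim (<-irrefl (sym (∷-injectiveˡ eq)) p)

sum-zeros : ∀ xs k → sum (xs ++ replicate k 0) ≡ sum xs
sum-zeros []       zero    = refl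
sum-zeros []       (suc k) = sum-zeros [] k
sum-zeros (x ∷ xs) k       = cong (x +_) (sum-zeros xs k)

-- Words of partitions of rank ≥ m: the word starts with a vertical step and is
-- padded with parts 0 so that it has m more horizontal than vertical steps.
record High (m : ℕ) {n} (π : Partition n) (w : List Bool) : Set where
  constructor high
  field
    {tail}  : List Bool
    {zeros} : ℕ
    starts  : w ≡ true ∷ tail
    excess  : cof w ≡ cnt w + m
    parts≡  : shape w ≡ parts π ++ replicate zeros 0

-- Words of partitions of rank < m: the word ends with a horizontal step and is
-- padded with horizontal steps at the start.
record Low (m : ℕ) {n} (π : Partition n) (w : List Bool) : Set where
  constructor low
  field
    {init} : List Bool
    ends   : w ≡ init ∷ʳ false
    excess : suc (cof w) ≡ cnt w + m
    parts≡ : shape w ≡ parts π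

length-parts : ∀ w {k} xs → shape w ≡ xs ++ replicate k 0 → cnt w ≡ length xs + k
length-parts w {k} xs eq = trans (sym (length-shape w)) (trans (cong length eq) (trans (length-++ xs) (cong (length xs +_) (length-replicate k))))

high-arith : ∀ {k l m c} → c ≡ l + k → k + (l + m) ≡ c + m
high-arith {k} {l} {m} {c} e0 = (sym e0) by eq k l m c
  where
  eq : ∀ k l m c → k + (l + m) + (c) ≡ c + m + (l + k)
  eq = solve-∀

high-word : ∀ {m n} (π : Partition n) → 0 < m → numberOfParts π + m ≤ largestPart π → ∃ (High m π)
high-word {m} (partition [] d p s) m>0 le with () ← ≤-trans m>0 le
high-word {m} π@(partition (x ∷ xs) d p s) m>0 le =
  word x (x ∷ xs ++ replicate k 0) , high {tail = word x (xs ++ replicate k 0)} {zeros = k}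
    (cong (λ z → replicate z false ++ true ∷ word x (xs ++ replicate k 0)) (n∸n≡0 x))
    (trans (cof-word x _ lk) (trans (sym (m∸n+n≡m le′)) (high-arith {k} {suc (length xs)} (length-parts (word x (x ∷ xs ++ replicate k 0)) (x ∷ xs) sh))))
    sh
  where
  -- The zeros bring the number of vertical steps up to `x - m`, as `excess` demands.
  k = x ∸ (suc (length xs) + m)
  le′ : suc (length xs) + m ≤ x
  le′ = subst (suc (length xs) + m ≤_) (max-decreasing d) le
  lk : Linked _≥_ (x ∷ x ∷ xs ++ replicate k 0)
  lk = ≤-refl ∷ linked-zeros xs k d
  sh = shape-word x (x ∷ xs ++ replicate k 0) lk

low-word : ∀ {m n} (π : Partition n) → 0 < n → largestPart π < numberOfParts π + m → ∃ (Low m π)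
low-word {m} (partition [] d p refl) ()
low-word {m} π@(partition (x ∷ xs) d p s) n>0 lt =
  word h (x ∷ xs) , low (proj₂ last) (trans (cong suc (cof-word h (x ∷ xs) lk)) (cong (_+ m) (sym low-arith))) sh
  where
  -- One less than the number of parts plus `m`. That the rank is below `m` means exactly that the
  -- largest part `x` is at most this.
  h = length xs + m
  lk : Linked _≥_ (h ∷ x ∷ xs)
  lk = s≤s⁻¹ (subst (_< suc h) (max-decreasing d) lt) ∷ d
  sh = shape-word h (x ∷ xs) lk
  last = word-last h (x ∷ xs) (≤-trans (All.head p) (s≤s⁻¹ (subst (_< suc h) (max-decreasing d) lt))) p
  low-arith : cnt (word h (x ∷ xs)) ≡ suc (length xs)
  low-arith = trans (sym (length-shape (word h (x ∷ xs)))) (cong length sh)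

high-partition : ∀ {m n} w {tail} → w ≡ true ∷ tail → cof w ≡ cnt w + m → sum (shape w) ≡ n → ∃ λ (π : Partition n) → High m π w
high-partition w st ex refl with ys , k , eq , ps , l ← strip-zeros (shape w) (shape-linked w ≤-refl) =
  partition ys (Linked.tail l) ps (trans (sym (sum-zeros ys k)) (cong sum (sym eq))) , high st ex eq

shape-positive : ∀ w → All (_> 0) (shape (w ∷ʳ false))
shape-positive []          = []
shape-positive (true ∷ w)  = subst (0 <_) (sym (trans (cof-++ w (false ∷ [])) (+-comm (cof w) 1))) (s≤s z≤n) ∷ shape-positive w
shape-positive (false ∷ w) = shape-positive w

low-partition : ∀ {m n} w {init} → w ≡ init ∷ʳ false → suc (cof w) ≡ cnt w + m → sum (shape w) ≡ n → ∃ λ (π : Partition n) → Low m π w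
low-partition w {i} refl ex refl = partition (shape w) (Linked.tail (shape-linked w ≤-refl)) (shape-positive i) refl , low refl ex refl

high-head : ∀ {m n} {π : Partition n} {w} → 0 < m → High m π w → largestPart π ≡ cof w
high-head {m} {π = partition [] _ _ _} {w} m>0 (high {zeros = suc k} refl ex eq) =
  ⊥-elim (1+n≰n (≤-trans m>0 (≤-trans (m≤n+m m _) (≤-reflexive (trans (sym ex) (∷-injectiveˡ eq))))))
high-head {π = partition (x ∷ xs) d _ _} m>0 (high refl ex eq) = trans (max-decreasing d) (sym (∷-injectiveˡ eq))

high-rank : ∀ {m n} {π : Partition n} {w} → 0 < m → High m π w → numberOfParts π + m ≤ largestPart π
high-rank {m} {π = π} {w} m>0 l@(high {zeros = k} st ex eq) = begin
  numberOfParts π + m      ≤⟨ +-monoˡ-≤ m (m≤m+n (numberOfParts π) k) ⟩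
  numberOfParts π + k + m  ≡⟨ cong (_+ m) (sym (length-parts w (parts π) eq)) ⟩
  cnt w + m                ≡⟨ sym ex ⟩
  cof w                    ≡⟨ sym (high-head m>0 l) ⟩
  largestPart π            ∎
  where open ≤-Reasoning

low-rank : ∀ {m n} {π : Partition n} {w} → Low m π w → largestPart π < numberOfParts π + m
low-rank {m} {π = π} {w} (low en ex eq) = begin
  suc (largestPart π)   ≤⟨ s≤s (max≤v⁺ {xs = parts π} z≤n (subst (All (_≤ cof w)) eq (shape≤cof w))) ⟩
  suc (cof w)           ≡⟨ ex ⟩
  cnt w + m             ≡⟨ cong (_+ m) (trans (sym (length-shape w)) (cong length eq)) ⟩
  numberOfParts π + m   ∎
  where open ≤-Reasoning

high-unique : ∀ {m n} {π : Partition n} {w w′} → 0 < m → High m π w → High m π w′ → w ≡ w′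
high-unique {m} {π = π} {w} {w′} m>0 l@(high {zeros = k} st ex eq) l′@(high {zeros = k′} st′ ex′ eq′) =
  shape-injective w w′ cofs (trans eq (trans (cong (λ z → parts π ++ replicate z 0) zs) (sym eq′)))
  where
  cofs : cof w ≡ cof w′
  cofs = trans (sym (high-head m>0 l)) (high-head m>0 l′)
  zs : k ≡ k′
  zs = +-cancelˡ-≡ (numberOfParts π) k k′ (trans (sym (length-parts w (parts π) eq))
         (trans (+-cancelʳ-≡ m _ _ (trans (sym ex) (trans cofs ex′))) (length-parts w′ (parts π) eq′)))

low-unique : ∀ {m n} {π : Partition n} {w w′} → Low m π w → Low m π w′ → w ≡ w′
low-unique {m} {π = π} {w} {w′} (low _ ex eq) (low _ ex′ eq′) = shape-injective w w′
  (suc-injective (trans ex (trans (cong (_+ m) (trans (sym (length-shape w)) (trans (cong length (trans eq (sym eq′))) (length-shape w′)))) (sym ex′))))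
  (trans eq (sym eq′))

high-injective : ∀ {m n} {π ρ : Partition n} {w} → High m π w → High m ρ w → π ≡ ρ
high-injective {π = π} {ρ} (high {zeros = k} _ _ eq) (high {zeros = l} _ _ eq′) =
  Partition-ext (zeros-unique (parts π) (parts ρ) k l (positive π) (positive ρ) (trans (sym eq) eq′))

low-injective : ∀ {m n} {π ρ : Partition n} {w} → Low m π w → Low m ρ w → π ≡ ρ
low-injective (low _ _ eq) (low _ _ eq′) = Partition-ext (trans (sym eq) eq′)

-- Words put together from the two sets at the cut

cof-∷ʳ : ∀ xs b → cof (xs ∷ʳ b) ≡ cof xs + cof [ b ]
cof-∷ʳ xs b = cof-++ xs [ b ]

cof-reverse : ∀ xs → cof (reverse xs) ≡ cof xs
cof-reverse []       = refl
cof-reverse (x ∷ xs) = trans (cong cof (unfold-reverse x xs)) (trans (cof-∷ʳ (reverse xs) x) (aux x (cof-reverse xs)))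
  where
  aux : ∀ {n} x → n ≡ cof xs → n + cof [ x ] ≡ cof (x ∷ xs)
  aux false refl = +-comm (cof xs) 1
  aux true  refl = +-identityʳ (cof xs)

map-not-involutive : ∀ w → map not (map not w) ≡ w
map-not-involutive []          = refl
map-not-involutive (true ∷ w)  = cong (true ∷_) (map-not-involutive w)
map-not-involutive (false ∷ w) = cong (false ∷_) (map-not-involutive w)

-- u and v list the sets a and b from the cut outwards, without the step at the cut
-- and without the extreme step that makes the rank large or small.
highWord lowWord : (u v : List Bool) → List Bool
highWord u v = reverse (false ∷ u ∷ʳ true) ++ map not v
lowWord  u v = reverse (true ∷ u) ++ map not (v ∷ʳ true)

reverse-head-++ : ∀ b (u y : List Bool) → reverse (b ∷ u) ++ y ≡ reverse u ++ b ∷ y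
reverse-head-++ b u y = trans (cong (_++ y) (unfold-reverse b u)) (++-assoc (reverse u) [ b ] y)

highWord-reverse : ∀ x y → highWord (reverse x) (map not y) ≡ true ∷ x ++ false ∷ y
highWord-reverse x y = trans (reverse-head-++ false (reverse x ∷ʳ true) (map not (map not y)))
  (cong₂ (λ a b → a ++ false ∷ b) (trans (reverse-++ (reverse x) [ true ]) (cong (true ∷_) (reverse-involutive x))) (map-not-involutive y))

lowWord-reverse : ∀ x y → lowWord (reverse x) (map not y) ≡ x ++ true ∷ y ∷ʳ false
lowWord-reverse x y = trans (reverse-head-++ true (reverse x) (map not (map not y ∷ʳ true)))
  (cong₂ (λ a b → a ++ true ∷ b) (reverse-involutive x) (trans (map-++ not (map not y) [ true ]) (cong (_∷ʳ false) (map-not-involutive y))))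

cof-highWord : ∀ u v → cof (highWord u v) ≡ suc (cof u + cnt v)
cof-highWord u v = trans (cof-++ (reverse (false ∷ u ∷ʳ true)) (map not v))
  (cong₂ _+_ (trans (cof-reverse (false ∷ u ∷ʳ true)) (cong suc (trans (cof-∷ʳ u true) (+-identityʳ (cof u))))) (cof-not v))

cnt-highWord : ∀ u v → cnt (highWord u v) ≡ suc (cnt u + cof v)
cnt-highWord u v = trans (cnt-++ (reverse (false ∷ u ∷ʳ true)) (map not v))
  (cong₂ _+_ (trans (cnt-reverse (false ∷ u ∷ʳ true)) (trans (cnt-∷ʳ u true) (+-comm (cnt u) 1))) (cnt-not v))

cof-lowWord : ∀ u v → cof (lowWord u v) ≡ suc (cof u + cnt v)
cof-lowWord u v = trans (cof-++ (reverse (true ∷ u)) (map not (v ∷ʳ true)))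
  (trans (cong₂ _+_ (cof-reverse (true ∷ u)) (trans (cof-not (v ∷ʳ true)) (trans (cnt-∷ʳ v true) (+-comm (cnt v) 1)))) (+-suc (cof u) (cnt v)))

cnt-lowWord : ∀ u v → cnt (lowWord u v) ≡ suc (cnt u + cof v)
cnt-lowWord u v = trans (cnt-++ (reverse (true ∷ u)) (map not (v ∷ʳ true)))
  (cong₂ _+_ (cnt-reverse (true ∷ u)) (trans (cnt-not (v ∷ʳ true)) (trans (cof-∷ʳ v true) (+-identityʳ (cof v)))))

highWord-starts : ∀ u v → ∃ λ t → highWord u v ≡ true ∷ t
highWord-starts u v = _ , cong (_++ map not v) (trans (unfold-reverse false (u ∷ʳ true)) (cong (_∷ʳ false) (reverse-++ u [ true ])))

lowWord-ends : ∀ u v → ∃ λ i → lowWord u v ≡ i ∷ʳ false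
lowWord-ends u v = _ , trans (cong (reverse (true ∷ u) ++_) (map-++ not v [ true ])) (sym (++-assoc (reverse (true ∷ u)) (map not v) [ false ]))

highWord-occ : ∀ u v {m} → cof (highWord u v) ≡ suc (length u) + m → ¬ occ m (shape (highWord u v))
highWord-occ u v eq o = occ-false (reverse (u ∷ʳ true)) (map not v)
  (trans (cong cof (sym split-eq)) (trans eq (cong (_+ _) (sym (trans (length-reverse (u ∷ʳ true)) (length-∷ʳ u true))))))
  (subst (λ z → occ _ (shape z)) split-eq o)
  where split-eq = reverse-head-++ false (u ∷ʳ true) (map not v)

lowWord-occ : ∀ u v {m} → cof (lowWord u v) ≡ length u + m → occ m (shape (lowWord u v))
lowWord-occ u v eq = subst (λ z → occ _ (shape z)) (sym split-eq) (occ-true (reverse u) (map not (v ∷ʳ true))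
  (trans (cong cof (sym split-eq)) (trans eq (cong (_+ _) (sym (length-reverse u))))))
  where split-eq = reverse-head-++ true u (map not (v ∷ʳ true))

double-injective : ∀ a b {k} → a + (a + k) ≡ b + (b + k) → a ≡ b
double-injective a b {k} eq = *-cancelˡ-≡ a b 2 (+-cancelʳ-≡ k (2 * a) (2 * b) (trans (aux a k) (trans eq (sym (aux b k)))))
  where
  aux : ∀ a k → 2 * a + k ≡ a + (a + k)
  aux = solve-∀

lowWord-length : ∀ {k} u v → length v ≡ length u + k → length (lowWord u v) ≡ suc (suc (length u + (length u + k)))
lowWord-length {k} u v lv = trans (length-++ (reverse (true ∷ u))) (trans (cong₂ _+_ (length-reverse (true ∷ u))
  (trans (length-map not (v ∷ʳ true)) (trans (length-∷ʳ v true) (cong suc lv)))) (cong suc (+-suc (length u) (length u + k))))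

-- As the difference `k` of the lengths is fixed, the length of the word determines where the cut
-- is.
lowWord-injective : ∀ {u v u′ v′ k} → length v ≡ length u + k → length v′ ≡ length u′ + k →
                    lowWord u v ≡ lowWord u′ v′ → u ≡ u′ × v ≡ v′
lowWord-injective {u} {v} {u′} {v′} {k} lv lv′ eq
  with lu ← double-injective (length u) (length u′) (suc-injective (suc-injective
              (trans (sym (lowWord-length u v lv)) (trans (cong length eq) (lowWord-length u′ v′ lv′)))))
  with eq₁ , eq₂ ← ++-split-injective (reverse (true ∷ u)) (reverse (true ∷ u′))
         (trans (length-reverse (true ∷ u)) (trans (cong suc lu) (sym (length-reverse (true ∷ u′))))) eq
  with refl ← ∷-injectiveʳ (reverse-injective {x = true ∷ u} {y = true ∷ u′} eq₁)
  with refl , _ ← ∷ʳ-injective v v′ (map-injective not-injective eq₂) = refl , refl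

highWord-prefix : ∀ u → length (reverse (false ∷ u ∷ʳ true)) ≡ suc (suc (length u))
highWord-prefix u = trans (length-reverse (false ∷ u ∷ʳ true)) (cong suc (length-∷ʳ u true))

highWord-length : ∀ {k} u v → length v ≡ length u + k → length (highWord u v) ≡ suc (suc (length u + (length u + k)))
highWord-length u v lv = trans (length-++ (reverse (false ∷ u ∷ʳ true))) (cong₂ _+_ (highWord-prefix u) (trans (length-map not v) lv))

highWord-injective : ∀ {u v u′ v′ k} → length v ≡ length u + k → length v′ ≡ length u′ + k →
                     highWord u v ≡ highWord u′ v′ → u ≡ u′ × v ≡ v′
highWord-injective {u} {v} {u′} {v′} {k} lv lv′ eq
  with lu ← double-injective (length u) (length u′) (suc-injective (suc-injective
              (trans (sym (highWord-length u v lv)) (trans (cong length eq) (highWord-length u′ v′ lv′)))))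
  with eq₁ , eq₂ ← ++-split-injective (reverse (false ∷ u ∷ʳ true)) (reverse (false ∷ u′ ∷ʳ true))
         (trans (highWord-prefix u) (trans (cong (λ z → suc (suc z)) lu) (sym (highWord-prefix u′)))) eq
  with refl , _ ← ∷ʳ-injective u u′ (∷-injectiveʳ (reverse-injective {x = false ∷ u ∷ʳ true} {y = false ∷ u′ ∷ʳ true} eq₁))
  with refl ← map-injective not-injective eq₂ = refl , refl

sum₂ : ∀ {s t cz wz lu cu wu wv} → s + t ≡ cz + wz + wv + cz → cz ≡ cu + 1 → wz ≡ wu + lu * 1 → s + t ≡ lu + 2 + (wu + 2 * cu + wv)
sum₂ {s} {t} {cz} {wz} {lu} {cu} {wu} {wv} e0 e1 e2 = (e0 & e1 & e1 & e2) by eq s t cz wz lu cu wu wv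
  where
  eq : ∀ s t cz wz lu cu wu wv → s + t + (cz + wz + wv + cz + (cu + 1 + (cu + 1 + (wu + lu * 1)))) ≡ lu + 2 + (wu + 2 * cu + wv) + (s + t + (cz + (cz + (wz))))
  eq = solve-∀
sum₃ : ∀ {s t wz lv cu wu wv} → s + t ≡ cu + wu + wz + suc cu → wz ≡ wv + lv * 1 → s + t ≡ lv + 1 + (wu + 2 * cu + wv)
sum₃ {s} {t} {wz} {lv} {cu} {wu} {wv} e0 e1 = (e0 & e1) by eq s t wz lv cu wu wv
  where
  eq : ∀ s t wz lv cu wu wv → s + t + (cu + wu + wz + suc cu + (wv + lv * 1)) ≡ lv + 1 + (wu + 2 * cu + wv) + (s + t + (wz))
  eq = solve-∀
cnt₂ : ∀ {cv cz cu c} → cv ≡ suc (cu + c) → cz ≡ cu + 1 → cv ≡ cz + c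
cnt₂ {cv} {cz} {cu} {c} e0 e1 = (e0 & sym e1) by eq cv cz cu c
  where
  eq : ∀ cv cz cu c → cv + (suc (cu + c) + (cz)) ≡ cz + c + (cv + (cu + 1))
  eq = solve-∀
cnt₃ : ∀ {cv cz cu c} → cv ≡ cu + c → cz ≡ cv + 1 → cz ≡ suc cu + c
cnt₃ {cv} {cz} {cu} {c} e0 e1 = (e0 & e1) by eq cv cz cu c
  where
  eq : ∀ cv cz cu c → cz + (cu + c + (cv + 1)) ≡ suc cu + c + (cv + (cz))
  eq = solve-∀

sum-highWord : ∀ {c} u v → cnt v ≡ suc (cnt u + c) →
               sum (shape (highWord u v)) + tri c ≡ length u + 2 + (wt u + 2 * cnt u + wt v)
sum-highWord {c} u v eq = sum₂ {sum (shape (highWord u v))} {tri c} {cz = cnt (u ∷ʳ true)} {wt (u ∷ʳ true)} {length u} {cnt u} {wt u} {wt v}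
  (sum-shape-centred (false ∷ u ∷ʳ true) v (cnt₂ {cu = cnt u} {c} eq (cnt-∷ʳ u true))) (cnt-∷ʳ u true) (wt-∷ʳ u true)

sum-lowWord : ∀ {c} u v → cnt v ≡ cnt u + c →
              sum (shape (lowWord u v)) + tri c ≡ length v + 1 + (wt u + 2 * cnt u + wt v)
sum-lowWord {c} u v eq = sum₃ {sum (shape (lowWord u v))} {tri c} {wz = wt (v ∷ʳ true)} {length v} {cnt u} {wt u} {wt v}
  (sum-shape-centred (true ∷ u) (v ∷ʳ true) (cnt₃ {cu = cnt u} {c} eq (cnt-∷ʳ v true))) (wt-∷ʳ v true)

core-sum′ : ∀ {S S′ t lu lu′ c lv′ E E′} → S′ + t ≡ lv′ + 1 + E′ → S + t ≡ lu + 2 + E → lv′ ≡ lu′ + c → lu′ + c + E′ ≡ suc lu + E → S′ ≡ S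
core-sum′ {S} {S′} {t} {lu} {lu′} {c} {lv′} {E} {E′} e0 e1 e2 e3 = (e0 & sym e1 & e2 & e3) by eq S S′ t lu lu′ c lv′ E E′
  where
  eq : ∀ S S′ t lu lu′ c lv′ E E′ → S′ + (lv′ + 1 + E′ + (S + t + (lu′ + c + (suc lu + E)))) ≡ S + (S′ + t + (lu + 2 + E + (lv′ + (lu′ + c + E′))))
  eq = solve-∀

core-sum : ∀ {c u v u′ v′} → cnt v ≡ suc (cnt u + c) → Valid c u v u′ v′ → sum (shape (lowWord u′ v′)) ≡ sum (shape (highWord u v))
core-sum {c} {u} {v} {u′} {v′} cv (valid l n w) =
  core-sum′ {t = tri c} {length u} {length u′} {c} (sum-lowWord u′ v′ n) (sum-highWord u v cv) l w

-- From partitions of rank at least m to X(m), and from X(m+1) back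

record HighToLow (c : ℕ) {n} (π ρ : Partition n) : Set where
  constructor highToLow
  field
    {u v u′ v′} : List Bool
    source  : High (suc c) π (highWord u v)
    move    : Core c u v u′ v′
    length≡ : length v′ ≡ length u′ + c
    target  : Low (suc c) ρ (lowWord u′ v′)

highToLow-injective : ∀ {c n} {π π′ ρ : Partition n} → HighToLow c π ρ → HighToLow c π′ ρ → π ≡ π′
highToLow-injective (highToLow {u′ = a} {b} s m l t) (highToLow {u′ = a′} {b′} s′ m′ l′ t′)
  with refl , refl ← lowWord-injective {a} {b} {a′} {b′} l l′ (low-unique t t′)
  with refl , refl ← core-injective m m′ refl refl = high-injective s s′

high-len : ∀ {cw fw lx ly lw c} → fw ≡ cw + suc c → cw + fw ≡ lw → lw ≡ suc lx + suc ly → suc lx ≡ cw → ly ≡ suc (lx + c)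
high-len {cw} {fw} {lx} {ly} {lw} {c} e0 e1 e2 e3 = (e0 & sym e1 & sym e2 & sym e3 & sym e3) by eq cw fw lx ly lw c
  where
  eq : ∀ cw fw lx ly lw c → ly + (cw + suc c + (cw + fw + (lw + (suc lx + (suc lx))))) ≡ suc (lx + c) + (fw + (lw + (suc lx + suc ly + (cw + (cw)))))
  eq = solve-∀
high-num : ∀ {cw fw lx c cx fx fy} → fw ≡ cw + suc c → fw ≡ fx + suc fy → cx + fx ≡ lx → suc lx ≡ cw → fy ≡ suc (cx + c)
high-num {cw} {fw} {lx} {c} {cx} {fx} {fy} e0 e1 e2 e3 = (e0 & sym e1 & sym e2 & sym e3) by eq cw fw lx c cx fx fy
  where
  eq : ∀ cw fw lx c cx fx fy → fy + (cw + suc c + (fw + (cx + fx + (suc lx)))) ≡ suc (cx + c) + (fw + (fx + suc fy + (lx + (cw))))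
  eq = solve-∀
low-excess : ∀ {lu lv cu cv fu fv c x y} → lv ≡ lu + c → cv ≡ cu + c → cu + fu ≡ lu → cv + fv ≡ lv → x ≡ suc (fu + cv) → y ≡ suc (cu + fv) → suc x ≡ y + suc c
low-excess {lu} {lv} {cu} {cv} {fu} {fv} {c} {x} {y} e0 e1 e2 e3 e4 e5 = (sym e0 & e1 & e1 & e2 & sym e3 & e4 & sym e5) by eq lu lv cu cv fu fv c x y
  where
  eq : ∀ lu lv cu cv fu fv c x y → suc x + (lv + (cu + c + (cu + c + (lu + (cv + fv + (suc (fu + cv) + (y))))))) ≡ y + suc c + (lu + c + (cv + (cv + (cu + fu + (lv + (x + (suc (cu + fv))))))))
  eq = solve-∀
low-cof : ∀ {lu cu cv fu c x} → cv ≡ cu + c → cu + fu ≡ lu → x ≡ suc (fu + cv) → x ≡ lu + suc c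
low-cof {lu} {cu} {cv} {fu} {c} {x} e0 e1 e2 = (e0 & e1 & e2) by eq lu cu cv fu c x
  where
  eq : ∀ lu cu cv fu c x → x + (cu + c + (lu + (suc (fu + cv)))) ≡ lu + suc c + (cv + (cu + fu + (x)))
  eq = solve-∀

highToLow-total′ : ∀ {c n} (π : Partition n) u v → High (suc c) π (highWord u v) →
                   length v ≡ suc (length u + c) → cnt v ≡ suc (cnt u + c) →
                   ∃ λ ρ → occ (suc c) (parts ρ) × HighToLow c π ρ
highToLow-total′ {c} {n} π u v hi@(high {zeros = k} _ _ sh) lv cv
  with u′ , v′ , m , va@(valid l cv′ _) ← core c u v lv cv
  with ρ , lo ← low-partition {m = suc c} {n} (lowWord u′ v′) (proj₂ (lowWord-ends u′ v′))
         (low-excess {lu = length u′} {cu = cnt u′} {cnt v′} {cof u′} {cof v′} {c} l cv′ (cnt+cof u′) (cnt+cof v′) (cof-lowWord u′ v′) (cnt-lowWord u′ v′))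
         (trans (core-sum cv va) (trans (cong sum sh) (trans (sum-zeros (parts π) k) (sums-to π))))
  = ρ , subst (occ (suc c)) (Low.parts≡ lo) (lowWord-occ u′ v′ (low-cof {cu = cnt u′} {cnt v′} {cof u′} {c} cv′ (cnt+cof u′) (cof-lowWord u′ v′))) ,
    highToLow hi m l lo

highToLow-total : ∀ {c n} (π : Partition n) → numberOfParts π + suc c ≤ largestPart π → ¬ occ (suc c) (parts π) →
                  ∃ λ ρ → occ (suc c) (parts ρ) × HighToLow c π ρ
highToLow-total {c} π le ¬o with high-word π (s≤s z≤n) le
-- The diagonal of `occ (suc c)` is met after `cof w - suc c` steps, which is `cnt w` by `excess`.
... | w , hi@(high {zeros = k} st ex sh) with split (cnt w) w (≤-trans (m≤m+n (cnt w) (cof w)) (≤-reflexive (cnt+cof w)))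
... | [] , y , refl , lx with () ← trans lx (cong cnt st)
... | b ∷ x , [] , refl , lx = ⊥-elim (m≢1+m+n (cnt w) {cnt w + c} (trans (trans (sym lx) (cong length (sym (++-identityʳ (b ∷ x)))))
        (trans (sym (cnt+cof w)) (trans (cong (cnt w +_) (trans ex (+-suc (cnt w) c))) (+-suc (cnt w) (cnt w + c))))))
... | b ∷ x , true ∷ y , refl , lx = ⊥-elim (¬o (occ-zeros (parts π) k (subst (occ (suc c)) sh (occ-true (b ∷ x) y (trans ex (cong (_+ suc c) (sym lx)))))))
... | b ∷ x , false ∷ y , refl , lx with refl ← ∷-injectiveˡ st =
  highToLow-total′ π (reverse x) (map not y) (subst (High (suc c) π) (sym (highWord-reverse x y)) hi)
    (trans (length-map not y) (trans (high-len {lx = length x} ex (cnt+cof w) (length-++ (true ∷ x)) lx) (cong (λ z → suc (z + c)) (sym (length-reverse x)))))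
    (trans (cnt-not y) (trans (high-num {lx = length x} {c} {cnt x} {cof x} ex (cof-++ x (false ∷ y)) (cnt+cof x) lx) (cong (λ z → suc (z + c)) (sym (cnt-reverse x)))))

-- The map from X(m+1) \ {rank ≥ m} to {rank ≥ m} \ X(m+1), from lowWord u v to highWord u′ v′.
data Lift : (u v u′ v′ : List Bool) → Set where
  start : ∀ {v} → Lift [] v [] (true ∷ v)
  fill  : ∀ {u v} → Lift (false ∷ u) v (u ∷ʳ false) (true ∷ v)
  drop  : ∀ {u v} → Lift (true ∷ u) v (u ∷ʳ false ∷ʳ false) (false ∷ v ∷ʳ false)

lift-injective : ∀ {u v u₀ v₀ u′ v′ u₀′ v₀′} → Lift u v u′ v′ → Lift u₀ v₀ u₀′ v₀′ → u′ ≡ u₀′ → v′ ≡ v₀′ → u ≡ u₀ × v ≡ v₀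
lift-injective start                   start                     refl refl = refl , refl
lift-injective start                   (fill {[]})               ()
lift-injective start                   (fill {_ ∷ _})            ()
lift-injective (fill {[]})             start                     ()
lift-injective (fill {_ ∷ _})          start                     ()
lift-injective (fill {u})              (fill {u₀})               eq refl with refl , _ ← ∷ʳ-injective u u₀ eq = refl , refl
lift-injective (drop {u} {v})          (drop {u₀} {v₀})          eq eq′
  with eq₁ , _ ← ∷ʳ-injective (u ∷ʳ false) (u₀ ∷ʳ false) eq
  with refl , _ ← ∷ʳ-injective u u₀ eq₁
  with refl , _ ← ∷ʳ-injective v v₀ (∷-injectiveʳ eq′) = refl , refl

record Lifted (m : ℕ) (u v u′ v′ : List Bool) : Set where
  constructor lifted
  field
    len : length v′ ≡ suc (suc (length u′ + m))
    num : cnt v′ ≡ suc (cnt u′ + m)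
    wgt : length u′ + (wt u′ + 2 * cnt u′ + wt v′) ≡ length u + m + (wt u + 2 * cnt u + wt v)

fill-len : ∀ {lz lu lv m} → lz ≡ suc lu → lv ≡ suc (suc (lu + m)) → suc lv ≡ suc (suc (lz + m))
fill-len {lz} {lu} {lv} {m} e0 e1 = (sym e0 & e1) by eq lz lu lv m
  where
  eq : ∀ lz lu lv m → suc lv + (lz + (suc (suc (lu + m)))) ≡ suc (suc (lz + m)) + (suc lu + (lv))
  eq = solve-∀
fill-num : ∀ {cz cu cv m} → cz ≡ cu + 0 → cv ≡ cu + m → suc cv ≡ suc (cz + m)
fill-num {cz} {cu} {cv} {m} e0 e1 = (sym e0 & e1) by eq cz cu cv m
  where
  eq : ∀ cz cu cv m → suc cv + (cz + (cu + m)) ≡ suc (cz + m) + (cu + 0 + (cv))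
  eq = solve-∀
fill-wgt : ∀ {lz lu cz cu cv wz wu wv m} → lz ≡ suc lu → cz ≡ cu + 0 → wz ≡ wu + lu * 0 → cv ≡ cu + m → lz + (wz + 2 * cz + (cv + wv)) ≡ suc lu + m + (cu + wu + 2 * cu + wv)
fill-wgt {lz} {lu} {cz} {cu} {cv} {wz} {wu} {wv} {m} e0 e1 e2 e3 = (e0 & e1 & e1 & e2 & e3) by eq lz lu cz cu cv wz wu wv m
  where
  eq : ∀ lz lu cz cu cv wz wu wv m → lz + (wz + 2 * cz + (cv + wv)) + (suc lu + (cu + 0 + (cu + 0 + (wu + lu * 0 + (cu + m))))) ≡ suc lu + m + (cu + wu + 2 * cu + wv) + (lz + (cz + (cz + (wz + (cv)))))
  eq = solve-∀
drop-len : ∀ {ly lz lu lv lv′ m} → ly ≡ suc lz → lz ≡ suc lu → lv ≡ suc (suc (lu + m)) → lv′ ≡ suc lv → suc lv′ ≡ suc (suc (ly + m))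
drop-len {ly} {lz} {lu} {lv} {lv′} {m} e0 e1 e2 e3 = (sym e0 & sym e1 & e2 & e3) by eq ly lz lu lv lv′ m
  where
  eq : ∀ ly lz lu lv lv′ m → suc lv′ + (ly + (lz + (suc (suc (lu + m)) + (suc lv)))) ≡ suc (suc (ly + m)) + (suc lz + (suc lu + (lv + (lv′))))
  eq = solve-∀
drop-num : ∀ {cy cz cu cv cv′ m} → cy ≡ cz + 0 → cz ≡ cu + 0 → cv ≡ suc (cu + m) → cv′ ≡ cv + 0 → cv′ ≡ suc (cy + m)
drop-num {cy} {cz} {cu} {cv} {cv′} {m} e0 e1 e2 e3 = (sym e0 & sym e1 & e2 & e3) by eq cy cz cu cv cv′ m
  where
  eq : ∀ cy cz cu cv cv′ m → cv′ + (cy + (cz + (suc (cu + m) + (cv + 0)))) ≡ suc (cy + m) + (cz + 0 + (cu + 0 + (cv + (cv′))))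
  eq = solve-∀
drop-wgt : ∀ {ly lz lu cy cz cu cv cv′ wy wz wu wv wv′ m lv} → ly ≡ suc lz → lz ≡ suc lu → cy ≡ cz + 0 → cz ≡ cu + 0 → wy ≡ wz + lz * 0 → wz ≡ wu + lu * 0 → cv ≡ suc (cu + m) → cv′ ≡ cv + 0 → wv′ ≡ wv + lv * 0 → ly + (wy + 2 * cy + (cv′ + wv′)) ≡ suc lu + m + (cu + wu + 2 * suc cu + wv)
drop-wgt {ly} {lz} {lu} {cy} {cz} {cu} {cv} {cv′} {wy} {wz} {wu} {wv} {wv′} {m} {lv} e0 e1 e2 e3 e4 e5 e6 e7 e8 = (e0 & e1 & e2 & e2 & e3 & e3 & e4 & e5 & e6 & e7 & e8) by eq ly lz lu cy cz cu cv cv′ wy wz wu wv wv′ m lv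
  where
  eq : ∀ ly lz lu cy cz cu cv cv′ wy wz wu wv wv′ m lv → ly + (wy + 2 * cy + (cv′ + wv′)) + (suc lz + (suc lu + (cz + 0 + (cz + 0 + (cu + 0 + (cu + 0 + (wz + lz * 0 + (wu + lu * 0 + (suc (cu + m) + (cv + 0 + (wv + lv * 0))))))))))) ≡ suc lu + m + (cu + wu + 2 * suc cu + wv) + (ly + (lz + (cy + (cy + (cz + (cz + (wy + (wz + (cv + (cv′ + (wv′)))))))))))
  eq = solve-∀

-- Seen on the partition, the part λ_{j+1} = j + m + 1 at the cut is deleted, each part below it
-- loses one, and a new largest part makes up for the loss. In the case `drop` λ_j equals the
-- deleted part. The new largest part moves it to index j + 1, where it would be on the diagonal
-- again, so it loses one too.
lift : ∀ m u v → length v ≡ suc (length u + m) → cnt v ≡ cnt u + m → ∃₂ λ u′ v′ → Lift u v u′ v′ × Lifted m u v u′ v′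
lift m []          v lv cv = [] , true ∷ v , start , lifted (cong suc lv) (cong suc cv) (cong (_+ wt v) cv)
lift m (false ∷ u) v lv cv = u ∷ʳ false , true ∷ v , fill , lifted
  (fill-len {lu = length u} {m = m} (length-∷ʳ u false) lv)
  (fill-num {cu = cnt u} {m = m} (cnt-∷ʳ u false) cv)
  (fill-wgt {lu = length u} {cu = cnt u} {wu = wt u} {wt v} {m} (length-∷ʳ u false) (cnt-∷ʳ u false) (wt-∷ʳ u false) cv)
lift m (true ∷ u)  v lv cv = u ∷ʳ false ∷ʳ false , false ∷ v ∷ʳ false , drop , lifted
  (drop-len {lu = length u} {m = m} (length-∷ʳ (u ∷ʳ false) false) (length-∷ʳ u false) lv (length-∷ʳ v false))
  (drop-num {cz = cnt (u ∷ʳ false)} {cu = cnt u} {cv = cnt v} {m = m} (cnt-∷ʳ (u ∷ʳ false) false) (cnt-∷ʳ u false) cv (cnt-∷ʳ v false))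
  (drop-wgt {lz = length (u ∷ʳ false)} {lu = length u} {cz = cnt (u ∷ʳ false)} {cu = cnt u} {cv = cnt v} {wz = wt (u ∷ʳ false)} {wu = wt u} {wv = wt v} {m = m} {lv = length v}
    (length-∷ʳ (u ∷ʳ false) false) (length-∷ʳ u false) (cnt-∷ʳ (u ∷ʳ false) false) (cnt-∷ʳ u false)
    (wt-∷ʳ (u ∷ʳ false) false) (wt-∷ʳ u false) cv (cnt-∷ʳ v false) (wt-∷ʳ v false))

record LowToHigh (m : ℕ) {n} (π ρ : Partition n) : Set where
  constructor lowToHigh
  field
    {u v u′ v′} : List Bool
    source  : Low m π (lowWord u v)
    move    : Lift u v u′ v′
    length≡ : length v′ ≡ length u′ + (2 + m)
    target  : High m ρ (highWord u′ v′)

lowToHigh-injective : ∀ {m n} {π π′ ρ : Partition n} → 0 < m → LowToHigh m π ρ → LowToHigh m π′ ρ → π ≡ π′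
lowToHigh-injective m>0 (lowToHigh {u′ = a} {b} s m l t) (lowToHigh {u′ = a′} {b′} s′ m′ l′ t′)
  with refl , refl ← highWord-injective {a} {b} {a′} {b′} l l′ (high-unique m>0 t t′)
  with refl , refl ← lift-injective m m′ refl refl = low-injective s s′

lift-sum′ : ∀ {S S′ t lu lu′ m lv E E′} → S + t ≡ lv + 1 + E → S′ + t ≡ lu′ + 2 + E′ → lv ≡ suc (lu + m) → lu′ + E′ ≡ lu + m + E → S′ ≡ S
lift-sum′ {S} {S′} {t} {lu} {lu′} {m} {lv} {E} {E′} e0 e1 e2 e3 = (sym e0 & e1 & sym e2 & e3) by eq S S′ t lu lu′ m lv E E′
  where
  eq : ∀ S S′ t lu lu′ m lv E E′ → S′ + (S + t + (lu′ + 2 + E′ + (lv + (lu + m + E)))) ≡ S + (lv + 1 + E + (S′ + t + (suc (lu + m) + (lu′ + E′))))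
  eq = solve-∀
lift-excess : ∀ {lu lv cu cv fu fv m x y} → lv ≡ suc (suc (lu + m)) → cv ≡ suc (cu + m) → cu + fu ≡ lu → cv + fv ≡ lv → x ≡ suc (fu + cv) → y ≡ suc (cu + fv) → x ≡ y + m
lift-excess {lu} {lv} {cu} {cv} {fu} {fv} {m} {x} {y} e0 e1 e2 e3 e4 e5 = (sym e0 & e1 & e1 & e2 & sym e3 & e4 & sym e5) by eq lu lv cu cv fu fv m x y
  where
  eq : ∀ lu lv cu cv fu fv m x y → x + (lv + (suc (cu + m) + (suc (cu + m) + (lu + (cv + fv + (suc (fu + cv) + (y))))))) ≡ y + m + (suc (suc (lu + m)) + (cv + (cv + (cu + fu + (lv + (x + (suc (cu + fv))))))))
  eq = solve-∀
lift-cof : ∀ {lu cu cv fu m x} → cv ≡ suc (cu + m) → cu + fu ≡ lu → x ≡ suc (fu + cv) → x ≡ suc lu + suc m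
lift-cof {lu} {cu} {cv} {fu} {m} {x} e0 e1 e2 = (e0 & e1 & e2) by eq lu cu cv fu m x
  where
  eq : ∀ lu cu cv fu m x → x + (suc (cu + m) + (lu + (suc (fu + cv)))) ≡ suc lu + suc m + (cv + (cu + fu + (x)))
  eq = solve-∀
lift-len : ∀ {l lu m} → l ≡ suc (suc (lu + m)) → l ≡ lu + (2 + m)
lift-len {l} {lu} {m} e0 = (e0) by eq l lu m
  where
  eq : ∀ l lu m → l + (suc (suc (lu + m))) ≡ lu + (2 + m) + (l)
  eq = solve-∀

lowToHigh-total′ : ∀ {m n} (π : Partition n) u v → Low (suc m) π (lowWord u v) → length v ≡ suc (length u + suc m) → cnt v ≡ cnt u + suc m →
                   ∃ λ ρ → ¬ occ (suc (suc m)) (parts ρ) × LowToHigh (suc m) π ρ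
lowToHigh-total′ {m} {n} π u v lo lv cv
  with u′ , v′ , mv , lifted l cv′ w ← lift (suc m) u v lv cv
  with ρ , hi@(high {zeros = k} _ _ sh) ← high-partition {suc m} {n} (highWord u′ v′) (proj₂ (highWord-starts u′ v′))
         (lift-excess {length u′} {cu = cnt u′} {cnt v′} {cof u′} {cof v′} l cv′ (cnt+cof u′) (cnt+cof v′) (cof-highWord u′ v′) (cnt-highWord u′ v′))
         (trans (lift-sum′ {t = tri (suc m)} {length u} {length u′} {suc m} (sum-lowWord u v cv) (sum-highWord u′ v′ cv′) lv w) (trans (cong sum (Low.parts≡ lo)) (sums-to π)))
  = ρ , (λ o → highWord-occ u′ v′ (lift-cof {cu = cnt u′} {cnt v′} {cof u′} cv′ (cnt+cof u′) (cof-highWord u′ v′)) (subst (occ (suc (suc m))) (sym sh) (occ-++ o))) ,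
    lowToHigh lo mv (lift-len {lu = length u′} l) hi

low-len : ∀ {cw fw lx ly lw m} → suc fw ≡ cw + suc m → cw + fw ≡ lw → lw ≡ lx + suc (suc ly) → fw ≡ lx + suc (suc m) → ly ≡ suc (lx + suc m)
low-len {cw} {fw} {lx} {ly} {lw} {m} e0 e1 e2 e3 = (sym e0 & sym e1 & sym e2 & e3 & e3) by eq cw fw lx ly lw m
  where
  eq : ∀ cw fw lx ly lw m → ly + (suc fw + (cw + fw + (lw + (lx + suc (suc m) + (lx + suc (suc m)))))) ≡ suc (lx + suc m) + (cw + suc m + (lw + (lx + suc (suc ly) + (fw + (fw)))))
  eq = solve-∀
low-num : ∀ {fw lx m cx fx fy fz} → fw ≡ fx + fz → fz ≡ fy + 1 → cx + fx ≡ lx → fw ≡ lx + suc (suc m) → fy ≡ cx + suc m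
low-num {fw} {lx} {m} {cx} {fx} {fy} {fz} e0 e1 e2 e3 = (sym e0 & sym e1 & sym e2 & e3) by eq fw lx m cx fx fy fz
  where
  eq : ∀ fw lx m cx fx fy fz → fy + (fw + (fz + (cx + fx + (lx + suc (suc m))))) ≡ cx + suc m + (fx + fz + (fy + 1 + (lx + (fw))))
  eq = solve-∀

occ-index : ∀ w m → occ m (shape w) → ∃₂ λ x y → w ≡ x ++ true ∷ y × cof w ≡ length x + m
occ-index (true ∷ w)  m (inj₁ p) = [] , w , refl , p
occ-index (true ∷ w)  m (inj₂ o) with x , y , refl , eq ← occ-index w (suc m) o = true ∷ x , y , refl , trans eq (+-suc (length x) m)
occ-index (false ∷ w) m o        with x , y , refl , eq ← occ-index w m o = false ∷ x , y , refl , cong suc eq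

ends-false : ∀ x y₀ {i} → x ++ true ∷ y₀ ≡ i ∷ʳ false → ∃ λ y → y₀ ≡ y ∷ʳ false
ends-false x [] {i} eq with () ← proj₂ (∷ʳ-injective x i eq)
ends-false x y₀@(_ ∷ _) {i} eq with y , b , eq₀ ← snoc y₀ (s≤s z≤n)
  with refl ← proj₂ (∷ʳ-injective (x ++ true ∷ y) i (trans (++-assoc x (true ∷ y) [ b ]) (trans (cong (λ z → x ++ true ∷ z) (sym eq₀)) eq))) = y , eq₀

lowToHigh-total : ∀ {m n} (π : Partition n) → 0 < n → largestPart π < numberOfParts π + suc m → occ (suc (suc m)) (parts π) →
                  ∃ λ ρ → ¬ occ (suc (suc m)) (parts ρ) × LowToHigh (suc m) π ρ
lowToHigh-total {m} π n>0 lt o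
  with w , lo@(low en ex sh) ← low-word π n>0 lt
  with x , y₀ , refl , cf ← occ-index w (suc (suc m)) (subst (occ (suc (suc m))) (sym sh) o)
  with y , refl ← ends-false x y₀ en
  = lowToHigh-total′ π (reverse x) (map not y) (subst (Low (suc m) π) (sym (lowWord-reverse x y)) lo)
      (trans (length-map not y) (trans (low-len {lx = length x} ex (cnt+cof w)
        (trans (length-++ x) (cong (λ z → length x + suc z) (length-∷ʳ y false))) cf) (cong (λ z → suc (z + suc m)) (sym (length-reverse x)))))
      (trans (cnt-not y) (trans (low-num {lx = length x} {cx = cnt x} {cof x} {cof y} (cof-++ x (true ∷ y ∷ʳ false)) (cof-∷ʳ y false) (cnt+cof x) cf)
        (cong (_+ suc m) (sym (cnt-reverse x)))))

-- Counting by injective relations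
length-≤ : ∀ {A B : Set} {R : A → B → Set} → (∀ {x x′ y} → R x y → R x′ y → x ≡ x′) →
           ∀ {xs ys} → Unique xs → All (λ x → ∃ λ y → y ∈ ys × R x y) xs → length xs ≤ length ys
length-≤ inj [] [] = z≤n
length-≤ {R = R} inj {x ∷ xs} {ys} (x∉ ∷ un) ((y , y∈ , r) ∷ rs)
  with as , bs , refl ← ∈-∃++ y∈ = ≤-trans (s≤s (length-≤ inj un (All.tabulate others)))
    (≤-reflexive (trans (cong suc (length-++ as)) (trans (sym (+-suc (length as) (length bs))) (sym (length-++ as)))))
  where
  others : ∀ {x′} → x′ ∈ xs → ∃ λ y′ → y′ ∈ as ++ bs × R x′ y′
  others x′∈ with y′ , y′∈ , r′ ← All.lookup rs x′∈ with ∈-++⁻ as y′∈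
  ... | inj₁ q           = y′ , ∈-++⁺ˡ q , r′
  ... | inj₂ (here refl) = ⊥-elim (All.lookup x∉ x′∈ (inj r r′))
  ... | inj₂ (there q)   = y′ , ∈-++⁺ʳ as q , r′

-- A relation instead of a function lets one construction, such as `Matched`, bound the counts in
-- both directions, and totality may choose the image by cases on the proof of `P`.
count-≤ : ∀ {n} {P Q : Pred (Partition n) 0ℓ} (P? : Decidable P) (Q? : Decidable Q) (R : Partition n → Partition n → Set) →
          (∀ {π π′ ρ} → R π ρ → R π′ ρ → π ≡ π′) → (∀ π → P π → ∃ λ ρ → Q ρ × R π ρ) → count P? ≤ count Q?
count-≤ {n} P? Q? R inj total = length-≤ {R = R} inj (filter⁺ P? (partitions-unique n))
  (All.map (λ {π} p → let ρ , q , r = total π p in ρ , ∈-filter⁺ Q? (partitions-complete ρ) q , r) (All.all-filter P? (partitions n)))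

RankAtLeast : ℕ → ∀ {n} → Partition n → Set
RankAtLeast m π = numberOfParts π + m ≤ largestPart π

rankAtLeast? : ∀ m {n} → Decidable (RankAtLeast m {n})
rankAtLeast? m π = numberOfParts π + m ≤? largestPart π

Occupied : ℕ → ∀ {n} → Partition n → Set
Occupied m π = occ m (parts π)

occupied? : ∀ m {n} → Decidable (Occupied m {n})
occupied? m π = occ? m (parts π)

-- The map is the identity on the intersection. All other images have rank below `suc c`, so the two
-- branches cannot meet.
rankAtLeast≤occupied : ∀ c n → count (rankAtLeast? (suc c) {n}) ≤ count (occupied? (suc c) {n})
rankAtLeast≤occupied c n = count-≤ (rankAtLeast? (suc c)) (occupied? (suc c)) R inj total
  where
  R : Partition n → Partition n → Set
  R π ρ = (π ≡ ρ × RankAtLeast (suc c) π) ⊎ HighToLow c π ρ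
  notBoth : ∀ {π ρ : Partition n} → RankAtLeast (suc c) ρ → ¬ HighToLow c π ρ
  notBoth rk r = 1+n≰n (≤-trans (low-rank (HighToLow.target r)) rk)
  inj : ∀ {π π′ ρ} → R π ρ → R π′ ρ → π ≡ π′
  inj (inj₁ (refl , _))  (inj₁ (refl , _))  = refl
  inj (inj₁ (refl , rk)) (inj₂ r)           = ⊥-elim (notBoth rk r)
  inj (inj₂ r)           (inj₁ (refl , rk)) = ⊥-elim (notBoth rk r)
  inj (inj₂ r)           (inj₂ r′)          = highToLow-injective r r′
  total : ∀ π → RankAtLeast (suc c) π → ∃ λ ρ → Occupied (suc c) ρ × R π ρ
  total π rk with occupied? (suc c) π
  ... | yes o = π , o , inj₁ (refl , rk)
  ... | no ¬o = let ρ , o , r = highToLow-total π rk ¬o in ρ , o , inj₂ r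

occupied≤rankAtLeast : ∀ m n → 0 < n → count (occupied? (suc (suc m)) {n}) ≤ count (rankAtLeast? (suc m) {n})
occupied≤rankAtLeast m n n>0 = count-≤ (occupied? (suc (suc m))) (rankAtLeast? (suc m)) R inj total
  where
  R : Partition n → Partition n → Set
  R π ρ = (π ≡ ρ × Occupied (suc (suc m)) π) ⊎ (¬ Occupied (suc (suc m)) ρ × LowToHigh (suc m) π ρ)
  inj : ∀ {π π′ ρ} → R π ρ → R π′ ρ → π ≡ π′
  inj (inj₁ (refl , _)) (inj₁ (refl , _)) = refl
  inj (inj₁ (refl , o)) (inj₂ (¬o , _))   = ⊥-elim (¬o o)
  inj (inj₂ (¬o , _))   (inj₁ (refl , o)) = ⊥-elim (¬o o)
  inj (inj₂ (_ , r))    (inj₂ (_ , r′))   = lowToHigh-injective (s≤s z≤n) r r′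
  total : ∀ π → Occupied (suc (suc m)) π → ∃ λ ρ → RankAtLeast (suc m) ρ × R π ρ
  total π o with rankAtLeast? (suc m) π
  ... | yes rk = π , rk , inj₁ (refl , o)
  ... | no ¬rk = let ρ , ¬o , r = lowToHigh-total π n>0 (≰⇒> ¬rk) o in ρ , high-rank (s≤s z≤n) (LowToHigh.target r) , inj₂ (¬o , r)

-- Conjugation
conjugate : List Bool → List Bool
conjugate w = map not (reverse w)

conj-sum : ∀ {s₁ s₂ t w c} → s₁ + 0 + t ≡ 0 + w + 0 → s₂ + t + 0 ≡ w + 0 + c * 0 → s₁ ≡ s₂
conj-sum {s₁} {s₂} {t} {w} {c} e0 e1 = (e0 & sym e1) by eq s₁ s₂ t w c
  where
  eq : ∀ s₁ s₂ t w c → s₁ + (0 + w + 0 + (s₂ + t + 0)) ≡ s₂ + (s₁ + 0 + t + (w + 0 + c * 0))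
  eq = solve-∀

-- Taking the reversed word in `sum-shape` once as `b` and once as `a`, with the other list empty,
-- gives the same sum of positions.
sum-conjugate : ∀ w → sum (shape (conjugate w)) ≡ sum (shape w)
sum-conjugate w = conj-sum {sum (shape (conjugate w))} {sum (shape w)} {tri (cnt (reverse w))} {wt (reverse w)} {cnt (reverse w)} (sum-shape [] (reverse w))
  (subst (λ z → sum (shape z) + tri (cnt (reverse w)) + 0 ≡ wt (reverse w) + 0 + cnt (reverse w) * 0)
         (trans (++-identityʳ (reverse (reverse w))) (reverse-involutive w)) (sum-shape (reverse w) []))

cof-conjugate : ∀ w → cof (conjugate w) ≡ cnt w
cof-conjugate w = trans (cof-not (reverse w)) (cnt-reverse w)

cnt-conjugate : ∀ w → cnt (conjugate w) ≡ cof w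
cnt-conjugate w = trans (cnt-not (reverse w)) (cof-reverse w)

conjugate-involutive : ∀ w → conjugate (conjugate w) ≡ w
conjugate-involutive w = trans (cong (map not) (sym (reverse-map-not w))) (trans (map-not-involutive (reverse (reverse w))) (reverse-involutive w))
  where
  reverse-map-not : ∀ w → map not (reverse (reverse w)) ≡ reverse (map not (reverse w))
  reverse-map-not w = reverse-map not (reverse w)

conjugate-injective : ∀ {w w′} → conjugate w ≡ conjugate w′ → w ≡ w′
conjugate-injective {w} {w′} eq = trans (sym (conjugate-involutive w)) (trans (cong conjugate eq) (conjugate-involutive w′))

conjugate-++ : ∀ x b y → conjugate (x ++ b ∷ y) ≡ conjugate y ++ not b ∷ conjugate x
conjugate-++ x b y = trans (cong (map not) (trans (reverse-++ x (b ∷ y)) (trans (cong (_++ reverse x) (unfold-reverse b y)) (++-assoc (reverse y) [ b ] (reverse x)))))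
  (map-++ not (reverse y) (b ∷ reverse x))

-- There is no padding, so `cof` is the largest part, `cnt` is the number of parts, and conjugation
-- maps such words to such words.
record Boundary {n} (π : Partition n) (w : List Bool) : Set where
  constructor boundary
  field
    {tail init} : List Bool
    starts : w ≡ true ∷ tail
    ends   : w ≡ init ∷ʳ false
    parts≡ : shape w ≡ parts π

boundary-word : ∀ {n} (π : Partition n) → 0 < n → ∃ (Boundary π)
boundary-word (partition [] d p refl) ()
boundary-word (partition (x ∷ xs) d p s) n>0 = word x (x ∷ xs) , boundary
  (cong (λ z → replicate z false ++ true ∷ word x xs) (n∸n≡0 x)) (proj₂ (word-last x (x ∷ xs) (All.head p) p)) (shape-word x (x ∷ xs) (≤-refl ∷ d))

boundary-largest : ∀ {n} {π : Partition n} {w} → Boundary π w → largestPart π ≡ cof w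
boundary-largest {π = partition (x ∷ xs) d p s} (boundary refl en eq) = trans (max-decreasing d) (sym (∷-injectiveˡ eq))
boundary-largest {π = partition [] d p s} (boundary refl en ())

boundary-length : ∀ {n} {π : Partition n} {w} → Boundary π w → numberOfParts π ≡ cnt w
boundary-length {w = w} b = trans (cong length (sym (Boundary.parts≡ b))) (length-shape w)

boundary-unique : ∀ {n} {π : Partition n} {w w′} → Boundary π w → Boundary π w′ → w ≡ w′
boundary-unique {w = w} {w′} b b′ = shape-injective w w′ (trans (sym (boundary-largest b)) (boundary-largest b′))
  (trans (Boundary.parts≡ b) (sym (Boundary.parts≡ b′)))

boundary-conjugate : ∀ {n} {π : Partition n} {w} → Boundary π w → ∃ λ (ρ : Partition n) → Boundary ρ (conjugate w)
boundary-conjugate {n} {π} {w} (boundary {t} {i} st en eq) =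
  partition (shape (conjugate w)) (Linked.tail (shape-linked (conjugate w) ≤-refl)) (subst (λ z → All (_> 0) (shape z)) (sym en′) (shape-positive (conjugate t)))
    (trans (sum-conjugate w) (trans (cong sum eq) (sums-to π))) ,
  boundary st′ en′ refl
  where
  st′ : conjugate w ≡ true ∷ conjugate i
  st′ = trans (cong conjugate en) (conjugate-++ i false [])
  en′ : conjugate w ≡ conjugate t ∷ʳ false
  en′ = trans (cong conjugate st) (conjugate-++ [] true t)

Conjugate : ∀ {n} → Partition n → Partition n → Set
Conjugate π ρ = ∃ λ w → Boundary π w × Boundary ρ (conjugate w)

conjugate-total : ∀ {n} (π : Partition n) → 0 < n → ∃ (Conjugate π)
conjugate-total π n>0 with w , b ← boundary-word π n>0 with ρ , b′ ← boundary-conjugate b = ρ , w , b , b′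

conjugate-unique : ∀ {n} {π π′ ρ : Partition n} → Conjugate π ρ → Conjugate π′ ρ → π ≡ π′
conjugate-unique (w , b , c) (w′ , b′ , c′) with refl ← conjugate-injective {w} {w′} (boundary-unique c c′) =
  Partition-ext (trans (sym (Boundary.parts≡ b)) (Boundary.parts≡ b′))

-- λ_{m+i} = i for some i ≥ 0, where λ_k = 0 beyond the last part.  This is the
-- property of λ that its conjugate is not in X(m).
Skip : ℕ → List ℕ → Set
Skip zero    xs       = occ 1 xs
Skip (suc m) []       = ⊤
Skip (suc m) (x ∷ xs) = Skip m xs

skip? : ∀ m xs → Dec (Skip m xs)
skip? zero    xs       = occ? 1 xs
skip? (suc m) []       = yes tt
skip? (suc m) (x ∷ xs) = skip? m xs

skip-short : ∀ m xs → length xs < m → Skip m xs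
skip-short (suc m) []       _        = tt
skip-short (suc m) (x ∷ xs) (s≤s lt) = skip-short m xs lt

skip-++ : ∀ m p xs → length p ≡ m → occ 1 xs → Skip m (p ++ xs)
skip-++ zero    []      xs _  o = o
skip-++ (suc m) (_ ∷ p) xs eq o = skip-++ m p xs (suc-injective eq) o

skip-split : ∀ m xs → m ≤ length xs → Skip m xs → ∃₂ λ p ys → xs ≡ p ++ ys × length p ≡ m × occ 1 ys
skip-split zero    xs       _        o = [] , xs , refl , refl , o
skip-split (suc m) (x ∷ xs) (s≤s le) o with p , ys , refl , eq , o′ ← skip-split m xs le o = x ∷ p , ys , refl , cong suc eq , o′

skip₁ : ∀ {l c m} → suc (suc l) ≡ c + suc m → suc l ≡ c + m
skip₁ {l} {c} {m} e0 = (e0) by eq l c m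
  where
  eq : ∀ l c m → suc l + (c + suc m) ≡ c + m + (suc (suc l))
  eq = solve-∀

skip-true : ∀ x y m → 0 < cof y → suc (length x) ≡ cof (x ++ true ∷ y) + m → Skip m (shape (x ++ true ∷ y))
skip-true x           y zero    c>0 eq = occ-true x y (trans (sym (+-identityʳ _)) (trans (sym eq) (+-comm 1 (length x))))
skip-true []          y (suc m) c>0 eq = ⊥-elim (1+n≰n (≤-trans (+-mono-≤ c>0 (s≤s z≤n)) (≤-reflexive (sym eq))))
skip-true (true ∷ x)  y (suc m) c>0 eq = skip-true x y m c>0 (skip₁ {length x} eq)
skip-true (false ∷ x) y (suc m) c>0 eq = skip-true x y (suc m) c>0 (suc-injective eq)

skip-false : ∀ x y m → suc (length x) ≡ cof (x ++ false ∷ y) + m → ¬ Skip m (shape (x ++ false ∷ y))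
skip-false x           y zero    eq o = occ-false x y (trans (sym (+-identityʳ _)) (trans (sym eq) (+-comm 1 (length x)))) o
skip-false []          y (suc m) eq o with () ← trans (suc-injective eq) (+-suc (cof y) m)
skip-false (true ∷ x)  y (suc m) eq o = skip-false x y m (skip₁ {length x} eq) o
skip-false (false ∷ x) y (suc m) eq o = skip-false x y (suc m) (suc-injective eq) o

dual₁ : ∀ {lx ly f c l m} → suc lx ≡ f + suc m → l ≡ lx + suc ly → c + f ≡ l → c ≡ ly + suc m
dual₁ {lx} {ly} {f} {c} {l} {m} e0 e1 e2 = (e0 & e1 & e2) by eq lx ly f c l m
  where
  eq : ∀ lx ly f c l m → c + (f + suc m + (lx + suc ly + (l))) ≡ ly + suc m + (suc lx + (l + (c + f)))
  eq = solve-∀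

length-conjugate : ∀ w → length (conjugate w) ≡ length w
length-conjugate w = trans (length-map not (reverse w)) (length-reverse w)

cof-conjugate-at : ∀ {m} x b y → suc (length x) ≡ cof (x ++ b ∷ y) + suc m → cof (conjugate (x ++ b ∷ y)) ≡ length (conjugate y) + suc m
cof-conjugate-at {m} x b y eq = trans (cof-conjugate (x ++ b ∷ y)) (trans (dual₁ {length x} {length y} eq (length-++ x) (cnt+cof (x ++ b ∷ y)))
  (cong (_+ suc m) (sym (length-conjugate y))))

-- The diagonal that decides `occ` for the conjugate meets `w` after `cof w + m` steps, and a
-- vertical step there is a horizontal one of the conjugate. If `w` has fewer than `suc m` vertical
-- steps, the diagonal misses the word: `Skip` holds for want of parts, and the parts of the
-- conjugate are too small.
dual : ∀ m w {init} → w ≡ init ∷ʳ false →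
       (Skip (suc m) (shape w) × ¬ occ (suc m) (shape (conjugate w))) ⊎ (¬ Skip (suc m) (shape w) × occ (suc m) (shape (conjugate w)))
dual m w {i} en with cnt w <? suc m
... | yes lt = inj₁ (skip-short (suc m) (shape w) (subst (_< suc m) (sym (length-shape w)) lt) ,
                     ¬occ-small (All.map (λ le → ≤-trans (s≤s (≤-trans le (≤-reflexive (cof-conjugate w)))) lt) (shape≤cof (conjugate w))))
... | no ¬lt with split (cof w + m) w (≤-trans (+-monoʳ-≤ (cof w) (≤-trans (n≤1+n m) (≮⇒≥ ¬lt))) (≤-reflexive (trans (+-comm (cof w) (cnt w)) (cnt+cof w))))
... | x , [] , refl , lx = ⊥-elim (1+n≰n (≤-trans (≤-reflexive (trans (cong suc (sym lx)) refl))
        (≤-trans (≤-reflexive (trans (cong suc lx) (sym (+-suc (cof w) m)))) (≤-trans (+-monoʳ-≤ (cof w) (≮⇒≥ ¬lt))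
          (≤-reflexive (trans (+-comm (cof w) (cnt w)) (trans (cnt+cof w) (trans (cong length (++-identityʳ x)) lx))))))))
... | x , true ∷ y , refl , lx with y′ , refl ← ends-false x y en = inj₁
  (skip-true x y (suc m) (subst (0 <_) (sym (trans (cof-∷ʳ y′ false) (+-comm (cof y′) 1))) (s≤s z≤n)) eq ,
   λ o → occ-false (conjugate y) (conjugate x) (trans (cong cof (sym (conjugate-++ x true y))) (cof-conjugate-at x true y eq))
           (subst (λ z → occ (suc m) (shape z)) (conjugate-++ x true y) o))
  where eq = trans (cong suc lx) (sym (+-suc (cof (x ++ true ∷ y)) m))
... | x , false ∷ y , refl , lx = inj₂
  (skip-false x y (suc m) eq ,
   subst (λ z → occ (suc m) (shape z)) (sym (conjugate-++ x false y))
     (occ-true (conjugate y) (conjugate x) (trans (cong cof (sym (conjugate-++ x false y))) (cof-conjugate-at x false y eq))))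
  where eq = trans (cong suc lx) (sym (+-suc (cof (x ++ false ∷ y)) m))

unoccupied? : ∀ m {n} → Decidable (λ (π : Partition n) → ¬ Occupied m π)
unoccupied? m π = ¬? (occupied? m π)

Skipped : ℕ → ∀ {n} → Partition n → Set
Skipped m π = Skip m (parts π)

skipped? : ∀ m {n} → Decidable (Skipped m {n})
skipped? m π = skip? m (parts π)

skipped≤unoccupied : ∀ m n → 0 < n → count (skipped? (suc m) {n}) ≤ count (unoccupied? (suc m) {n})
skipped≤unoccupied m n n>0 = count-≤ (skipped? (suc m)) (unoccupied? (suc m)) Conjugate conjugate-unique total
  where
  total : ∀ π → Skipped (suc m) π → ∃ λ ρ → ¬ Occupied (suc m) ρ × Conjugate π ρ
  total π s with ρ , c@(w , b , b′) ← conjugate-total π n>0 with dual m w (Boundary.ends b)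
  ... | inj₁ (_ , ¬o) = ρ , (λ o → ¬o (subst (occ (suc m)) (sym (Boundary.parts≡ b′)) o)) , c
  ... | inj₂ (¬s , _) = ⊥-elim (¬s (subst (Skip (suc m)) (sym (Boundary.parts≡ b)) s))

unoccupied≤skipped : ∀ m n → 0 < n → count (unoccupied? (suc m) {n}) ≤ count (skipped? (suc m) {n})
unoccupied≤skipped m n n>0 = count-≤ (unoccupied? (suc m)) (skipped? (suc m)) Conjugate conjugate-unique total
  where
  total : ∀ π → ¬ Occupied (suc m) π → ∃ λ ρ → Skipped (suc m) ρ × Conjugate π ρ
  total π ¬o with ρ , c@(w , b , b′) ← conjugate-total π n>0 with dual m (conjugate w) (Boundary.ends b′)
  ... | inj₁ (s , _) = ρ , subst (Skip (suc m)) (Boundary.parts≡ b′) s , c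
  ... | inj₂ (_ , o) = ⊥-elim (¬o (subst (occ (suc m)) (trans (cong shape (conjugate-involutive w)) (Boundary.parts≡ b)) o))

-- Crank
ones : List ℕ → ℕ
ones xs = length (filter (ℕ._≟ 1) xs)

big : ℕ → List ℕ → ℕ
big k xs = length (filter (k <?_) xs)

ones-++ : ∀ xs ys → ones (xs ++ ys) ≡ ones xs + ones ys
ones-++ xs ys = trans (cong length (filter-++ (ℕ._≟ 1) xs ys)) (length-++ (filter (ℕ._≟ 1) xs))

big-++ : ∀ k xs ys → big k (xs ++ ys) ≡ big k xs + big k ys
big-++ k xs ys = trans (cong length (filter-++ (k <?_) xs ys)) (length-++ (filter (k <?_) xs))

ones-reject : ∀ {x xs} → x ≢ 1 → ones (x ∷ xs) ≡ ones xs
ones-reject ≢1 = cong length (filter-reject (ℕ._≟ 1) ≢1)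

ones-replicate : ∀ m → ones (replicate m 1) ≡ m
ones-replicate zero    = refl
ones-replicate (suc m) = cong suc (ones-replicate m)

big-accept : ∀ {k x xs} → k < x → big k (x ∷ xs) ≡ suc (big k xs)
big-accept {k} k<x = cong length (filter-accept (k <?_) k<x)

big-none : ∀ {k xs} → All (_≤ k) xs → big k xs ≡ 0
big-none {k} ps = cong length (filter-none (k <?_) (All.map ≤⇒≯ ps))

big≤length : ∀ k xs → big k xs ≤ length xs
big≤length k xs = length-filter (k <?_) xs

linked-bounded : ∀ {x xs} → Linked _≥_ (x ∷ xs) → All (_≤ x) xs
linked-bounded [-]      = []
linked-bounded (le ∷ l) = le ∷ All.map (λ le′ → ≤-trans le′ le) (linked-bounded l)

linked-suffix : ∀ xs {ys : List ℕ} → Linked _≥_ (xs ++ ys) → Linked _≥_ ys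
linked-suffix []       l = l
linked-suffix (x ∷ xs) l = linked-suffix xs (Linked.tail l)

linked-prefix : ∀ x xs {ys : List ℕ} → Linked _≥_ (x ∷ xs ++ ys) → Linked _≥_ (x ∷ xs)
linked-prefix x []       _        = [-]
linked-prefix x (y ∷ xs) (le ∷ l) = le ∷ linked-prefix y xs l

linked-ones : ∀ {h} xs m → 0 < h → All (_> 0) xs → Linked _≥_ (h ∷ xs) → Linked _≥_ (h ∷ xs ++ replicate m 1)
linked-ones []       zero    h>0 _        _        = [-]
linked-ones []       (suc m) h>0 _        _        = h>0 ∷ linked-ones [] m (s≤s z≤n) [] [-]
linked-ones (x ∷ xs) m       h>0 (p ∷ ps) (le ∷ l) = le ∷ linked-ones xs m p ps l

linked-replace : ∀ p {xs ys} → All (_> 0) p → 0 < length p → (∀ {h} → 0 < h → Linked _≥_ (h ∷ xs) → Linked _≥_ (h ∷ ys)) →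
                 Linked _≥_ (p ++ xs) → Linked _≥_ (p ++ ys)
linked-replace (h ∷ [])     (h>0 ∷ _) _ f l        = f h>0 l
linked-replace (h ∷ k ∷ p)  (_ ∷ ps)  _ f (le ∷ l) = le ∷ linked-replace (k ∷ p) ps (s≤s z≤n) f l

-- The part that puts the partition into X(m) is replaced by ones.
data Dissolve : ℕ → List ℕ → List ℕ → Set where
  here  : ∀ {m xs} → Dissolve m (m ∷ xs) (xs ++ replicate m 1)
  there : ∀ {m x xs ys} → m < x → Dissolve (suc m) xs ys → Dissolve m (x ∷ xs) (x ∷ ys)

occ⇒≤ : ∀ {m x xs} → Linked _≥_ (x ∷ xs) → occ m xs → m ≤ x
occ⇒≤ {xs = _ ∷ _} (le ∷ _) (inj₁ refl) = le
occ⇒≤ {xs = _ ∷ _} (le ∷ l) (inj₂ o)    = ≤-trans (≤-trans (n≤1+n _) (occ⇒≤ l o)) le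

dissolve : ∀ {m xs} → Linked _≥_ xs → occ m xs → ∃ (Dissolve m xs)
dissolve {xs = x ∷ xs} l (inj₁ refl) = _ , here
dissolve {xs = x ∷ xs} l (inj₂ o) with ys , d ← dissolve (Linked.tail l) o = x ∷ ys , there (occ⇒≤ l o) d

dissolve-occ : ∀ {m xs ys} → Dissolve m xs ys → occ m xs
dissolve-occ here        = inj₁ refl
dissolve-occ (there _ d) = inj₂ (dissolve-occ d)

dissolve-sum : ∀ {m xs ys} → Dissolve m xs ys → sum ys ≡ sum xs
dissolve-sum {m} (here {xs = xs}) = trans (sum-++ xs (replicate m 1)) (trans (cong (sum xs +_) (sum-ones m)) (+-comm (sum xs) m))
  where
  sum-ones : ∀ m → sum (replicate m 1) ≡ m
  sum-ones zero    = refl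
  sum-ones (suc m) = cong suc (sum-ones m)
dissolve-sum (there {x = x} _ d) = cong (x +_) (dissolve-sum d)

dissolve-positive : ∀ {m xs ys} → Dissolve m xs ys → All (_> 0) xs → All (_> 0) ys
dissolve-positive {m} here        (_ ∷ ps) = All.++⁺ ps (All.replicate⁺ m (s≤s z≤n))
dissolve-positive     (there _ d) (p ∷ ps) = p ∷ dissolve-positive d ps

dissolve-linked : ∀ {m xs ys h} → 0 < m → All (_> 0) xs → Dissolve m xs ys → Linked _≥_ (h ∷ xs) → Linked _≥_ (h ∷ ys)
dissolve-linked {m} m>0 (_ ∷ ps) (here {xs = xs}) (le ∷ l) = linked-ones xs m (≤-trans m>0 le) ps (relax xs le l)
  where
  relax : ∀ {h m} xs → m ≤ h → Linked _≥_ (m ∷ xs) → Linked _≥_ (h ∷ xs)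
  relax []       _  _         = [-]
  relax (x ∷ xs) le (le′ ∷ l) = ≤-trans le′ le ∷ l
dissolve-linked m>0 (_ ∷ ps) (there _ d) (le ∷ l) = le ∷ dissolve-linked (s≤s z≤n) ps d l

-- The first entry of `ys` tells the constructors apart: after `here` it is at most `m`, after
-- `there` it is larger.
dissolve-injective : ∀ {m xs xs′ ys ys′} → Dissolve m xs ys → Dissolve m xs′ ys′ → Linked _≥_ xs → Linked _≥_ xs′ → ys ≡ ys′ → xs ≡ xs′
dissolve-head : ∀ {m x ys} xs → Linked _≥_ (m ∷ xs) → xs ++ replicate m 1 ≡ x ∷ ys → ¬ (m < x)
dissolve-head {suc m} []       _        eq (s≤s m<x) with refl ← ∷-injectiveˡ eq with () ← m<x
dissolve-head         (y ∷ xs) (le ∷ _) eq m<x with refl ← ∷-injectiveˡ eq = 1+n≰n (≤-trans m<x le)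
dissolve-injective {m} (here {xs = xs}) (here {xs = xs′}) _ _  eq = cong (m ∷_) (++-cancelʳ (replicate m 1) xs xs′ eq)
dissolve-injective (here {xs = xs}) (there lt _) l _  eq = ⊥-elim (dissolve-head xs l eq lt)
dissolve-injective (there lt _) (here {xs = xs}) _ l  eq = ⊥-elim (dissolve-head xs l (sym eq) lt)
dissolve-injective (there {x = x} _ d) (there _ d′) l l′ eq with refl ← ∷-injectiveˡ eq =
  cong (x ∷_) (dissolve-injective d d′ (Linked.tail l) (Linked.tail l′) (∷-injectiveʳ eq))

dissolve-functional : ∀ {m xs xs′ ys ys′} → Dissolve m xs ys → Dissolve m xs′ ys′ → xs ≡ xs′ → ys ≡ ys′
dissolve-functional here         here          refl = refl
dissolve-functional here         (there lt _)  refl = ⊥-elim (1+n≰n lt)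
dissolve-functional (there lt _) here          refl = ⊥-elim (1+n≰n lt)
dissolve-functional (there _ d)  (there _ d′)  refl = cong (_ ∷_) (dissolve-functional d d′ refl)

-- `j` is the number of parts before the replaced one, which was `j + m`. So there are at least
-- `j + m` ones, and only those `j` parts can exceed a bound `k ≥ j + m`. With `k` the number of
-- ones, the crank is at most `-m`.
dissolve-crank : ∀ {m xs ys} → 0 < m → Linked _≥_ xs → Dissolve m xs ys → ∃ λ j → j + m ≤ ones ys × (∀ {k} → j + m ≤ k → big k ys ≤ j)
dissolve-crank {m} m>0 l (here {xs = xs}) = 0 ,
  ≤-trans (≤-reflexive (sym (ones-replicate m))) (≤-trans (m≤n+m _ (ones xs)) (≤-reflexive (sym (ones-++ xs (replicate m 1))))) ,
  λ m≤k → ≤-reflexive (big-none (All.++⁺ (All.map (λ le → ≤-trans le m≤k) (linked-bounded l)) (All.replicate⁺ m (≤-trans m>0 m≤k))))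
dissolve-crank {m} m>0 l (there {x = x} {ys = ys} m<x d) with j , le , f ← dissolve-crank (s≤s z≤n) (Linked.tail l) d = suc j ,
  ≤-trans (≤-reflexive (sym (+-suc j m))) (≤-trans le (≤-trans (m≤n+m (ones ys) (ones (x ∷ []))) (≤-reflexive (sym (ones-++ (x ∷ []) ys))))) ,
  λ {k} le′ → ≤-trans (≤-reflexive (big-++ k (x ∷ []) ys)) (+-mono-≤ (big≤length k (x ∷ [])) (f (≤-trans (≤-reflexive (+-suc j m)) le′)))

all-ones : ∀ xs → Linked _≥_ (1 ∷ xs) → All (_> 0) xs → xs ≡ replicate (length xs) 1
all-ones []       _        _        = refl
all-ones (x ∷ xs) (le ∷ l) (p ∷ ps) with refl ← ≤-antisym le p = cong (1 ∷_) (all-ones xs l ps)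

replicate-+ : ∀ a b → replicate (a + b) 1 ≡ replicate a 1 ++ replicate b 1
replicate-+ zero    b = refl
replicate-+ (suc a) b = cong (1 ∷_) (replicate-+ a b)

ones-suffix : ∀ m ys → Linked _≥_ ys → All (_> 0) ys → m ≤ ones ys → ∃ λ zs → ys ≡ zs ++ replicate m 1
ones-suffix zero    []       _ _        _  = [] , refl
ones-suffix m       (y ∷ ys) l (p ∷ ps) le with y ℕ.≟ 1
... | yes refl = replicate (suc (length ys) ∸ m) 1 ,
        trans (cong (1 ∷_) (all-ones ys l ps))
          (trans (cong (λ k → replicate k 1) (sym (m∸n+n≡m (≤-trans le (length-filter (ℕ._≟ 1) (1 ∷ ys)))))) (replicate-+ (suc (length ys) ∸ m) m))
... | no y≢1 with zs , eq ← ones-suffix m ys (Linked.tail l) ps (≤-trans le (≤-reflexive (ones-reject y≢1))) = y ∷ zs , cong (y ∷_) eq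

-- If `y` exceeds the number of ones, removing it lowers the count of larger parts by one, which
-- pays for `suc m`. Otherwise no later part exceeds that number either, and the number is at least
-- `y > m`.
dissolve-bound : ∀ {m y ys} → 0 < m → m < y → Linked _≥_ (y ∷ ys) →
                 big (ones (y ∷ ys)) (y ∷ ys) + m ≤ ones (y ∷ ys) → big (ones ys) ys + suc m ≤ ones ys
dissolve-bound {m} {y} {ys} m>0 m<y l le = subst (λ z → big z ys + suc m ≤ z) (ones-reject {y} {ys} y≢1) (bound (ω <? y))
  where
  ω = ones (y ∷ ys)
  y≢1 : y ≢ 1
  y≢1 refl = 1+n≰n (≤-trans (s≤s m>0) m<y)
  bound : Dec (ω < y) → big ω ys + suc m ≤ ω
  bound (yes ω<y) = ≤-trans (≤-reflexive (trans (+-suc (big ω ys) m) (cong (_+ m) (sym (big-accept ω<y))))) le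
  bound (no ω≮y)  = ≤-trans (≤-reflexive (cong (_+ suc m) (big-none (All.map (λ le′ → ≤-trans le′ (≮⇒≥ ω≮y)) (linked-bounded l))))) (≤-trans m<y (≮⇒≥ ω≮y))

-- The restored part goes in front of the first part not larger than the current `m`, which grows by
-- one for each part passed. A crank of at most `-m` ensures that there are enough ones to build it
-- from.
dissolve-onto : ∀ m ys → Linked _≥_ ys → All (_> 0) ys → 0 < m → big (ones ys) ys + m ≤ ones ys →
                ∃ λ xs → Dissolve m xs ys × All (_> 0) xs × (∀ {h} → m ≤ h → Linked _≥_ (h ∷ ys) → Linked _≥_ (h ∷ xs))
dissolve-onto m []       l ps       m>0 le = ⊥-elim (1+n≰n (≤-trans m>0 le))
dissolve-onto m (y ∷ ys) l ps₀@(p ∷ ps) m>0 le with m <? y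
... | no m≮y with zs , eq ← ones-suffix m (y ∷ ys) l ps₀ (≤-trans (m≤n+m m _) le) =
  m ∷ zs , subst (Dissolve m (m ∷ zs)) (sym eq) here , m>0 ∷ proj₁ (All.++⁻ zs (subst (All (_> 0)) eq ps₀)) ,
  λ m≤h _ → m≤h ∷ linked-prefix m zs (subst (λ z → Linked _≥_ (m ∷ z)) eq (≮⇒≥ m≮y ∷ l))
... | yes m<y with xs , d , qs , f ← dissolve-onto (suc m) ys (Linked.tail l) ps (s≤s z≤n) (dissolve-bound m>0 m<y l le) =
  y ∷ xs , there m<y d , p ∷ qs , λ { _ (le′ ∷ l′) → le′ ∷ f m<y l′ }

dissolve-nonempty : ∀ {m xs ys} → 0 < m → Dissolve m xs ys → 0 < length ys × 0 < length xs
dissolve-nonempty {suc m} _ (here {xs = xs}) = ≤-trans (≤-trans (s≤s z≤n) (m≤n+m _ (length xs))) (≤-reflexive (sym (length-++ xs))) , s≤s z≤n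
dissolve-nonempty         _ (there _ _)      = s≤s z≤n , s≤s z≤n

shape-∷ʳ : ∀ w → All (_≥ 2) (shape (w ∷ʳ false ∷ʳ false))
shape-∷ʳ []          = []
shape-∷ʳ (true ∷ w)  = subst (2 ≤_) (sym (trans (cof-∷ʳ (w ∷ʳ false) false) (trans (cong (_+ 1) (cof-∷ʳ w false)) (solve (cof w))))) (s≤s (s≤s z≤n)) ∷ shape-∷ʳ w
  where
  solve : ∀ x → x + 1 + 1 ≡ suc (suc x)
  solve = solve-∀
shape-∷ʳ (false ∷ w) = shape-∷ʳ w

ones-none : ∀ {xs} → All (_≥ 2) xs → ones xs ≡ 0
ones-none ps = cong length (filter-none (ℕ._≟ 1) (All.map (λ { (s≤s ()) refl }) ps))

conjugate-double : ∀ t → conjugate (true ∷ true ∷ t) ≡ conjugate t ∷ʳ false ∷ʳ false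
conjugate-double t = trans (conjugate-++ [] true (true ∷ t)) (cong (_∷ʳ false) (conjugate-++ [] true t))

-- A bijection between the partitions with Skip m and those of crank < m.  The
-- last two cases match fewer than m parts with: a part 1 and at most m parts; no
-- part 1 and all parts less than m.
data Matched (m : ℕ) {n} (π ρ : Partition n) : Set where
  long   : ∀ {p xs ys} → length p ≡ m → Dissolve 1 xs ys → parts π ≡ p ++ xs → parts ρ ≡ p ++ ys → Matched m π ρ
  short  : ∀ {x xs} → suc (length xs) < m → parts π ≡ suc x ∷ xs → parts ρ ≡ x ∷ xs ∷ʳ 1 → Matched m π ρ
  double : ∀ {w t} → w ≡ true ∷ true ∷ t → Boundary π w → Boundary ρ (conjugate w) → cnt w < m → Matched m π ρ

long-length : ∀ {m} p (zs : List ℕ) → length p ≡ m → 0 < length zs → m < length (p ++ zs)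
long-length p zs refl lt = ≤-trans (≤-reflexive (+-comm 1 (length p))) (≤-trans (+-monoʳ-≤ (length p) lt) (≤-reflexive (sym (length-++ p))))

long-ones : ∀ {p xs ys} → Linked _≥_ xs → Dissolve 1 xs ys → 0 < ones (p ++ ys)
long-ones {p} {xs} {ys} l d with j , le , _ ← dissolve-crank (s≤s z≤n) l d =
  ≤-trans (≤-trans (m≤n+m 1 j) le) (≤-trans (m≤n+m (ones ys) (ones p)) (≤-reflexive (sym (ones-++ p ys))))

short-ones : ∀ xs → 0 < ones (xs ∷ʳ 1)
short-ones xs = ≤-trans (m≤n+m 1 (ones xs)) (≤-reflexive (sym (ones-++ xs (1 ∷ []))))

double-ones : ∀ {n} {ρ : Partition n} {w t} → w ≡ true ∷ true ∷ t → Boundary ρ (conjugate w) → ones (parts ρ) ≡ 0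
double-ones {t = t} refl b = trans (cong ones (sym (Boundary.parts≡ b))) (ones-none (subst (λ z → All (_≥ 2) (shape z)) (sym (conjugate-double t)) (shape-∷ʳ (conjugate t))))

long≢short : ∀ {m} p (zs : List ℕ) {xs ys : List ℕ} → length p ≡ m → 0 < length zs → xs ≡ p ++ zs → xs ≡ ys → ¬ (length ys ≤ m)
long≢short p zs lp lt refl refl le = 1+n≰n (≤-trans (long-length p zs lp lt) le)

-- The targets are disjoint: those of `double` have no part 1, those of `short` have one and at most
-- `m` parts, those of `long` have one and more than `m` parts.
matched-injective : ∀ {m n} {π π′ ρ : Partition n} → Matched m π ρ → Matched m π′ ρ → π ≡ π′
matched-injective {π = π} {π′} (long {p} {xs} lp d e f) (long {p′} {xs′} lp′ d′ e′ f′)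
  with refl , eq ← ++-split-injective p p′ (trans lp (sym lp′)) (trans (sym f) f′) =
  Partition-ext (trans e (trans (cong (p ++_) (dissolve-injective d d′ (linked-suffix p (subst (Linked _≥_) e (weakly-decreasing π)))
    (linked-suffix p (subst (Linked _≥_) e′ (weakly-decreasing π′))) eq)) (sym e′)))
matched-injective (long {p} {ys = ys} lp d e f) (short {x} {xs} lt e′ f′) = ⊥-elim (long≢short p ys lp (proj₁ (dissolve-nonempty (s≤s z≤n) d)) f f′
  (≤-trans (≤-reflexive (cong suc (trans (length-++ xs) (+-comm (length xs) 1)))) lt))
matched-injective {π = π} (long {p} lp d e f) (double e′ b b′ _) = ⊥-elim (1+n≰n (≤-trans (long-ones {p} (linked-suffix p (subst (Linked _≥_) e (weakly-decreasing π))) d)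
  (≤-reflexive (trans (cong ones (sym f)) (double-ones e′ b′)))))
matched-injective (short {x} {xs} lt e′ f′) (long {p} {ys = ys} lp d e f) = ⊥-elim (long≢short p ys lp (proj₁ (dissolve-nonempty (s≤s z≤n) d)) f f′
  (≤-trans (≤-reflexive (cong suc (trans (length-++ xs) (+-comm (length xs) 1)))) lt))
matched-injective (short {x} {xs} _ e f) (short {x′} {xs′} _ e′ f′)
  with refl , eq ← ∷-injective (trans (sym f) f′) with refl , _ ← ∷ʳ-injective xs xs′ eq = Partition-ext (trans e (sym e′))
matched-injective (short {x} {xs} _ e f) (double e′ b b′ _) = ⊥-elim (1+n≰n (≤-trans (short-ones (x ∷ xs)) (≤-reflexive (trans (cong ones (sym f)) (double-ones e′ b′)))))
matched-injective {π′ = π} (double e′ b b′ _) (long {p} lp d e f) = ⊥-elim (1+n≰n (≤-trans (long-ones {p} (linked-suffix p (subst (Linked _≥_) e (weakly-decreasing π))) d)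
  (≤-reflexive (trans (cong ones (sym f)) (double-ones e′ b′)))))
matched-injective (double e′ b b′ _) (short {x} {xs} _ e f) = ⊥-elim (1+n≰n (≤-trans (short-ones (x ∷ xs)) (≤-reflexive (trans (cong ones (sym f)) (double-ones e′ b′)))))
matched-injective (double _ b c _) (double _ b′ c′ _) = conjugate-unique (_ , b , c) (_ , b′ , c′)

short≢double : ∀ {n} {π ρ : Partition n} {x xs w t} → parts π ≡ suc x ∷ xs → parts ρ ≡ x ∷ xs ∷ʳ 1 → w ≡ true ∷ true ∷ t → ¬ Boundary π w
short≢double {ρ = ρ} {x} e f refl b with eq , refl ← ∷-injective (trans (sym e) (sym (Boundary.parts≡ b)))
  with le ∷ _ ← subst (Linked _≥_) f (weakly-decreasing ρ) = 1+n≰n (subst (_≤ x) (sym eq) le)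

-- The sources are disjoint as well: more than `m` parts for `long`, fewer than `m` for the others,
-- and the two largest parts are equal for `double` but not for `short`.
matched-functional : ∀ {m n} {π ρ ρ′ : Partition n} → Matched m π ρ → Matched m π ρ′ → ρ ≡ ρ′
matched-functional (long {p} lp d e f) (long {p′} lp′ d′ e′ f′)
  with refl , eq ← ++-split-injective p p′ (trans lp (sym lp′)) (trans (sym e) e′) =
  Partition-ext (trans f (trans (cong (p ++_) (dissolve-functional d d′ eq)) (sym f′)))
matched-functional (long {p} {xs} lp d e f) (short lt e′ f′) = ⊥-elim (long≢short p xs lp (proj₂ (dissolve-nonempty (s≤s z≤n) d)) e e′ (≤-trans (n≤1+n _) lt))
matched-functional (short lt e′ f′) (long {p} {xs} lp d e f) = ⊥-elim (long≢short p xs lp (proj₂ (dissolve-nonempty (s≤s z≤n) d)) e e′ (≤-trans (n≤1+n _) lt))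
matched-functional (long {p} {xs} lp d e f) (double e′ b b′ lt) = ⊥-elim (long≢short p xs lp (proj₂ (dissolve-nonempty (s≤s z≤n) d)) e refl
  (≤-trans (≤-reflexive (boundary-length b)) (≤-trans (n≤1+n _) lt)))
matched-functional (double e′ b b′ lt) (long {p} {xs} lp d e f) = ⊥-elim (long≢short p xs lp (proj₂ (dissolve-nonempty (s≤s z≤n) d)) e refl
  (≤-trans (≤-reflexive (boundary-length b)) (≤-trans (n≤1+n _) lt)))
matched-functional (short _ e f) (short _ e′ f′) with refl , refl ← ∷-injective (trans (sym e) e′) = Partition-ext (trans f (sym f′))
matched-functional {ρ = ρ} (short _ e f) (double e′ b _ _) = ⊥-elim (short≢double {ρ = ρ} e f e′ b)
matched-functional {ρ′ = ρ} (double e′ b _ _) (short _ e f) = ⊥-elim (short≢double {ρ = ρ} e f e′ b)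
matched-functional (double _ b c _) (double _ b′ c′ _) with refl ← boundary-unique b b′ = Partition-ext (trans (sym (Boundary.parts≡ c)) (Boundary.parts≡ c′))

CrankBelow : ℕ → ∀ {n} → Partition n → Set
CrankBelow m π = (numberOfOnes π ≡ 0 × largestPart π < m) ⊎ (0 < numberOfOnes π × numberOfPartsLargerThan (numberOfOnes π) π < numberOfOnes π + m)

linked-relax : ∀ {h m} xs → m ≤ h → Linked _≥_ (m ∷ xs) → Linked _≥_ (h ∷ xs)
linked-relax []       _  _         = [-]
linked-relax (x ∷ xs) le (le′ ∷ l) = ≤-trans le′ le ∷ l

-- The first `m` parts add at most `m` to the count of parts larger than the number of ones. The
-- dissolved rest has negative crank, so the total stays below `m`.
skipped-long : ∀ {m n} (π : Partition n) → 0 < m → m ≤ numberOfParts π → Skipped m π → ∃ λ ρ → CrankBelow m ρ × Matched m π ρ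
skipped-long {m} π m>0 le s with p , xs , eq , lp , o ← skip-split m (parts π) le s
  with l ← subst (Linked _≥_) eq (weakly-decreasing π)
  with pos-p , pos-xs ← All.++⁻ p (subst (All (_> 0)) eq (positive π))
  with ys , d ← dissolve (linked-suffix p l) o
  with j , lo , f ← dissolve-crank (s≤s z≤n) (linked-suffix p l) d
  = ρ p ys eq lp l pos-p pos-xs d , inj₂ (≤-trans (s≤s z≤n) (ω≥ p ys lo) , bound p ys lp lo f) , long lp d eq refl
  where
  ρ : ∀ p ys {xs} → parts π ≡ p ++ xs → length p ≡ m → Linked _≥_ (p ++ xs) → All (_> 0) p → All (_> 0) xs → Dissolve 1 xs ys → Partition _
  ρ p ys {xs} eq lp l pos-p pos-xs d = partition (p ++ ys)
    (linked-replace p pos-p (subst (0 <_) (sym lp) m>0) (λ _ → dissolve-linked (s≤s z≤n) pos-xs d) l)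
    (All.++⁺ pos-p (dissolve-positive d pos-xs))
    (trans (sum-++ p ys) (trans (cong (sum p +_) (dissolve-sum d)) (trans (sym (sum-++ p xs)) (trans (cong sum (sym eq)) (sums-to π)))))
  ω≥ : ∀ p ys {j} → j + 1 ≤ ones ys → suc j ≤ ones (p ++ ys)
  ω≥ p ys {j} lo = ≤-trans (≤-reflexive (+-comm 1 j)) (≤-trans lo (≤-trans (m≤n+m (ones ys) (ones p)) (≤-reflexive (sym (ones-++ p ys)))))
  bound : ∀ p ys {j} → length p ≡ m → j + 1 ≤ ones ys → (∀ {k} → j + 1 ≤ k → big k ys ≤ j) → big (ones (p ++ ys)) (p ++ ys) < ones (p ++ ys) + m
  bound p ys {j} lp lo f = ≤-trans (s≤s (≤-trans (≤-reflexive (big-++ ω p ys)) (+-mono-≤ (≤-trans (big≤length ω p) (≤-reflexive lp)) (f (≤-trans (≤-reflexive (+-comm j 1)) (ω≥ p ys lo))))))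
    (≤-trans (≤-reflexive (trans (sym (+-suc m j)) (+-comm m (suc j)))) (+-monoˡ-≤ m (ω≥ p ys lo)))
    where ω = ones (p ++ ys)

big-∷ʳ-1 : ∀ k xs → 0 < k → big k (xs ∷ʳ 1) ≤ length xs
big-∷ʳ-1 k xs k>0 = ≤-trans (≤-reflexive (trans (big-++ k xs (1 ∷ [])) (trans (cong (big k xs +_) (big-none (k>0 ∷ []))) (+-identityʳ _)))) (big≤length k xs)

-- This excludes the partition of 1, whose only part `short` would lower to 0.
first-positive : ∀ {n} x xs → 1 < n → Linked _≥_ (x ∷ xs) → All (_> 0) xs → suc x + sum xs ≡ n → 0 < x
first-positive (suc x) xs       _   _        _       _    = s≤s z≤n
first-positive zero    []       n>1 _        _       refl = ⊥-elim (1+n≰n n>1)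
first-positive zero    (y ∷ ys) _   (le ∷ _) (p ∷ _) _    = ⊥-elim (1+n≰n (≤-trans p le))

skipped-short : ∀ {m n} (π : Partition n) → 1 < n → numberOfParts π < m → ∃ λ ρ → CrankBelow m ρ × Matched m π ρ
skipped-short {m} {n} π n>1 lt with boundary-word π (≤-trans (n≤1+n 1) n>1)
... | w , bd@(boundary {[]} {i} refl en eq) = ⊥-elim (absurd i en)
  where
  absurd : ∀ i → true ∷ [] ≡ i ∷ʳ false → ⊥
  absurd []          ()
  absurd (_ ∷ [])    ()
  absurd (_ ∷ _ ∷ _) ()
... | w , bd@(boundary {true ∷ t} refl en eq) with ρ , b ← boundary-conjugate bd =
  ρ , inj₁ (double-ones {t = t} refl b , ≤-trans (s≤s (≤-reflexive (trans (boundary-largest b) (trans (cof-conjugate w) (sym (boundary-length bd)))))) lt) ,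
  double refl bd b (≤-trans (s≤s (≤-reflexive (sym (boundary-length bd)))) lt)
... | w , bd@(boundary {false ∷ t} refl en eq) = ρ , inj₂ (short-ones (cof t ∷ shape t) , bound) , short lt′ (sym eq) refl
  where
  pos : All (_> 0) (shape t)
  pos = All.tail (subst (All (_> 0)) (sym eq) (positive π))
  x>0 : 0 < cof t
  x>0 = first-positive (cof t) (shape t) n>1 (shape-linked t ≤-refl) pos (trans (cong sum eq) (sums-to π))
  ρ : Partition n
  ρ = partition (cof t ∷ shape t ∷ʳ 1) (linked-ones (shape t) 1 x>0 pos (shape-linked t ≤-refl)) (x>0 ∷ All.++⁺ pos (s≤s z≤n ∷ []))
        (trans (cong (cof t +_) (sum-++ (shape t) (1 ∷ []))) (trans (solve (cof t) (sum (shape t))) (trans (cong sum eq) (sums-to π))))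
    where
    solve : ∀ a b → a + (b + 1) ≡ suc a + b
    solve = solve-∀
  lt′ : suc (length (shape t)) < m
  lt′ = ≤-trans (s≤s (≤-reflexive (cong length eq))) lt
  bound : big (numberOfOnes ρ) (cof t ∷ shape t ∷ʳ 1) < numberOfOnes ρ + m
  bound = ≤-trans (s≤s (big-∷ʳ-1 (numberOfOnes ρ) (cof t ∷ shape t) (short-ones (cof t ∷ shape t)))) (≤-trans lt′ (m≤n+m m _))

big-split : ∀ k p {ys} → Linked _≥_ (p ++ ys) → big k p ≡ length p ⊎ big k ys ≡ 0
big-split k []      l = inj₁ refl
big-split k (x ∷ p) l with k <? x
... | no k≮x = inj₂ (big-none (proj₂ (All.++⁻ p (All.map (λ le → ≤-trans le (≮⇒≥ k≮x)) (linked-bounded l)))))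
... | yes k<x with big-split k p (Linked.tail l)
... | inj₁ eq = inj₁ (trans (big-accept {k} {x} {p} k<x) (cong suc eq))
... | inj₂ eq = inj₂ eq

ones-split : ∀ p {ys} → Linked _≥_ (p ++ ys) → 0 < ones p → All (_≤ 1) ys
ones-split (x ∷ p) l lt with x ℕ.≟ 1
... | yes refl = proj₂ (All.++⁻ p (linked-bounded l))
... | no x≢1   = ones-split p (Linked.tail l) (subst (0 <_) (ones-reject {x} {p} x≢1) lt)

-- If `p` contains a 1, then `ys` consists of ones. If not, the number of ones belongs to `ys`
-- alone. Then either all `m` parts of `p` exceed it and can be subtracted from both sides, or some
-- part does not and nothing in `ys` exceeds it.
ones-bound : ∀ p ys {m} → Linked _≥_ (p ++ ys) → All (_> 0) ys → 0 < length ys → length p ≡ m → 0 < ones (p ++ ys) →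
             big (ones (p ++ ys)) (p ++ ys) < ones (p ++ ys) + m → big (ones ys) ys + 1 ≤ ones ys
ones-bound p ys {m} l pos ne lp ω>0 lt with ones p in op | ones-++ p ys
ones-bound p (y ∷ ys) l pos@(q ∷ _) ne lp ω>0 lt | suc k | _
  with le ∷ les ← ones-split p l (≤-trans (s≤s z≤n) (≤-reflexive (sym op))) with refl ← ≤-antisym le q
  = ≤-trans (≤-reflexive (cong (_+ 1) (big-none (≤-trans (s≤s z≤n) ≤-refl ∷ All.map (λ z → ≤-trans z (s≤s z≤n)) les)))) (s≤s z≤n)
ones-bound p ys {m} l pos ne lp ω>0 lt | zero | eq with big-split (ones ys) p l
... | inj₂ none = ≤-trans (≤-reflexive (cong (_+ 1) none)) (subst (0 <_) eq ω>0)
... | inj₁ full = ≤-trans (≤-reflexive (+-comm _ 1)) (+-cancelˡ-≤ m _ _ (begin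
  m + suc (big (ones ys) ys)              ≡⟨ +-suc m _ ⟩
  suc (m + big (ones ys) ys)              ≡⟨ cong (λ z → suc (z + big (ones ys) ys)) (trans (sym lp) (sym full)) ⟩
  suc (big (ones ys) p + big (ones ys) ys) ≡⟨ cong suc (sym (big-++ (ones ys) p ys)) ⟩
  suc (big (ones ys) (p ++ ys))           ≤⟨ subst (λ z → big z (p ++ ys) < z + m) eq lt ⟩
  ones ys + m                             ≡⟨ +-comm (ones ys) m ⟩
  m + ones ys                             ∎))
  where open ≤-Reasoning

shape-one : ∀ i → 0 < ones (shape (i ∷ʳ true ∷ʳ false))
shape-one []          = s≤s z≤n
shape-one (true ∷ i)  = ≤-trans (shape-one i) (≤-trans (m≤n+m _ (ones (cof (i ∷ʳ true ∷ʳ false) ∷ []))) (≤-reflexive (sym (ones-++ (cof (i ∷ʳ true ∷ʳ false) ∷ []) _))))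
shape-one (false ∷ i) = shape-one i

-- Without a part 1 the word ends with two horizontal steps, which become two leading vertical steps
-- of the conjugate.
crank-double : ∀ {m n} (ρ : Partition n) → 0 < n → numberOfOnes ρ ≡ 0 → largestPart ρ < m → ∃ λ π → Skipped m π × Matched m π ρ
crank-double {m} ρ n>0 ω lt with boundary-word ρ n>0
... | w , bd@(boundary {init = []} st en eq) with () ← ∷-injectiveˡ (trans (sym st) en)
... | w , bd@(boundary {init = i@(_ ∷ _)} st en eq) with snoc i (s≤s z≤n)
... | j , true , eq′ = ⊥-elim (1+n≰n (≤-trans (shape-one j) (≤-reflexive (trans (cong ones (trans (cong (λ z → shape (z ∷ʳ false)) (sym eq′)) (trans (cong shape (sym en)) eq))) ω))))
... | j , false , eq′ with π , b ← boundary-conjugate bd = π , skip-short m (parts π) lt′ ,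
  double (trans (cong conjugate (trans en (cong (_∷ʳ false) eq′))) (trans (conjugate-++ (j ∷ʳ false) false []) (cong (true ∷_) (conjugate-++ j false []))))
    b (subst (Boundary ρ) (sym (conjugate-involutive w)) bd) (≤-trans (s≤s (≤-reflexive (sym (boundary-length b)))) lt′)
  where
  lt′ : numberOfParts π < m
  lt′ = ≤-trans (s≤s (≤-reflexive (trans (boundary-length b) (trans (cnt-conjugate w) (sym (boundary-largest bd)))))) lt

crank-short : ∀ {m n} (ρ : Partition n) → 1 < n → 0 < numberOfOnes ρ → numberOfParts ρ ≤ m → ∃ λ π → Skipped m π × Matched m π ρ
crank-short {m} ρ n>1 ω le with ones-suffix 1 (parts ρ) (weakly-decreasing ρ) (positive ρ) ω
... | [] , eq = ⊥-elim (1+n≰n (≤-trans n>1 (≤-reflexive (trans (sym (sums-to ρ)) (cong sum eq)))))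
... | x ∷ xs , eq = π , skip-short m (suc x ∷ xs) lt , short lt refl eq
  where
  lt : suc (length xs) < m
  lt = ≤-trans (≤-reflexive (cong suc (trans (+-comm 1 (length xs)) (sym (length-++ xs))))) (≤-trans (≤-reflexive (sym (cong length eq))) le)
  π = partition (suc x ∷ xs) (linked-relax xs (n≤1+n x) (linked-prefix x xs (subst (Linked _≥_) eq (weakly-decreasing ρ))))
        (s≤s z≤n ∷ All.tail (proj₁ (All.++⁻ (x ∷ xs) (subst (All (_> 0)) eq (positive ρ)))))
        (trans (sym (trans (cong (x +_) (sum-++ xs (1 ∷ []))) (solve x (sum xs)))) (trans (cong sum (sym eq)) (sums-to ρ)))
    where
    solve : ∀ a b → a + (b + 1) ≡ suc a + b
    solve = solve-∀

suffix-nonempty : ∀ {m} p (ys : List ℕ) → length p ≡ m → m < length (p ++ ys) → 0 < length ys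
suffix-nonempty p []      lp lt = ⊥-elim (1+n≰n (≤-trans lt (≤-reflexive (trans (cong length (++-identityʳ p)) lp))))
suffix-nonempty p (_ ∷ _) lp lt = s≤s z≤n

crank-long : ∀ {m n} (ρ : Partition n) → 0 < m → 0 < numberOfOnes ρ → m < numberOfParts ρ →
             numberOfPartsLargerThan (numberOfOnes ρ) ρ < numberOfOnes ρ + m → ∃ λ π → Skipped m π × Matched m π ρ
crank-long {m} ρ m>0 ω>0 lt G with split m (parts ρ) (≤-trans (n≤1+n m) lt)
... | p , ys , eq , lp
  with l ← subst (Linked _≥_) eq (weakly-decreasing ρ)
  with pos-p , pos-ys ← All.++⁻ p (subst (All (_> 0)) eq (positive ρ))
  with xs , d , pos-xs , f ← dissolve-onto 1 ys (linked-suffix p l) pos-ys (s≤s z≤n)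
         (ones-bound p ys l pos-ys (suffix-nonempty p ys lp (subst (λ z → m < length z) eq lt)) lp (subst (λ z → 0 < ones z) eq ω>0) (subst (λ z → big (ones z) z < ones z + m) eq G))
  = partition (p ++ xs) (linked-replace p pos-p (subst (0 <_) (sym lp) m>0) f l) (All.++⁺ pos-p pos-xs)
      (trans (sum-++ p xs) (trans (cong (sum p +_) (sym (dissolve-sum d))) (trans (sym (sum-++ p ys)) (trans (cong sum (sym eq)) (sums-to ρ))))) ,
    skip-++ m p xs lp (dissolve-occ d) , long lp d refl eq

skipped⇒crankBelow : ∀ {m n} → 0 < m → 1 < n → (π : Partition n) → Skipped m π → ∃ λ ρ → CrankBelow m ρ × Matched m π ρ
skipped⇒crankBelow {m} m>0 n>1 π s with m ≤? numberOfParts π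
... | yes le = skipped-long π m>0 le s
... | no ¬le = skipped-short π n>1 (≰⇒> ¬le)

crankBelow⇒skipped : ∀ {m n} → 0 < m → 1 < n → (ρ : Partition n) → CrankBelow m ρ → ∃ λ π → Skipped m π × Matched m π ρ
crankBelow⇒skipped m>0 n>1 ρ (inj₁ (ω , lt)) = crank-double ρ (≤-trans (n≤1+n 1) n>1) ω lt
crankBelow⇒skipped {m} m>0 n>1 ρ (inj₂ (ω , lt)) with numberOfParts ρ ≤? m
... | yes le = crank-short ρ n>1 ω le
... | no ¬le = crank-long ρ m>0 ω (≰⇒> ¬le) lt

-- The crank conditions as inequalities between integers

crank-no-ones : ∀ {n} (π : Partition n) → numberOfOnes π ≡ 0 → crank π ≡ ℤ.+ largestPart π
crank-no-ones π eq with numberOfOnes π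
crank-no-ones π refl | zero = refl

crank-ones : ∀ {n} (π : Partition n) → 0 < numberOfOnes π → crank π ≡ numberOfPartsLargerThan (numberOfOnes π) π ℤ.⊖ numberOfOnes π
crank-ones π lt with numberOfOnes π
crank-ones π lt | suc ω = ℤ.m-n≡m⊖n (numberOfPartsLargerThan (suc ω) π) (suc ω)

⊖<⁺ : ∀ {a b m} → a < b + m → a ℤ.⊖ b ℤ.< ℤ.+ m
⊖<⁺ {a} {b} {m} lt = ℤ.<-≤-trans (ℤ.⊖-monoˡ-< b lt) (ℤ.≤-reflexive (trans (ℤ.⊖-≥ (m≤m+n b m)) (cong ℤ.+_ (m+n∸m≡n b m))))

⊖<⁻ : ∀ {a b m} → a ℤ.⊖ b ℤ.< ℤ.+ m → a < b + m
⊖<⁻ {a} {b} {m} lt = ≰⇒> λ le → ℤ.<⇒≱ lt (ℤ.≤-trans (ℤ.≤-reflexive (sym (trans (ℤ.⊖-≥ (m≤m+n b m)) (cong ℤ.+_ (m+n∸m≡n b m))))) (ℤ.⊖-monoˡ-≤ b le))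

⊖≤-⁺ : ∀ {a b m} → a + m ≤ b → a ℤ.⊖ b ℤ.≤ ℤ.- ℤ.+ m
⊖≤-⁺ {a} {b} {m} le = ℤ.≤-trans (ℤ.⊖-monoʳ-≥-≤ a le) (ℤ.≤-reflexive (trans (ℤ.⊖-≤ (m≤m+n a m)) (cong (λ z → ℤ.- ℤ.+ z) (m+n∸m≡n a m))))

crankBelow⁺ : ∀ {m n} (π : Partition n) → CrankBelow m π → crank π ℤ.< ℤ.+ m
crankBelow⁺ π (inj₁ (ω , lt)) = ℤ.≤-<-trans (ℤ.≤-reflexive (crank-no-ones π ω)) (ℤ.+<+ lt)
crankBelow⁺ π (inj₂ (ω , lt)) = ℤ.≤-<-trans (ℤ.≤-reflexive (crank-ones π ω)) (⊖<⁺ lt)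

crankBelow⁻ : ∀ {m n} (π : Partition n) → crank π ℤ.< ℤ.+ m → CrankBelow m π
crankBelow⁻ {m} π lt with 0 <? numberOfOnes π
... | yes ω = inj₂ (ω , ⊖<⁻ (subst (ℤ._< ℤ.+ m) (crank-ones π ω) lt))
... | no ¬ω = inj₁ (ω , ℤ.drop‿+<+ (subst (ℤ._< ℤ.+ m) (crank-no-ones π ω) lt))
  where ω = n≤0⇒n≡0 (≮⇒≥ ¬ω)

atLeast? : ∀ {n} (stat : Partition n → ℤ.ℤ) k → Decidable (λ π → k ℤ.≤ stat π)
atLeast? stat k π = k ℤ.≤? stat π

atMost? : ∀ {n} (stat : Partition n → ℤ.ℤ) k → Decidable (λ π → stat π ℤ.≤ k)
atMost? stat k π = stat π ℤ.≤? k

crankBelow? : ∀ m {n} → Decidable (λ (π : Partition n) → crank π ℤ.< ℤ.+ m)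
crankBelow? m π = crank π ℤ.<? ℤ.+ m

crankBelow≤skipped : ∀ {m n} → 0 < m → 1 < n → count (crankBelow? m {n}) ≤ count (skipped? m {n})
crankBelow≤skipped {m} {n} m>0 n>1 = count-≤ {n} (crankBelow? m) (skipped? m) (λ ρ π → Matched m π ρ) matched-functional
  (λ ρ lt → crankBelow⇒skipped m>0 n>1 ρ (crankBelow⁻ ρ lt))

skipped≤crankBelow : ∀ {m n} → 0 < m → 1 < n → count (skipped? m {n}) ≤ count (crankBelow? m {n})
skipped≤crankBelow {m} {n} m>0 n>1 = count-≤ {n} (skipped? m) (crankBelow? m) (Matched m) matched-injective
  λ π s → let ρ , cb , r = skipped⇒crankBelow m>0 n>1 π s in ρ , crankBelow⁺ ρ cb , r

-- Inequalities between the numbers of partitions with bounded rank and crank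

count-complement : ∀ {n} {P Q : Pred (Partition n) 0ℓ} (P? : Decidable P) (Q? : Decidable Q) →
                   (∀ π → P π → ¬ Q π) → (∀ π → ¬ P π → Q π) → count P? + count Q? ≡ p n
count-complement {n} P? Q? excl cover = go (partitions n)
  where
  go : ∀ πs → length (filter P? πs) + length (filter Q? πs) ≡ length πs
  go [] = refl
  go (π ∷ πs) with P? π | Q? π
  ... | yes a | yes b = ⊥-elim (excl π a b)
  ... | yes a | no _  = cong suc (go πs)
  ... | no _  | yes b = trans (+-suc _ _) (cong suc (go πs))
  ... | no a  | no b  = ⊥-elim (b (cover π a))

complement-≤ : ∀ {a b c d N} → a + b ≡ N → c + d ≡ N → a ≤ c → d ≤ b
complement-≤ {a} {b} {c} {d} refl eq le = +-cancelˡ-≤ a d b (≤-trans (+-monoˡ-≤ d le) (≤-reflexive eq))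

crank-complement : ∀ m n → count (crankBelow? m {n}) + count (atLeast? {n} crank (ℤ.+ m)) ≡ p n
crank-complement m n = count-complement {n} (crankBelow? m) (atLeast? crank (ℤ.+ m)) (λ _ → ℤ.<⇒≱) (λ _ → ℤ.≮⇒≥)

occupied-complement : ∀ m n → count (unoccupied? m {n}) + count (occupied? m {n}) ≡ p n
occupied-complement m n = count-complement {n} (unoccupied? m) (occupied? m) (λ _ ¬o → ¬o) (λ π ¬¬o → decidable-stable (occupied? m π) ¬¬o)

occupied≤crank : ∀ m n → 1 < n → count (occupied? (suc m) {n}) ≤ count (atLeast? {n} crank (ℤ.+ suc m))
occupied≤crank m n n>1 = complement-≤ (crank-complement (suc m) n) (occupied-complement (suc m) n)
  (≤-trans (crankBelow≤skipped (s≤s z≤n) n>1) (skipped≤unoccupied m n (≤-trans (n≤1+n 1) n>1)))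

crank≤occupied : ∀ m n → 1 < n → count (atLeast? {n} crank (ℤ.+ suc m)) ≤ count (occupied? (suc m) {n})
crank≤occupied m n n>1 = complement-≤ (occupied-complement (suc m) n) (crank-complement (suc m) n)
  (≤-trans (unoccupied≤skipped m n (≤-trans (n≤1+n 1) n>1)) (skipped≤crankBelow (s≤s z≤n) n>1))

rank≡⊖ : ∀ {n} (π : Partition n) → rank π ≡ largestPart π ℤ.⊖ numberOfParts π
rank≡⊖ π = ℤ.m-n≡m⊖n (largestPart π) (numberOfParts π)

rankAtLeast⁻ : ∀ {m n} (π : Partition n) → ℤ.+ m ℤ.≤ rank π → RankAtLeast m π
rankAtLeast⁻ {m} π le = ≮⇒≥ λ lt → ℤ.<⇒≱ (ℤ.≤-<-trans (ℤ.≤-reflexive (rank≡⊖ π)) (⊖<⁺ lt)) le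

rankAtLeast⁺ : ∀ {m n} (π : Partition n) → RankAtLeast m π → ℤ.+ m ℤ.≤ rank π
rankAtLeast⁺ {m} π le = ℤ.≮⇒≥ λ lt → <⇒≱ (⊖<⁻ (subst (ℤ._< ℤ.+ m) (rank≡⊖ π) lt)) le

count-mono : ∀ {n} {P Q : Pred (Partition n) 0ℓ} (P? : Decidable P) (Q? : Decidable Q) → (∀ π → P π → Q π) → count P? ≤ count Q?
count-mono {n} P? Q? f = count-≤ {n} P? Q? _≡_ (λ { refl refl → refl }) (λ π a → π , f π a , refl)

rank≤crank : ∀ m n → 1 < n → count (atLeast? {n} rank (ℤ.+ suc m)) ≤ count (atLeast? {n} crank (ℤ.+ suc m))
rank≤crank m n n>1 = ≤-trans (count-mono {n} (atLeast? rank (ℤ.+ suc m)) (rankAtLeast? (suc m)) rankAtLeast⁻)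
  (≤-trans (rankAtLeast≤occupied m n) (occupied≤crank m n n>1))

crank≤rank : ∀ m n → 1 < n → count (atLeast? {n} crank (ℤ.+ suc (suc m))) ≤ count (atLeast? {n} rank (ℤ.+ suc m))
crank≤rank m n n>1 = ≤-trans (crank≤occupied (suc m) n n>1)
  (≤-trans (occupied≤rankAtLeast m n (≤-trans (n≤1+n 1) n>1)) (count-mono {n} (rankAtLeast? (suc m)) (atLeast? rank (ℤ.+ suc m)) rankAtLeast⁺))

decreasing-cons : ∀ {xs} → Linked _≥_ xs → ∃ λ h → Linked _≥_ (h ∷ xs)
decreasing-cons {[]}    l = 0 , [-]
decreasing-cons {x ∷ _} l = x , ≤-refl ∷ l

occupied≤negativeCrank : ∀ m n → count (occupied? (suc m) {n}) ≤ count (atMost? {n} crank (ℤ.- ℤ.+ suc m))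
occupied≤negativeCrank m n = count-≤ {n} (occupied? (suc m)) (atMost? crank (ℤ.- ℤ.+ suc m)) (λ π ρ → Dissolve (suc m) (parts π) (parts ρ))
  (λ {π} {π′} d d′ → Partition-ext (dissolve-injective d d′ (weakly-decreasing π) (weakly-decreasing π′) refl)) total
  where
  total : ∀ π → Occupied (suc m) π → ∃ λ (ρ : Partition n) → crank ρ ℤ.≤ ℤ.- ℤ.+ suc m × Dissolve (suc m) (parts π) (parts ρ)
  total π o with ys , d ← dissolve (weakly-decreasing π) o
    with j , ω≥ , f ← dissolve-crank (s≤s z≤n) (weakly-decreasing π) d
    with h , l ← decreasing-cons (weakly-decreasing π) =
    ρ , ℤ.≤-trans (ℤ.≤-reflexive (crank-ones ρ (≤-trans (≤-trans (s≤s z≤n) (m≤n+m (suc m) j)) ω≥))) (⊖≤-⁺ (≤-trans (+-monoˡ-≤ (suc m) (f ω≥)) ω≥)) , d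
    where
    ρ : Partition n
    ρ = partition ys (Linked.tail (dissolve-linked (s≤s z≤n) (positive π) d l)) (dissolve-positive d (positive π)) (trans (dissolve-sum d) (sums-to π))

-- Conjugation exchanges the largest part with the number of parts, so it negates the rank.
negativeRank≤rankAtLeast : ∀ m n → 0 < n → count (atMost? {n} rank (ℤ.- ℤ.+ m)) ≤ count (rankAtLeast? m {n})
negativeRank≤rankAtLeast m n n>0 = count-≤ {n} (atMost? rank (ℤ.- ℤ.+ m)) (rankAtLeast? m) Conjugate conjugate-unique total
  where
  total : ∀ π → rank π ℤ.≤ ℤ.- ℤ.+ m → ∃ λ ρ → RankAtLeast m ρ × Conjugate π ρ
  total π le with ρ , c@(w , b , b′) ← conjugate-total π n>0 = ρ , rankAtLeast⁻ ρ (ℤ.≤-trans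
    (ℤ.≤-trans (ℤ.≤-reflexive (sym (ℤ.neg-involutive (ℤ.+ m)))) (ℤ.neg-mono-≤ le)) (ℤ.≤-reflexive (trans (cong ℤ.-_ (rank≡⊖ π))
      (trans (sym (ℤ.⊖-swap (numberOfParts π) (largestPart π))) (trans (cong₂ ℤ._⊖_ eq₁ eq₂) (sym (rank≡⊖ ρ))))))) , c
    where
    eq₁ : numberOfParts π ≡ largestPart ρ
    eq₁ = trans (boundary-length b) (sym (trans (boundary-largest b′) (cof-conjugate w)))
    eq₂ : largestPart π ≡ numberOfParts ρ
    eq₂ = trans (boundary-largest b) (sym (trans (boundary-length b′) (cnt-conjugate w)))

negativeRank≤negativeCrank : ∀ m n → 0 < n → count (atMost? {n} rank (ℤ.- ℤ.+ suc m)) ≤ count (atMost? {n} crank (ℤ.- ℤ.+ suc m))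
negativeRank≤negativeCrank m n n>0 = ≤-trans (negativeRank≤rankAtLeast (suc m) n n>0) (≤-trans (rankAtLeast≤occupied m n) (occupied≤negativeCrank m n))

-- Sorted listings
module _ {A : Set} where

  filter-map-length : ∀ {B : Set} {P : Pred B 0ℓ} (P? : Decidable P) (f : A → B) xs →
                      length (filter P? (map f xs)) ≡ length (filter (P? ∘ f) xs)
  filter-map-length P? f []       = refl
  filter-map-length P? f (x ∷ xs) with P? (f x)
  ... | yes _ = cong suc (filter-map-length P? f xs)
  ... | no _  = filter-map-length P? f xs

  filter-≤ : ∀ {P Q : Pred A 0ℓ} (P? : Decidable P) (Q? : Decidable Q) → (∀ {x} → P x → Q x) → ∀ xs →
             length (filter P? xs) ≤ length (filter Q? xs)
  filter-≤ P? Q? f [] = z≤n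
  filter-≤ P? Q? f (x ∷ xs) with P? x | Q? x
  ... | yes _ | yes _ = s≤s (filter-≤ P? Q? f xs)
  ... | yes a | no ¬b = ⊥-elim (¬b (f a))
  ... | no _  | yes _ = m≤n⇒m≤1+n (filter-≤ P? Q? f xs)
  ... | no _  | no _  = filter-≤ P? Q? f xs

  filter-< : ∀ {P Q : Pred A 0ℓ} (P? : Decidable P) (Q? : Decidable Q) → (∀ {x} → P x → Q x) → ∀ {y xs} →
             y ∈ xs → Q y → ¬ P y → length (filter P? xs) < length (filter Q? xs)
  filter-< P? Q? f {xs = x ∷ xs} (here refl) q ¬p with P? x | Q? x
  ... | yes a | _     = ⊥-elim (¬p a)
  ... | no _  | yes _ = s≤s (filter-≤ P? Q? f xs)
  ... | no _  | no ¬q = ⊥-elim (¬q q)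
  filter-< P? Q? f {xs = x ∷ xs} (there y∈) q ¬p with P? x | Q? x
  ... | yes _ | yes _ = s≤s (filter-< P? Q? f y∈ q ¬p)
  ... | yes a | no ¬b = ⊥-elim (¬b (f a))
  ... | no _  | yes _ = m≤n⇒m≤1+n (filter-< P? Q? f y∈ q ¬p)
  ... | no _  | no _  = filter-< P? Q? f y∈ q ¬p

listing-↭ : ∀ {n} (l : Listing n) → map (to l) (allFin (p n)) ↭ partitions n
listing-↭ {n} l = ∼bag⇒↭ (unique∧set⇒bag (unique-map⁺ (injective l) (allFin⁺ (p n))) (partitions-unique n)
  (λ {π} → mk⇔ (λ _ → partitions-complete π) (λ _ → listed π)))
  where
  listed : ∀ π → π ∈ map (to l) (allFin (p n))
  listed π with i , eq ← surjective l π = subst (_∈ map (to l) (allFin (p n))) (eq refl) (∈-map⁺ (to l) (∈-allFin i))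

listing-count : ∀ {n} (l : Listing n) {P : Pred (Partition n) 0ℓ} (P? : Decidable P) → length (filter (P? ∘ to l) (allFin (p n))) ≡ count P?
listing-count {n} l P? = trans (sym (filter-map-length P? (to l) (allFin (p n)))) (↭-length (filter-↭ P? (listing-↭ l)))

listing-sum : ∀ {n} (l : Listing n) (f : Partition n → ℕ) → sum (map (f ∘ to l) (allFin (p n))) ≡ sum (map f (partitions n))
listing-sum {n} l f = trans (cong sum (map-∘ {g = f} {f = to l} (allFin (p n)))) (sum-↭ (↭-map⁺ f (listing-↭ l)))

-- An element of `P` outside `Q` would make `Q` a proper subset of `P` and contradict the counts.
dominate : ∀ {N} {P Q : Pred (Fin N) 0ℓ} (P? : Decidable P) (Q? : Decidable Q) →
           length (filter P? (allFin N)) ≤ length (filter Q? (allFin N)) →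
           (∀ {i j} → P i → ¬ Q i → Q j → P j) → ∀ i → P i → Q i
dominate P? Q? le closed i pi with Q? i
... | yes qi = qi
... | no ¬qi = ⊥-elim (<⇒≱ (filter-< Q? P? (closed pi ¬qi) (∈-allFin i) pi ¬qi) le)

module _ {n : ℕ} (s s′ : Partition n → ℤ.ℤ) (l l′ : Listing n) (sorted : WeaklyIncreasing s l) (sorted′ : WeaklyIncreasing s′ l′) where

  -- In a sorted listing the indices with a value of at least `k` form a final segment. Of two final
  -- segments the smaller one is contained in the other, so the counts decide.
  transfer-atLeast : ∀ k k′ → count (atLeast? s k) ≤ count (atLeast? s′ k′) → ∀ i → k ℤ.≤ s (to l i) → k′ ℤ.≤ s′ (to l′ i)
  transfer-atLeast k k′ le = dominate (atLeast? s k ∘ to l) (atLeast? s′ k′ ∘ to l′)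
    (subst₂ _≤_ (sym (listing-count l (atLeast? s k))) (sym (listing-count l′ (atLeast? s′ k′))) le) closed
    where
    closed : ∀ {i j} → k ℤ.≤ s (to l i) → ¬ k′ ℤ.≤ s′ (to l′ i) → k′ ℤ.≤ s′ (to l′ j) → k ℤ.≤ s (to l j)
    closed {i} {j} a ¬b c with Fin.≤-total i j
    ... | inj₁ i≤j = ℤ.≤-trans a (sorted i≤j)
    ... | inj₂ j≤i = ⊥-elim (¬b (ℤ.≤-trans c (sorted′ j≤i)))

  transfer-atMost : ∀ k k′ → count (atMost? s k) ≤ count (atMost? s′ k′) → ∀ i → s (to l i) ℤ.≤ k → s′ (to l′ i) ℤ.≤ k′
  transfer-atMost k k′ le = dominate (atMost? s k ∘ to l) (atMost? s′ k′ ∘ to l′)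
    (subst₂ _≤_ (sym (listing-count l (atMost? s k))) (sym (listing-count l′ (atMost? s′ k′))) le) closed
    where
    closed : ∀ {i j} → s (to l i) ℤ.≤ k → ¬ s′ (to l′ i) ℤ.≤ k′ → s′ (to l′ j) ℤ.≤ k′ → s (to l j) ℤ.≤ k
    closed {i} {j} a ¬b c with Fin.≤-total i j
    ... | inj₁ i≤j = ⊥-elim (¬b (ℤ.≤-trans (sorted′ i≤j) c))
    ... | inj₂ j≤i = ℤ.≤-trans (sorted j≤i) a

-- The case m = 0 of `M(≥m+1) ≤ N(≥m)`, needed so that a positive crank never meets a negative rank.
-- It is the complement of `N(≤-1) ≤ M(≤-1)`, as crank at most -1 excludes crank at least 1.
crank≤rank₀ : ∀ n → 1 < n → count (atLeast? {n} crank (ℤ.+ 1)) ≤ count (atLeast? {n} rank (ℤ.+ 0))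
crank≤rank₀ n n>1 = complement-≤
  (count-complement (atMost? {n} rank (ℤ.- ℤ.+ 1)) (atLeast? rank (ℤ.+ 0)) (λ _ a b → minus a b) (λ _ → minus′))
  (count-complement (λ π → ¬? (atLeast? {n} crank (ℤ.+ 1) π)) (atLeast? {n} crank (ℤ.+ 1)) (λ _ a → a) (λ π → decidable-stable (atLeast? crank (ℤ.+ 1) π)))
  (≤-trans (negativeRank≤negativeCrank 0 n (≤-trans (n≤1+n 1) n>1))
    (count-mono {n} (atMost? crank (ℤ.- ℤ.+ 1)) (λ π → ¬? (atLeast? crank (ℤ.+ 1) π)) (λ _ a b → minus a (ℤ.≤-trans (ℤ.+≤+ z≤n) b))))
  where
  minus : ∀ {i} → i ℤ.≤ ℤ.- ℤ.+ 1 → ¬ ℤ.+ 0 ℤ.≤ i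
  minus a b with () ← ℤ.≤-trans b a
  minus′ : ∀ {i} → ¬ i ℤ.≤ ℤ.- ℤ.+ 1 → ℤ.+ 0 ℤ.≤ i
  minus′ {ℤ.+ _}      _ = ℤ.+≤+ z≤n
  minus′ {ℤ.-[1+ _ ]} h = ⊥-elim (h (ℤ.-≤- z≤n))

-- Positive parts and their sums

pos : ℤ.ℤ → ℕ
pos (ℤ.+ n)      = n
pos ℤ.-[1+ _ ]   = 0

indicator : ∀ {P : Set} → Dec P → ℕ
indicator (yes _) = 1
indicator (no _)  = 0

indicator-yes : ∀ {P : Set} (d : Dec P) → P → indicator d ≡ 1
indicator-yes (yes _) _ = refl
indicator-yes (no ¬p) p = ⊥-elim (¬p p)

indicator-no : ∀ {P : Set} (d : Dec P) → ¬ P → indicator d ≡ 0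
indicator-no (yes p) ¬p = ⊥-elim (¬p p)
indicator-no (no _)  _  = refl

difference-one : ∀ c r → c ℤ.- r ≡ ℤ.+ 1 → c ≡ ℤ.+ 1 ℤ.+ r
difference-one c r eq = trans (sym (trans (ℤ.+-assoc c (ℤ.- r) r) (trans (cong (λ z → c ℤ.+ z) (ℤ.+-inverseˡ r)) (ℤ.+-identityʳ c)))) (cong (ℤ._+ r) eq)

pos-difference : ∀ c r →
  (∀ m → ℤ.+ suc m ℤ.≤ r → ℤ.+ suc m ℤ.≤ c) → (∀ m → ℤ.+ suc m ℤ.≤ c → ℤ.+ m ℤ.≤ r) → (∀ m → r ℤ.≤ ℤ.- ℤ.+ suc m → c ℤ.≤ ℤ.- ℤ.+ suc m) →
  pos c ≡ pos r + indicator ((c ℤ.- r) ℤ.≟ ℤ.+ 1)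
-- `β c` gives `c ≤ r`; if `r` is larger than `c`, then `α` at the value `r` forces it to be
-- `suc c`.
pos-difference (ℤ.+ suc c) (ℤ.+ r) α β γ with m≤n⇒m<n∨m≡n (ℤ.drop‿+≤+ (β c ℤ.≤-refl))
... | inj₂ refl = trans (+-comm 1 c) (cong (c +_) (sym (indicator-yes (_ ℤ.≟ _)
        (trans (ℤ.m-n≡m⊖n (suc c) c) (trans (ℤ.⊖-≥ (n≤1+n c)) (cong ℤ.+_ (m+n∸n≡m 1 c)))))))
pos-difference (ℤ.+ suc c) (ℤ.+ suc r) α β γ | inj₁ (s≤s c≤r) with refl ← ≤-antisym c≤r (s≤s⁻¹ (ℤ.drop‿+≤+ (α r ℤ.≤-refl))) =
  trans (sym (+-identityʳ (suc c))) (cong (suc c +_) (sym (indicator-no (_ ℤ.≟ _) λ eq → 1+n≢n (sym (ℤ.+-injective (difference-one (ℤ.+ suc c) (ℤ.+ suc c) eq))))))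
pos-difference (ℤ.+ suc c) ℤ.-[1+ r ] α β γ with () ← β c ℤ.≤-refl
pos-difference (ℤ.+ zero) (ℤ.+ suc r) α β γ with ℤ.+≤+ () ← α r ℤ.≤-refl
pos-difference (ℤ.+ zero) (ℤ.+ zero)  α β γ = refl
pos-difference (ℤ.+ zero) ℤ.-[1+ r ]  α β γ with () ← γ r ℤ.≤-refl
pos-difference ℤ.-[1+ c ] (ℤ.+ suc r) α β γ with () ← α r ℤ.≤-refl
pos-difference ℤ.-[1+ c ] (ℤ.+ zero)  α β γ = refl
pos-difference ℤ.-[1+ c ] ℤ.-[1+ r ]  α β γ with ℤ.-≤- r≤c ← γ r ℤ.≤-refl =
  sym (indicator-no (_ ℤ.≟ _) λ eq → absurd (difference-one ℤ.-[1+ c ] ℤ.-[1+ r ] eq))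
  where
  absurd : ℤ.-[1+ c ] ≢ ℤ.+ 1 ℤ.+ ℤ.-[1+ r ]
  absurd eq = ℤ.<⇒≱ (ℤ.<-≤-trans (ℤ.≤∧≢⇒< (ℤ.i≤suc[i] ℤ.-[1+ r ]) ℤ.i≢suc[i]) (ℤ.≤-reflexive (sym eq))) (ℤ.-≤- r≤c)

length-filter-indicator : ∀ {A : Set} {P : Pred A 0ℓ} (P? : Decidable P) xs → length (filter P? xs) ≡ sum (map (indicator ∘ P?) xs)
length-filter-indicator P? [] = refl
length-filter-indicator P? (x ∷ xs) with P? x
... | yes _ = cong suc (length-filter-indicator P? xs)
... | no _  = length-filter-indicator P? xs

sum-map-+ : ∀ {A : Set} (f g : A → ℕ) xs → sum (map (λ x → f x + g x) xs) ≡ sum (map f xs) + sum (map g xs)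
sum-map-+ f g []       = refl
sum-map-+ f g (x ∷ xs) = trans (cong (f x + g x +_) (sum-map-+ f g xs)) (solve (f x) (g x) (sum (map f xs)) (sum (map g xs)))
  where
  solve : ∀ a b c d → a + b + (c + d) ≡ a + c + (b + d)
  solve = solve-∀

sum-upTo : ∀ (f : ℕ → ℕ) k → sum (map f (upTo (suc k))) ≡ sum (map f (upTo k)) + f k
sum-upTo f k = trans (cong (sum ∘ map f) (sym (upTo-∷ʳ k))) (trans (cong sum (map-++ f (upTo k) (k ∷ [])))
  (trans (sum-++ (map f (upTo k)) (f k ∷ [])) (cong (λ z → sum (map f (upTo k)) + z) (+-identityʳ (f k)))))

moment₁ : ∀ x k → pos x < k → sum (map (λ m → m * indicator (x ℤ.≟ ℤ.+ m)) (upTo k)) ≡ pos x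
moment₁ x k lt = above x k lt
  where
  term : ℤ.ℤ → ℕ → ℕ
  term x m = m * indicator (x ℤ.≟ ℤ.+ m)
  zero-term : ∀ x m → x ≢ ℤ.+ m → term x m ≡ 0
  zero-term x m ne = trans (cong (m *_) (indicator-no (x ℤ.≟ ℤ.+ m) ne)) (*-zeroʳ m)
  below : ∀ x k → (∀ m → m < k → x ≢ ℤ.+ m) → sum (map (term x) (upTo k)) ≡ 0
  below x zero    _ = refl
  below x (suc k) f = trans (sum-upTo (term x) k) (cong₂ _+_ (below x k (λ m lt → f m (m≤n⇒m≤1+n lt))) (zero-term x k (f k ≤-refl)))
  above : ∀ x k → pos x < k → sum (map (term x) (upTo k)) ≡ pos x
  above ℤ.-[1+ j ] k _ = below ℤ.-[1+ j ] k (λ _ _ ())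
  above (ℤ.+ j) (suc k) (s≤s j≤k) with m≤n⇒m<n∨m≡n j≤k
  ... | inj₁ j<k  = trans (sum-upTo (term (ℤ.+ j)) k) (trans (cong₂ _+_ (above (ℤ.+ j) k j<k) (zero-term (ℤ.+ j) k (λ { refl → 1+n≰n j<k }))) (+-identityʳ j))
  ... | inj₂ refl = trans (sum-upTo (term (ℤ.+ j)) j) (cong₂ _+_ (below (ℤ.+ j) j (λ { m m<j refl → 1+n≰n m<j }))
                      (trans (cong (j *_) (indicator-yes (ℤ.+ j ℤ.≟ ℤ.+ j) refl)) (*-identityʳ j)))

-- By interchanging the sums, each `x` contributes its value once if that is nonnegative and nothing
-- otherwise; the bound keeps the value in the range `upTo k`.
moment : ∀ {A : Set} (stat : A → ℤ.ℤ) k xs → (∀ x → pos (stat x) < k) →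
         sum (map (λ m → m * length (filter (λ x → stat x ℤ.≟ ℤ.+ m) xs)) (upTo k)) ≡ sum (map (pos ∘ stat) xs)
moment stat k []       bound = zeros (upTo k)
  where
  zeros : ∀ ms → sum (map (λ m → m * 0) ms) ≡ 0
  zeros []       = refl
  zeros (m ∷ ms) = cong₂ _+_ (*-zeroʳ m) (zeros ms)
moment stat k (x ∷ xs) bound = trans (cong sum (map-cong term (upTo k))) (trans (sum-map-+ _ _ (upTo k))
  (cong₂ _+_ (moment₁ (stat x) k (bound x)) (moment stat k xs bound)))
  where
  term : ∀ m → m * length (filter (λ x → stat x ℤ.≟ ℤ.+ m) (x ∷ xs)) ≡ m * indicator (stat x ℤ.≟ ℤ.+ m) + m * length (filter (λ x → stat x ℤ.≟ ℤ.+ m) xs)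
  term m = trans (cong (m *_) (trans (length-filter-indicator P? (x ∷ xs)) (cong (indicator (P? x) +_) (sym (length-filter-indicator P? xs))))) (*-distribˡ-+ m _ _)
    where P? = λ x → stat x ℤ.≟ ℤ.+ m

pos-< : ∀ {x n} → x ℤ.≤ ℤ.+ n → pos x < suc n
pos-< {ℤ.+ _}      (ℤ.+≤+ le) = s≤s le
pos-< {ℤ.-[1+ _ ]} _          = s≤s z≤n

open import Data.Integer using (+_; _-_; _≟_)

theorem1p8 : (n : ℕ) → n > 1 → (τ : Partition n ⤖ Partition n) → MatchesCrankWithRank τ →
    ospt n ≡ + count (λ π → (crank π - rank (Bijection.to τ π)) ≟ + 1)
theorem1p8 n n>1 τ matching = trans (cong₂ (λ a b → ℤ.+ a ℤ.- ℤ.+ b) cranks ranks)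
  (trans (ℤ.m-n≡m⊖n (B + K) B) (trans (ℤ.⊖-≥ (m≤m+n B K)) (cong ℤ.+_ (m+n∸m≡n B K))))
  where
  open MatchesCrankWithRank matching
  D? : Decidable (λ π → crank π ℤ.- rank (to τ π) ≡ ℤ.+ 1)
  D? π = (crank π ℤ.- rank (to τ π)) ℤ.≟ ℤ.+ 1
  K = count D?
  -- Both moments are taken along the sorted listings, where they can be compared index by index:
  -- the one of the crank is `B` plus the number of indices with difference 1.
  B = sum (map (pos ∘ rank ∘ to byRank) (allFin (p n)))
  pointwise : ∀ i → pos (crank (to byCrank i)) ≡ pos (rank (to byRank i)) + indicator (D? (to byCrank i))
  pointwise i = subst (λ π → pos (crank (to byCrank i)) ≡ pos (rank (to byRank i)) + indicator ((crank (to byCrank i) ℤ.- rank π) ℤ.≟ ℤ.+ 1)) (sym (matches i))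
    (pos-difference (crank (to byCrank i)) (rank (to byRank i))
      (λ m → transfer-atLeast rank crank byRank byCrank rank-sorted crank-sorted _ _ (rank≤crank m n n>1) i)
      (λ { zero    → transfer-atLeast crank rank byCrank byRank crank-sorted rank-sorted _ _ (crank≤rank₀ n n>1) i
         ; (suc m) → transfer-atLeast crank rank byCrank byRank crank-sorted rank-sorted _ _ (crank≤rank m n n>1) i })
      (λ m → transfer-atMost rank crank byRank byCrank rank-sorted crank-sorted _ _ (negativeRank≤negativeCrank m n (≤-trans (n≤1+n 1) n>1)) i))
  ranks : sum (map (λ m → m * N (ℤ.+ m) n) (upTo (suc n))) ≡ B
  ranks = trans (moment rank (suc n) (partitions n) (λ π → pos-< (rank≤n π))) (sym (listing-sum byRank (pos ∘ rank)))
  cranks : sum (map (λ m → m * M (ℤ.+ m) n) (upTo (suc n))) ≡ B + K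
  cranks = trans (moment crank (suc n) (partitions n) (λ π → pos-< (crank≤n π))) (trans (sym (listing-sum byCrank (pos ∘ crank)))
    (trans (cong sum (map-cong pointwise (allFin (p n)))) (trans (sum-map-+ _ _ (allFin (p n)))
      (cong (λ z → B + z) (trans (sym (length-filter-indicator (D? ∘ to byCrank) (allFin (p n)))) (listing-count byCrank D?))))))
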